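{- Let $X\in\mathbb{R}^{n\times m}$ with $m\ge n$ and $\mathrm{rank}(X)=n$, and let $\eta>0$. Upon termination, Algorithm 5 (described in the context) outputs a set $\mathcal S\subseteq[m]$ of cardinality $n$ such that $$\|X_{\mathcal S}^{ -1}\|_F^2\le(1+\eta)(m-n+1)\|X^{\dagger}\|_F^2\quad\text{and}\quad\|X_{\mathcal S}^{ -1}\|_2^2\le(1+\eta)(m-n+1)\,n\,\|X^{\dagger}\|_2^2 .$$ For every $0<\delta<1$, with probability at least $1-\delta$ the algorithm terminates after $O\big(mn^3\log(1/\delta)/\log(1+\eta)\big)$ arithmetic operations.
   Context: $[m]=\{1,\dots,m\}$; $X_{\mathcal S}$ is the submatrix of columns indexed by $\mathcal S$; $A^\dagger$ pseudo-inverse; $\|\cdot\|_2,\|\cdot\|_F$ spectral and Frobenius norms. $\mathrm{VolSamp}(X,n)$ is the distribution on subsets $\mathcal T\subseteq[m]$ with $|\mathcal T|=n$ given by $\Pr(\mathcal T)\propto\det(X_{\mathcal T}X_{\mathcal T}^T)$. It is assumed (as provided by the VolumeSample procedure of Guruswami–Sinop) that an exact sample from $\mathrm{VolSamp}(X,n)$ can be drawn using $O(n^3m)$ operations. Algorithm 5: let $\alpha=(1+\eta)(m-n+1)\|X^\dagger\|_F^2$. Repeat: draw $\mathcal S\sim\mathrm{VolSamp}(X,n)$ (independently of previous draws), until $\|X_{\mathcal S}^{ -1}\|_F^2\le\alpha$. Output $\mathcal S$.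
   Formalization: The operation bound is proved as O(mn³·max(1, log(1/δ)/log(1+η))): with a uniform constant the stated bound fails when log(1/δ)/log(1+η) is near 0 (for example n=m=1, δ=1/2, η→∞), since at least one draw and test are always made. -}

module Defs where

open import Level using (0ℓ)
open import Algebra.Bundles using (CommutativeRing)
open import Axiom.ExcludedMiddle using (ExcludedMiddle)
open import Data.Bool.Base using (if_then_else_)
open import Data.Fin.Base using (Fin; zero; suc; toℕ; punchIn)
open import Data.Fin.Properties using () renaming (_≟_ to _≟ᶠ_)
open import Data.Fin.Subset using (Subset; inside; outside; ∣_∣)
open import Data.Maybe.Base using (Maybe; just; nothing; maybe)
import Data.Maybe.Base as Maybe
open import Data.Nat.Base as ℕ using (ℕ; zero; suc)
open import Data.Nat.Properties using () renaming (_≟_ to _≟ⁿ_)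
open import Data.Product.Base using (Σ-syntax; ∃; ∃₂; _×_; _,_; proj₁; proj₂; map₂)
open import Data.Vec.Base using (Vec; []; _∷_)
open import Data.Vec.Functional using (Vector)
open import Relation.Binary.Bundles using (TotalOrder)
open import Relation.Binary.PropositionalEquality.Core using (_≡_)
open import Relation.Binary.Structures using (IsTotalOrder)
open import Relation.Nullary.Decidable.Core using (Dec; yes; no; does)
open import Relation.Nullary.Negation.Core using (¬_)

-- The real numbers, characterised up to isomorphism as the complete ordered
-- field. As in the library's algebra bundles, equality is the setoid
-- equality _≈_.
record CompleteOrderedField : Set₁ where
  infix 4 _≤_ _<_
  infix 8 _⁻¹
  field
    commutativeRing : CommutativeRing 0ℓ 0ℓ
  open CommutativeRing commutativeRing public
  field
    0≉1          : ¬ 0# ≈ 1#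
    -- Total, with an unspecified value at 0#.
    _⁻¹          : Carrier → Carrier
    ⁻¹-cong      : ∀ {x y} → x ≈ y → x ⁻¹ ≈ y ⁻¹
    *-inverseʳ   : ∀ {x} → ¬ x ≈ 0# → x * x ⁻¹ ≈ 1#
    _≤_          : Carrier → Carrier → Set
    isTotalOrder : IsTotalOrder _≈_ _≤_
    +-monoˡ-≤    : ∀ z {x y} → x ≤ y → x + z ≤ y + z
    *-nonNeg     : ∀ {x y} → 0# ≤ x → 0# ≤ y → 0# ≤ x * y

  _<_ : Carrier → Carrier → Set
  x < y = x ≤ y × ¬ x ≈ y

  IsUpperBound : (Carrier → Set) → Carrier → Set
  IsUpperBound P b = ∀ {x} → P x → x ≤ b

  IsSup : (Carrier → Set) → Carrier → Set
  IsSup P s = IsUpperBound P s × (∀ {b} → IsUpperBound P b → s ≤ b)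

  field
    complete : (P : Carrier → Set) → ∃ P → ∃ (IsUpperBound P) → ∃ (IsSup P)

  totalOrder : TotalOrder 0ℓ 0ℓ 0ℓ
  totalOrder = record { isTotalOrder = isTotalOrder }

module Theory (em : ExcludedMiddle 0ℓ) (reals : CompleteOrderedField) where

  open CompleteOrderedField reals public
    renaming (Carrier to ℝ)
    using ( _≈_; _+_; _*_; -_; _-_; 0#; 1#; _⁻¹; _≤_; _<_; IsSup
          ; semiring; +-monoid; totalOrder )
  open import Algebra.Properties.Semiring.Sum semiring public using (sum; sum-syntax)
  open import Algebra.Properties.Semiring.Exp semiring public using (_^_)
  open import Algebra.Properties.Monoid.Mult +-monoid using () renaming (_×_ to _·_)
  open import Algebra.Construct.NaturalChoice.Max totalOrder public using (_⊔_)

  infixl 7 _/_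
  infix  8 √_
  infixl 7 _⊗_
  infix  4 _≋_
  infix  9 _ᵀ _⁺ _†

  _/_ : ℝ → ℝ → ℝ
  x / y = x * y ⁻¹

  fromℕ : ℕ → ℝ
  fromℕ k = k · 1#

  -- Used for partial notions such as suprema and matrix inverses: an element
  -- satisfying P if there is one, and the given default otherwise.
  choose : {A : Set} → A → (A → Set) → A
  choose {A} a P = go em
    where
    go : Dec (∃ P) → A
    go (yes (x , _)) = x
    go (no  _)       = a

  sup : (ℝ → Set) → ℝ
  sup P = choose 0# (IsSup P)

  √_ : ℝ → ℝ
  √ x = choose 0# λ t → 0# ≤ t × t * t ≈ x

  -- A logarithm to an arbitrary base b > 1: a strictly increasing
  -- homomorphism from (ℝ>0, ·) to (ℝ, +). Its values outside ℝ>0 are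
  -- irrelevant.
  record IsLogarithm (log : ℝ → ℝ) : Set where
    field
      log-cong : ∀ {x y} → 0# < x → x ≈ y → log x ≈ log y
      log-*    : ∀ {x y} → 0# < x → 0# < y → log (x * y) ≈ log x + log y
      log-mono : ∀ {x y} → 0# < x → x < y → log x < log y

  -- Matrices

  Matrix : ℕ → ℕ → Set
  Matrix n m = Fin n → Fin m → ℝ

  private variable
    k l m n : ℕ

  _≋_ : Matrix n m → Matrix n m → Set
  A ≋ B = ∀ i j → A i j ≈ B i j

  _⊗_ : Matrix n m → Matrix m l → Matrix n l
  (A ⊗ B) i j = ∑[ k < _ ] (A i k * B k j)

  _ᵀ : Matrix n m → Matrix m n
  (A ᵀ) i j = A j i

  𝟎 : Matrix n m
  𝟎 _ _ = 0#

  𝟏 : Matrix n n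
  𝟏 i j = if does (i ≟ᶠ j) then 1# else 0#

  _·ᵛ_ : Matrix n m → Vector ℝ m → Vector ℝ n
  (A ·ᵛ v) i = ∑[ j < _ ] (A i j * v j)

  det : Matrix n n → ℝ
  det {zero}  A = 1#
  det {suc n} A =
    ∑[ j < suc n ] ((- 1#) ^ toℕ j * A zero j * det λ i k → A (suc i) (punchIn j k))

  -- Independence of the indexed family of columns: in particular a repeated
  -- column makes the family dependent.
  IndependentColumns : Matrix n m → Set
  IndependentColumns A = ∀ v → (∀ i → (A ·ᵛ v) i ≈ 0#) → ∀ j → v j ≈ 0#

  -- The rank is the largest number of linearly independent columns.
  HasRank : Matrix n m → ℕ → Set
  HasRank {m = m} A r =
      (Σ[ c ∈ (Fin r → Fin m) ] IndependentColumns λ i j → A i (c j))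
    × (∀ s (c : Fin s → Fin m) → IndependentColumns (λ i j → A i (c j)) → s ℕ.≤ r)

  -- Formally rectangular, because the number of columns of X_𝒮 equals n only
  -- propositionally; a two-sided inverse forces n ≡ k.
  IsInverse : Matrix n k → Matrix k n → Set
  IsInverse A B = A ⊗ B ≋ 𝟏 × B ⊗ A ≋ 𝟏

  Invertible : Matrix n k → Set
  Invertible A = ∃ (IsInverse A)

  _⁺ : Matrix n k → Matrix k n
  A ⁺ = choose 𝟎 (IsInverse A)

  -- Moore–Penrose pseudo-inverse.
  IsPseudoInverse : Matrix n m → Matrix m n → Set
  IsPseudoInverse A B =
      A ⊗ B ⊗ A ≋ A
    × B ⊗ A ⊗ B ≋ B
    × (A ⊗ B) ᵀ ≋ A ⊗ B
    × (B ⊗ A) ᵀ ≋ B ⊗ A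

  _† : Matrix n m → Matrix m n
  A † = choose 𝟎 (IsPseudoInverse A)

  ‖_‖ : Vector ℝ n → ℝ
  ‖ v ‖ = √ (∑[ i < _ ] (v i * v i))

  ‖_‖F : Matrix n m → ℝ
  ‖ A ‖F = √ (∑[ i < _ ] ∑[ j < _ ] (A i j * A i j))

  ‖_‖₂ : Matrix n m → ℝ
  ‖ A ‖₂ = sup λ t → ∃ λ v → ‖ v ‖ ≤ 1# × t ≈ ‖ A ·ᵛ v ‖

  -- Volume sampling

  -- The elements of a subset in increasing order.
  element : (T : Subset m) → Fin ∣ T ∣ → Fin m
  element (inside  ∷ T) zero    = zero
  element (inside  ∷ T) (suc i) = suc (element T i)
  element (outside ∷ T) i       = suc (element T i)

  columns : Matrix n m → (T : Subset m) → Matrix n ∣ T ∣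
  columns X T i j = X i (element T j)

  sumSubsets : (Subset m → ℝ) → ℝ
  sumSubsets {zero}  f = f []
  sumSubsets {suc m} f =
    sumSubsets (λ T → f (inside ∷ T)) + sumSubsets (λ T → f (outside ∷ T))

  volume : Matrix n m → Subset m → ℝ
  volume {n} X T =
    if does (∣ T ∣ ≟ⁿ n) then det (columns X T ⊗ columns X T ᵀ) else 0#

  -- The probability mass function of VolSamp(X, n), n being the number of
  -- rows of X.
  volSamp : Matrix n m → Subset m → ℝ
  volSamp X T = volume X T / sumSubsets (volume X)

  -- Expectation over k independent draws from the mass function p.
  expect : (Subset m → ℝ) → (k : ℕ) → (Vec (Subset m) k → ℝ) → ℝ
  expect p zero    f = f []
  expect p (suc k) f = sumSubsets λ T → p T * expect p k λ Ts → f (T ∷ Ts)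

  prob : (Subset m → ℝ) → (k : ℕ) → (Vec (Subset m) k → Set) → ℝ
  prob p k E = expect p k λ Ts → if does (em {E Ts}) then 1# else 0#

  -- The probability, for an infinite sequence of independent draws, that some
  -- finite prefix satisfies E. For E closed under extension of the prefix, as
  -- below, continuity of measure makes this the supremum of the
  -- finite-horizon probabilities.
  prob∞ : (Subset m → ℝ) → (∀ {k} → Vec (Subset m) k → Set) → ℝ
  prob∞ p E = sup λ q → ∃ λ k → q ≈ prob p k E

  -- Arithmetic programs

  data Op : Set where
    add subtract multiply divide : Op

  ⟦_⟧ : Op → ℝ → ℝ → ℝ
  ⟦ add      ⟧ = _+_
  ⟦ subtract ⟧ = _-_
  ⟦ multiply ⟧ = _*_
  ⟦ divide   ⟧ = _/_

  -- Algebraic computation trees on real registers indexed by V. An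
  -- instruction producing a value extends the register set by nothing : Maybe V;
  -- a program cannot inspect its registers except by arithmetic and by
  -- comparisons.
  data Program (V : Set) : Set where
    output  : V → Program V
    numeral : ℕ → Program (Maybe V) → Program V
    compute : Op → V → V → Program (Maybe V) → Program V
    -- Continue with the first program if x ≤ y, and with the second otherwise.
    compare : V → V → Program V → Program V → Program V

  -- The output, and the number of arithmetic operations and comparisons
  -- performed.
  run : {V : Set} → Program V → (V → ℝ) → ℝ × ℕ
  run (output x)        ρ = ρ x , 0
  run (numeral a P)     ρ = run P (maybe ρ (fromℕ a))
  run (compute o x y P) ρ = map₂ suc (run P (maybe ρ (⟦ o ⟧ (ρ x) (ρ y))))
  run (compare x y P Q) ρ =
    map₂ suc (if does (em {ρ x ≤ ρ y}) then run P ρ else run Q ρ)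

  entries : Matrix n m → Fin n × Fin m → ℝ
  entries A (i , j) = A i j

  -- Programs for the two norms the algorithm evaluates exactly. Every draw of
  -- positive probability gives an invertible X_𝒮, so nothing is required of
  -- invNorm² on singular matrices.
  record Subroutines : Set where
    field
      invNorm²  : ∀ n k → Program (Fin n × Fin k)
      pinvNorm² : ∀ n m → Program (Fin n × Fin m)

      invNorm²-correct : ∀ {n k} (A : Matrix n k) → 1 ℕ.≤ n → Invertible A →
        proj₁ (run (invNorm² n k) (entries A)) ≈ ‖ A ⁺ ‖F ^ 2
      pinvNorm²-correct : ∀ {n m} (X : Matrix n m) → 1 ℕ.≤ n → HasRank X n →
        proj₁ (run (pinvNorm² n m) (entries X)) ≈ ‖ X † ‖F ^ 2

  -- (1 + η)(m - n + 1)a; the truncated subtraction is exact for n ≤ m.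
  threshold : ℕ → ℕ → ℝ → ℝ → ℝ
  threshold n m η a = (1# + η) * fromℕ (m ℕ.∸ n ℕ.+ 1) * a

  -- The loop "draw 𝒮 until ‖X_𝒮⁻¹‖F² ≤ α" on the given successive draws, each of
  -- which costs d operations: the output together with the number of
  -- operations, or nothing if the loop is still running after these draws.
  -- One operation is charged for the comparison with α.
  loop : Subroutines → (d : ℕ) → Matrix n m → (α : ℝ) →
         Vec (Subset m) k → Maybe (Subset m × ℕ)
  loop S d X α []       = nothing
  loop {n} S d X α (T ∷ Ts) =
    let (a , t) = run (Subroutines.invNorm² S n ∣ T ∣) (entries (columns X T))
        cost    = d ℕ.+ t ℕ.+ 1
    in if does (em {a ≤ α})
       then just (T , cost)
       else Maybe.map (map₂ (cost ℕ.+_)) (loop S d X α Ts)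

  -- Five operations are charged for forming α from η, m, n and ‖X†‖F².
  algorithm : Subroutines → (d : ℕ) → Matrix n m → (η : ℝ) →
              Vec (Subset m) k → Maybe (Subset m × ℕ)
  algorithm {n} {m} S d X η Ts =
    let (a , t) = run (Subroutines.pinvNorm² S n m) (entries X)
    in Maybe.map (map₂ (t ℕ.+ 5 ℕ.+_)) (loop S d X (threshold n m η a) Ts)

  TerminatesWithin : Subroutines → (d : ℕ) → Matrix n m → (η : ℝ) → (b : ℝ) →
                     Vec (Subset m) k → Set
  TerminatesWithin S d X η b Ts =
    ∃₂ λ T t → algorithm S d X η Ts ≡ just (T , t) × fromℕ t ≤ b

-- Let w be the wedge product of the rows x₁, …, xₙ of X in the exterior algebra
-- of ℝᵐ. Its coefficient at a set T of n columns is det X_T, so T is drawn with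
-- probability w(T)² / ‖w‖². The columns y₁, …, yₙ of X† form the dual basis of
-- the rows within their span. The contraction of w with a vector b depends only
-- on the products of b with the rows, so y_i may be replaced by the i-th column
-- of X_T⁻¹ extended by zero, whence
--   ‖X_T⁻¹‖F² w(T)² = Σ_i Σ_{j ∈ T} (y_i ⌟ w)(T \ {j})².
-- Summed over T, every set of n − 1 columns occurs m − n + 1 times on the right,
-- and ‖y_i ⌟ w‖² = ‖y_i‖² ‖w‖² because y_i ∧ w = 0; hence the mean of ‖X_T⁻¹‖F²
-- is at most (m − n + 1) ‖X†‖F². By Markov's inequality a draw is rejected with
-- probability at most 1 / (1 + η), and ⌈log (1/δ) / log (1 + η)⌉ draws suffice.
-- Both norms are evaluated by Gram–Schmidt on [X | 𝟏], which needs no pivoting.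

module Submission where

open import Defs
open import Level using (0ℓ)
open import Algebra.Solver.Ring.AlmostCommutativeRing using (fromCommutativeRing; _-Raw-AlmostCommutative⟶_)
open import Axiom.ExcludedMiddle using (ExcludedMiddle)
open import Data.Bool.Base using (if_then_else_; true; false)
open import Data.Empty using (⊥-elim)
open import Data.Fin.Base using (Fin; zero; suc; toℕ; punchIn; combine; remQuot)
open import Data.Fin.Properties using (remQuot-combine) renaming (_≟_ to _≟ᶠ_)
open import Data.Fin.Subset using (Subset; inside; outside; ∣_∣) renaming (⊤ to full; ⊥ to empty)
open import Data.Fin.Subset.Properties using (∣p∣≤n)
open import Data.Integer.Base as ℤ using (ℤ; +_; -[1+_]; _⊖_)
import Data.Integer.Properties as ℤ
open import Data.Maybe.Base as Maybe using (Maybe; just; nothing; maybe)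
open import Data.Nat.Base as ℕ using (ℕ; zero; suc)
import Data.Nat.Properties as ℕ
open import Data.Nat.Solver using (module +-*-Solver)
open import Data.Product.Base using (Σ-syntax; ∃; ∃₂; _×_; _,_; proj₁; proj₂; map₂; uncurry)
open import Data.Sum.Base as Sum using (_⊎_; inj₁; inj₂; [_,_]′)
open import Data.Vec.Base using (Vec; []; _∷_)
open import Data.Vec.Functional as Vector using (Vector)
open import Data.Vec.Relation.Unary.All as All using (All; []; _∷_)
open import Function.Base using (_∘_; id)
open import Relation.Binary.Bundles using (TotalOrder)
open import Relation.Binary.PropositionalEquality.Core as ≡ using (_≡_; _≢_)
open import Relation.Nullary.Decidable.Core using (Dec; yes; no; does)
open import Relation.Nullary.Negation.Core using (¬_; contradiction)

-- The transposes of X† and of X_T⁻¹ are both characterised by `Dual`, which speaks only of products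
-- and spans; hence one construction and one program serve the inverse and the pseudo-inverse alike.
-- No general theory of determinants is developed: `det` enters through Gram determinants, whose
-- expansion along the first row is matched term by term with repeated contraction of a wedge
-- product, and this is the Cauchy-Binet formula. Forms are functions on `Subset`, with wedge and
-- contraction recursing on the first coordinate, so every sign rule is a local ring identity. The
-- mean is bounded rather than computed, because a set of n dependent columns, drawn with
-- probability zero, may still contribute a positive term to the sum over T. Since `HasRank` counts
-- columns while Gram-Schmidt works on rows, row independence is first extracted from an invertible
-- square submatrix.

module Counting where
  open import Data.Nat.Base using (_+_; _*_; _^_; _≤_)
  open ℕ.≤-Reasoning
  open +-*-Solver

  -- Operation counts in the natural numbers.

  store-regroup : ∀ s t u → s + (t + suc u) ≡ s + (t + 1) + u
  store-regroup = solve 3 (λ s t u → s :+ (t :+ (con 1 :+ u)) := s :+ (t :+ con 1) :+ u) ≡.refl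

  step-regroup : ∀ a b c d e → a + (b + (c + (d + e))) ≡ a + (b + (c + d)) + e
  step-regroup = solve 5 (λ a b c d e → a :+ (b :+ (c :+ (d :+ e))) := a :+ (b :+ (c :+ d)) :+ e) ≡.refl

  total-bound : ∀ b r → b + (r * (b + 1) + 1) ≡ suc r * (b + 1)
  total-bound = solve 2 (λ b r → b :+ (r :* (b :+ con 1) :+ con 1) := (con 1 :+ r) :* (b :+ con 1)) ≡.refl

  -- After replacing `p` and the single operations by `m`, the `n` multipliers cost 5nm, the
  -- accumulator 6m and the updates of both blocks 4nm. The sum 9nm + 6m is rounded up to 9m(n + 1),
  -- which is the origin of the constant 9.
  step-bound : ∀ n {m p} → 1 ≤ m → p ≤ m →
    n * (m * 2 + (m * 2 + 1)) + (p * 2 + (m * 2 + 1) + 1 + (n * m * 2 + n * p * 2)) ≤ 9 * m * suc n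
  step-bound n {m} {p} 1≤m p≤m = begin
    n * (m * 2 + (m * 2 + 1)) + (p * 2 + (m * 2 + 1) + 1 + (n * m * 2 + n * p * 2))
      ≤⟨ ℕ.+-mono-≤ (ℕ.*-monoʳ-≤ n (ℕ.+-monoʳ-≤ (m * 2) (ℕ.+-monoʳ-≤ (m * 2) 1≤m)))
           (ℕ.+-mono-≤ (ℕ.+-mono-≤ (ℕ.+-mono-≤ (ℕ.*-monoˡ-≤ 2 p≤m) (ℕ.+-monoʳ-≤ (m * 2) 1≤m)) 1≤m)
             (ℕ.+-monoʳ-≤ (n * m * 2) (ℕ.*-monoˡ-≤ 2 (ℕ.*-monoʳ-≤ n p≤m)))) ⟩
    n * (m * 2 + (m * 2 + m)) + (m * 2 + (m * 2 + m) + m + (n * m * 2 + n * m * 2))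
      ≤⟨ ℕ.m≤m+n _ (3 * m) ⟩
    n * (m * 2 + (m * 2 + m)) + (m * 2 + (m * 2 + m) + m + (n * m * 2 + n * m * 2)) + 3 * m
      ≡⟨ solve 2 (λ n m → n :* (m :* con 2 :+ (m :* con 2 :+ m))
           :+ (m :* con 2 :+ (m :* con 2 :+ m) :+ m :+ (n :* m :* con 2 :+ n :* m :* con 2)) :+ con 3 :* m
           := con 9 :* m :* (con 1 :+ n)) ≡.refl n m ⟩
    9 * m * suc n ∎

  -- The inductive step for bounding 1 + ... + n by n², namely (n + 1) + n² ≤ (n + 1)².
  sweep-bound : ∀ m n → 9 * m * suc n + 9 * m * (n * n) ≤ 9 * m * (suc n * suc n)
  sweep-bound m n = begin
    9 * m * suc n + 9 * m * (n * n)    ≡⟨ ℕ.*-distribˡ-+ (9 * m) (suc n) (n * n) ⟨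
    9 * m * (suc n + n * n)            ≤⟨ ℕ.*-monoʳ-≤ (9 * m) (ℕ.+-monoʳ-≤ (suc n) (ℕ.*-monoʳ-≤ n (ℕ.n≤1+n n))) ⟩
    9 * m * (suc n * suc n)            ∎

  1≤mn³ : ∀ {m n} → 1 ≤ n → 1 ≤ m → 1 ≤ m * n ^ 3
  1≤mn³ 1≤n 1≤m = ℕ.*-mono-≤ 1≤m (ℕ.*-mono-≤ 1≤n (ℕ.*-mono-≤ 1≤n (ℕ.*-mono-≤ 1≤n ℕ.≤-refl)))

  mn²≤mn³ : ∀ {m n} → 1 ≤ n → 9 * m * (n * n) ≤ 9 * (m * n ^ 3)
  mn²≤mn³ {m} {n} 1≤n = begin
    9 * m * (n * n)            ≡⟨ ℕ.*-identityʳ (9 * m * (n * n)) ⟨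
    9 * m * (n * n) * 1        ≤⟨ ℕ.*-monoʳ-≤ (9 * m * (n * n)) 1≤n ⟩
    9 * m * (n * n) * n        ≡⟨ solve 2 (λ m n → con 9 :* m :* (n :* n) :* n := con 9 :* (m :* (n :* (n :* (n :* con 1))))) ≡.refl m n ⟩
    9 * (m * n ^ 3)            ∎

  -- The 10 consists of 9 for evaluating the norm and 1 for the comparison with the threshold.
  draw-cost : ∀ {n m d s} c → 1 ≤ n → 1 ≤ m → s ≤ 9 * m * (n * n) → d ≤ c * (n ^ 3 * m) →
    d + s + 1 ≤ (c + 10) * (m * n ^ 3)
  draw-cost {n} {m} {d} {s} c 1≤n 1≤m s≤ d≤ = begin
    d + s + 1                                      ≤⟨ ℕ.+-mono-≤ (ℕ.+-mono-≤ d≤ (ℕ.≤-trans s≤ (mn²≤mn³ {m} 1≤n))) (1≤mn³ 1≤n 1≤m) ⟩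
    c * (n ^ 3 * m) + 9 * (m * n ^ 3) + m * n ^ 3  ≡⟨ solve 3 (λ c m k → c :* (k :* m) :+ con 9 :* (m :* k) :+ m :* k
                                                        := (c :+ con 10) :* (m :* k)) ≡.refl c m (n ^ 3) ⟩
    (c + 10) * (m * n ^ 3)                         ∎

  setup-cost : ∀ {n m s} → 1 ≤ n → 1 ≤ m → s ≤ 9 * m * (n * n) → s + 5 ≤ 14 * (m * n ^ 3)
  setup-cost {n} {m} {s} 1≤n 1≤m s≤ = begin
    s + 5                                   ≤⟨ ℕ.+-mono-≤ (ℕ.≤-trans s≤ (mn²≤mn³ {m} 1≤n)) (ℕ.*-monoʳ-≤ 5 (1≤mn³ 1≤n 1≤m)) ⟩
    9 * (m * n ^ 3) + 5 * (m * n ^ 3)       ≡⟨ ℕ.*-distribʳ-+ (m * n ^ 3) 9 5 ⟨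
    14 * (m * n ^ 3)                        ∎

  -- The term `c + 10` occurs twice because rounding up the number of draws costs a factor 2; 14 is
  -- 9 for the norm of the pseudo-inverse plus 5 for forming the threshold.
  budget : ∀ c N → 14 * N + ((c + 10) * N + (c + 10) * N) ≡ (14 + ((c + 10) + (c + 10))) * N
  budget = solve 2 (λ c N → con 14 :* N :+ ((c :+ con 10) :* N :+ (c :+ con 10) :* N)
    := (con 14 :+ ((c :+ con 10) :+ (c :+ con 10))) :* N) ≡.refl

module _ (em : ExcludedMiddle 0ℓ) (reals : CompleteOrderedField) where

  open Theory em reals
  open CompleteOrderedField reals
    using ( commutativeRing; ring; 0≉1; ⁻¹-cong; *-inverseʳ; +-monoˡ-≤; *-nonNeg; complete
          ; IsUpperBound; +-cong; +-congˡ; +-congʳ; +-assoc; +-comm; +-identityˡ; +-identityʳ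
          ; *-cong; *-congˡ; *-congʳ; *-assoc; *-comm; *-identityˡ; *-identityʳ; distribˡ; distribʳ
          ; zeroˡ; zeroʳ; -‿cong; -‿inverseʳ; refl; sym; trans; reflexive)
  open import Algebra.Construct.NaturalChoice.Max totalOrder using (x≤x⊔y; x≤y⊔x)
  open import Algebra.Properties.Ring ring
    using (-0#≈0#; -‿involutive; -‿distribˡ-*; -‿distribʳ-*; +-cancelˡ; -‿+-comm)
  open import Algebra.Properties.Semiring.Sum semiring
    using (sum-cong-≋; sum-replicate-zero; ∑-distrib-+; ∑-comm; *-distribˡ-sum; *-distribʳ-sum)
  open import Algebra.Properties.Semiring.Mult semiring using (×-homo-+; ×-homo-1; ×1-homo-*)
  open TotalOrder totalOrder
    using (poset; total; antisym; ≤-respˡ-≈; ≤-respʳ-≈)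
    renaming (refl to ≤-refl; reflexive to ≤-reflexive; trans to ≤-trans)
  open import Relation.Binary.Reasoning.PartialOrder poset

  -- Integer coefficients and the ring solver.

  fromℕ-+ : ∀ m n → fromℕ (m ℕ.+ n) ≈ fromℕ m + fromℕ n
  fromℕ-+ = ×-homo-+ 1#

  fromℕ-* : ∀ m n → fromℕ (m ℕ.* n) ≈ fromℕ m * fromℕ n
  fromℕ-* = ×1-homo-*

  private
    fromℤ : ℤ → ℝ
    fromℤ (+ n)    = fromℕ n
    fromℤ -[1+ n ] = - fromℕ (suc n)

    -- Derived by hand, since the ring solver is built from the homomorphism that rests on this
    -- identity.
    cancel-1+ : ∀ x y → x - y ≈ (1# + x) - (1# + y)
    cancel-1+ x y = begin-equality
      x - y                        ≈⟨ +-identityˡ _ ⟨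
      0# + (x - y)                 ≈⟨ +-congʳ (-‿inverseʳ 1#) ⟨
      (1# - 1#) + (x - y)          ≈⟨ +-assoc _ _ _ ⟩
      1# + (- 1# + (x - y))        ≈⟨ +-congˡ (+-assoc _ _ _) ⟨
      1# + (- 1# + x - y)          ≈⟨ +-congˡ (+-congʳ (+-comm _ _)) ⟩
      1# + (x - 1# - y)            ≈⟨ +-congˡ (+-assoc _ _ _) ⟩
      1# + (x + (- 1# - y))        ≈⟨ +-assoc _ _ _ ⟨
      1# + x + (- 1# - y)          ≈⟨ +-congˡ (-‿+-comm 1# y) ⟩
      (1# + x) - (1# + y)          ∎

    fromℤ-⊖ : ∀ m n → fromℤ (m ⊖ n) ≈ fromℕ m - fromℕ n
    fromℤ-⊖ m zero = sym (trans (+-congˡ -0#≈0#) (+-identityʳ _))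
    fromℤ-⊖ zero (suc n) = sym (+-identityˡ _)
    fromℤ-⊖ (suc m) (suc n) = begin-equality
      fromℤ (suc m ⊖ suc n)         ≡⟨ ≡.cong fromℤ (ℤ.[1+m]⊖[1+n]≡m⊖n m n) ⟩
      fromℤ (m ⊖ n)                 ≈⟨ fromℤ-⊖ m n ⟩
      fromℕ m - fromℕ n             ≈⟨ cancel-1+ _ _ ⟩
      fromℕ (suc m) - fromℕ (suc n) ∎

    fromℤ-neg : ∀ i → fromℤ (ℤ.- i) ≈ - fromℤ i
    fromℤ-neg (+ zero)  = sym -0#≈0#
    fromℤ-neg (+ suc n) = refl
    fromℤ-neg -[1+ n ]  = sym (-‿involutive _)

    fromℤ-+ : ∀ i j → fromℤ (i ℤ.+ j) ≈ fromℤ i + fromℤ j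
    fromℤ-+ (+ m)    (+ n)    = fromℕ-+ m n
    fromℤ-+ (+ m)    -[1+ n ] = fromℤ-⊖ m (suc n)
    fromℤ-+ -[1+ m ] (+ n)    = trans (fromℤ-⊖ n (suc m)) (+-comm _ _)
    fromℤ-+ -[1+ m ] -[1+ n ] = begin-equality
      - fromℕ (suc (suc (m ℕ.+ n)))     ≡⟨ ≡.cong (λ k → - fromℕ (suc k)) (ℕ.+-suc m n) ⟨
      - fromℕ (suc m ℕ.+ suc n)         ≈⟨ -‿cong (fromℕ-+ (suc m) (suc n)) ⟩
      - (fromℕ (suc m) + fromℕ (suc n)) ≈⟨ -‿+-comm _ _ ⟨
      - fromℕ (suc m) - fromℕ (suc n)   ∎

    fromℤ-*⁻ : ∀ m n → fromℤ (+ m ℤ.* -[1+ n ]) ≈ fromℕ m * - fromℕ (suc n)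
    fromℤ-*⁻ m n = begin-equality
      fromℤ (+ m ℤ.* -[1+ n ])       ≡⟨ ≡.cong fromℤ (ℤ.neg-distribʳ-* (+ m) (+ suc n)) ⟨
      fromℤ (ℤ.- (+ m ℤ.* + suc n))  ≈⟨ fromℤ-neg (+ m ℤ.* + suc n) ⟩
      - fromℤ (+ m ℤ.* + suc n)      ≡⟨ ≡.cong (λ i → - fromℤ i) (ℤ.pos-* m (suc n)) ⟨
      - fromℕ (m ℕ.* suc n)          ≈⟨ -‿cong (fromℕ-* m (suc n)) ⟩
      - (fromℕ m * fromℕ (suc n))    ≈⟨ -‿distribʳ-* _ _ ⟩
      fromℕ m * - fromℕ (suc n)      ∎

    fromℤ-* : ∀ i j → fromℤ (i ℤ.* j) ≈ fromℤ i * fromℤ j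
    fromℤ-* (+ m)    (+ n)    = trans (reflexive (≡.cong fromℤ (≡.sym (ℤ.pos-* m n)))) (fromℕ-* m n)
    fromℤ-* (+ m)    -[1+ n ] = fromℤ-*⁻ m n
    fromℤ-* -[1+ m ] (+ n)    = begin-equality
      fromℤ (-[1+ m ] ℤ.* + n)  ≡⟨ ≡.cong fromℤ (ℤ.*-comm -[1+ m ] (+ n)) ⟩
      fromℤ (+ n ℤ.* -[1+ m ])  ≈⟨ fromℤ-*⁻ n m ⟩
      fromℕ n * - fromℕ (suc m) ≈⟨ *-comm _ _ ⟩
      - fromℕ (suc m) * fromℕ n ∎
    fromℤ-* -[1+ m ] -[1+ n ] = begin-equality
      fromℕ (suc m ℕ.* suc n)           ≈⟨ fromℕ-* (suc m) (suc n) ⟩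
      fromℕ (suc m) * fromℕ (suc n)     ≈⟨ -‿involutive _ ⟨
      - - (fromℕ (suc m) * fromℕ (suc n)) ≈⟨ -‿cong (-‿distribˡ-* _ _) ⟩
      - (- fromℕ (suc m) * fromℕ (suc n)) ≈⟨ -‿distribʳ-* _ _ ⟩
      - fromℕ (suc m) * - fromℕ (suc n) ∎

    -- The solver reads con (+ 1) through this map, so it must be 1# on the nose.
    coefficient : ℤ → ℝ
    coefficient (+ 1) = 1#
    coefficient i     = fromℤ i

    coefficient≈ : ∀ i → coefficient i ≈ fromℤ i
    coefficient≈ (+ zero)        = refl
    coefficient≈ (+ suc zero)    = sym (×-homo-1 1#)
    coefficient≈ (+ suc (suc n)) = refl
    coefficient≈ -[1+ n ]        = refl

    morphism : ℤ.+-*-rawRing -Raw-AlmostCommutative⟶ fromCommutativeRing commutativeRing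
    morphism = record
      { ⟦_⟧    = coefficient
      ; +-homo = λ i j → trans (coefficient≈ (i ℤ.+ j))
          (trans (fromℤ-+ i j) (sym (+-cong (coefficient≈ i) (coefficient≈ j))))
      ; *-homo = λ i j → trans (coefficient≈ (i ℤ.* j))
          (trans (fromℤ-* i j) (sym (*-cong (coefficient≈ i) (coefficient≈ j))))
      ; -‿homo = λ i → trans (coefficient≈ (ℤ.- i))
          (trans (fromℤ-neg i) (sym (-‿cong (coefficient≈ i))))
      ; 0-homo = refl
      ; 1-homo = refl
      }

    -- The solver asks only for soundness: `nothing` makes no claim that the two images differ.
    _≟ᶜ_ : ∀ i j → Maybe (coefficient i ≈ coefficient j)
    i ≟ᶜ j with i ℤ.≟ j
    ... | yes ≡.refl = just refl
    ... | no _       = nothing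

  open import Algebra.Solver.Ring ℤ.+-*-rawRing (fromCommutativeRing commutativeRing) morphism _≟ᶜ_
    using (solve; _:=_; _:+_; _:*_; _:-_; :-_; con)

  -- The bridge to `√_`, `_⁺`, `_†`, `‖_‖₂` and `prob∞`: each acquires its intended meaning only
  -- through a proof that a suitable value exists.
  choose-satisfies : {A : Set} (a : A) (P : A → Set) → ∃ P → P (choose a P)
  choose-satisfies a P witness with em {∃ P}
  ... | yes (_ , p) = p
  ... | no none     = contradiction witness none

  -- Order and division in the field.

  x≤y⇒0≤y-x : ∀ {x y} → x ≤ y → 0# ≤ y - x
  x≤y⇒0≤y-x {x} x≤y = ≤-respˡ-≈ (-‿inverseʳ x) (+-monoˡ-≤ (- x) x≤y)

  0≤y-x⇒x≤y : ∀ {x y} → 0# ≤ y - x → x ≤ y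
  0≤y-x⇒x≤y {x} {y} h = begin
    x           ≈⟨ +-identityˡ x ⟨
    0# + x      ≤⟨ +-monoˡ-≤ x h ⟩
    y - x + x   ≈⟨ solve 2 (λ x y → y :- x :+ x := y) refl x y ⟩
    y           ∎

  difference⇒≤ : ∀ {x y d} → y - x ≈ d → 0# ≤ d → x ≤ y
  difference⇒≤ eq 0≤d = 0≤y-x⇒x≤y (≤-respʳ-≈ (sym eq) 0≤d)

  +-monoʳ-≤ : ∀ z {x y} → x ≤ y → z + x ≤ z + y
  +-monoʳ-≤ z {x} {y} x≤y = begin
    z + x ≈⟨ +-comm z x ⟩
    x + z ≤⟨ +-monoˡ-≤ z x≤y ⟩
    y + z ≈⟨ +-comm y z ⟩
    z + y ∎

  +-mono-≤ : ∀ {x y u v} → x ≤ y → u ≤ v → x + u ≤ y + v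
  +-mono-≤ x≤y u≤v = ≤-trans (+-monoˡ-≤ _ x≤y) (+-monoʳ-≤ _ u≤v)

  +-nonNeg : ∀ {x y} → 0# ≤ x → 0# ≤ y → 0# ≤ x + y
  +-nonNeg 0≤x 0≤y = ≤-respˡ-≈ (+-identityˡ 0#) (+-mono-≤ 0≤x 0≤y)

  neg-mono-≤ : ∀ {x y} → x ≤ y → - y ≤ - x
  neg-mono-≤ {x} {y} x≤y =
    difference⇒≤ (solve 2 (λ x y → :- x :- :- y := y :- x) refl x y) (x≤y⇒0≤y-x x≤y)

  *-monoˡ-≤ : ∀ {z x y} → 0# ≤ z → x ≤ y → z * x ≤ z * y
  *-monoˡ-≤ {z} {x} {y} 0≤z x≤y =
    difference⇒≤ (solve 3 (λ z x y → z :* y :- z :* x := z :* (y :- x)) refl z x y)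
      (*-nonNeg 0≤z (x≤y⇒0≤y-x x≤y))

  *-monoʳ-≤ : ∀ {z x y} → 0# ≤ z → x ≤ y → x * z ≤ y * z
  *-monoʳ-≤ {z} {x} {y} 0≤z x≤y = begin
    x * z ≈⟨ *-comm x z ⟩
    z * x ≤⟨ *-monoˡ-≤ 0≤z x≤y ⟩
    z * y ≈⟨ *-comm z y ⟩
    y * z ∎

  *-mono-≤ : ∀ {x y u v} → 0# ≤ x → x ≤ y → 0# ≤ u → u ≤ v → x * u ≤ y * v
  *-mono-≤ 0≤x x≤y 0≤u u≤v = ≤-trans (*-monoʳ-≤ 0≤u x≤y) (*-monoˡ-≤ (≤-trans 0≤x x≤y) u≤v)

  square-nonNeg : ∀ x → 0# ≤ x * x
  square-nonNeg x with total 0# x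
  ... | inj₁ 0≤x = *-nonNeg 0≤x 0≤x
  ... | inj₂ x≤0 = ≤-respʳ-≈ (solve 1 (λ x → (:- x) :* (:- x) := x :* x) refl x) (*-nonNeg 0≤-x 0≤-x)
    where
    0≤-x : 0# ≤ - x
    0≤-x = ≤-respˡ-≈ -0#≈0# (neg-mono-≤ x≤0)

  0≤1 : 0# ≤ 1#
  0≤1 = ≤-respʳ-≈ (*-identityˡ 1#) (square-nonNeg 1#)

  0<1 : 0# < 1#
  0<1 = 0≤1 , 0≉1

  ≮⇒≥ : ∀ {x y} → ¬ x < y → y ≤ x
  ≮⇒≥ {x} {y} x≮y with total y x | em {x ≈ y}
  ... | inj₁ y≤x | _       = y≤x
  ... | inj₂ _   | yes x≈y = ≤-reflexive (sym x≈y)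
  ... | inj₂ x≤y | no x≉y  = contradiction (x≤y , x≉y) x≮y

  ≰⇒> : ∀ {x y} → ¬ x ≤ y → y < x
  ≰⇒> {x} {y} x≰y with total y x
  ... | inj₁ y≤x = y≤x , λ y≈x → x≰y (≤-reflexive (sym y≈x))
  ... | inj₂ x≤y = contradiction x≤y x≰y

  <⇒≱ : ∀ {x y} → x < y → ¬ y ≤ x
  <⇒≱ (x≤y , x≉y) y≤x = x≉y (antisym x≤y y≤x)

  <-≤-trans : ∀ {x y z} → x < y → y ≤ z → x < z
  <-≤-trans (x≤y , x≉y) y≤z = ≤-trans x≤y y≤z , λ x≈z → x≉y (antisym x≤y (≤-trans y≤z (≤-reflexive (sym x≈z))))

  <-respʳ-≈ : ∀ {x y z} → y ≈ z → x < y → x < z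
  <-respʳ-≈ y≈z x<y = <-≤-trans x<y (≤-reflexive y≈z)

  0<x⇒x≉0 : ∀ {x} → 0# < x → ¬ x ≈ 0#
  0<x⇒x≉0 (_ , 0≉x) x≈0 = 0≉x (sym x≈0)

  *-inverseˡ : ∀ {x} → ¬ x ≈ 0# → x ⁻¹ * x ≈ 1#
  *-inverseˡ x≉0 = trans (*-comm _ _) (*-inverseʳ x≉0)

  *-cancelˡ-≈ : ∀ {x y z} → ¬ x ≈ 0# → x * y ≈ x * z → y ≈ z
  *-cancelˡ-≈ {x} {y} {z} x≉0 xy≈xz = begin-equality
    y              ≈⟨ *-identityˡ y ⟨
    1# * y         ≈⟨ *-congʳ (*-inverseˡ x≉0) ⟨
    x ⁻¹ * x * y   ≈⟨ *-assoc _ _ _ ⟩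
    x ⁻¹ * (x * y) ≈⟨ *-congˡ xy≈xz ⟩
    x ⁻¹ * (x * z) ≈⟨ *-assoc _ _ _ ⟨
    x ⁻¹ * x * z   ≈⟨ *-congʳ (*-inverseˡ x≉0) ⟩
    1# * z         ≈⟨ *-identityˡ z ⟩
    z              ∎

  xy≈0⇒y≈0 : ∀ {x y} → ¬ x ≈ 0# → x * y ≈ 0# → y ≈ 0#
  xy≈0⇒y≈0 x≉0 xy≈0 = *-cancelˡ-≈ x≉0 (trans xy≈0 (sym (zeroʳ _)))

  xx≈0⇒x≈0 : ∀ {x} → x * x ≈ 0# → x ≈ 0#
  xx≈0⇒x≈0 {x} xx≈0 with em {x ≈ 0#}
  ... | yes x≈0 = x≈0
  ... | no x≉0  = xy≈0⇒y≈0 x≉0 xx≈0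

  *-pos : ∀ {x y} → 0# < x → 0# < y → 0# < x * y
  *-pos 0<x 0<y = *-nonNeg (proj₁ 0<x) (proj₁ 0<y) ,
    λ 0≈xy → 0<x⇒x≉0 0<y (xy≈0⇒y≈0 (0<x⇒x≉0 0<x) (sym 0≈xy))

  ⁻¹-pos : ∀ {x} → 0# < x → 0# < x ⁻¹
  ⁻¹-pos {x} 0<x = ≰⇒> λ x⁻¹≤0 → <⇒≱ 0<1 (begin
    1#            ≈⟨ *-inverseʳ (0<x⇒x≉0 0<x) ⟨
    x * x ⁻¹      ≤⟨ *-monoˡ-≤ (proj₁ 0<x) x⁻¹≤0 ⟩
    x * 0#        ≈⟨ zeroʳ x ⟩
    0#            ∎)

  *-cancelˡ-≤ : ∀ {z x y} → 0# < z → z * x ≤ z * y → x ≤ y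
  *-cancelˡ-≤ {z} {x} {y} 0<z zx≤zy = begin
    x              ≈⟨ unscale x ⟨
    z ⁻¹ * (z * x) ≤⟨ *-monoˡ-≤ (proj₁ (⁻¹-pos 0<z)) zx≤zy ⟩
    z ⁻¹ * (z * y) ≈⟨ unscale y ⟩
    y              ∎
    where
    unscale : ∀ w → z ⁻¹ * (z * w) ≈ w
    unscale w = trans (sym (*-assoc _ _ _)) (trans (*-congʳ (*-inverseˡ (0<x⇒x≉0 0<z))) (*-identityˡ w))

  x/y*y≈x : ∀ {x y} → ¬ y ≈ 0# → x / y * y ≈ x
  x/y*y≈x y≉0 = trans (*-assoc _ _ _) (trans (*-congˡ (*-inverseˡ y≉0)) (*-identityʳ _))

  /-nonNeg : ∀ {x y} → 0# ≤ x → 0# < y → 0# ≤ x / y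
  /-nonNeg 0≤x 0<y = *-nonNeg 0≤x (proj₁ (⁻¹-pos 0<y))

  -- If `y < x`, then `x - y` is positive, and so is `x + y` because `- y ≤ y`; their product
  -- `x * x - y * y` would then be positive.
  square-cancel-≤ : ∀ {x y} → 0# ≤ y → x * x ≤ y * y → x ≤ y
  square-cancel-≤ {x} {y} 0≤y xx≤yy = ≮⇒≥ λ y<x →
    let 0<x-y = x≤y⇒0≤y-x (proj₁ y<x) , λ 0≈x-y → proj₂ y<x (begin-equality
          y           ≈⟨ +-identityˡ y ⟨
          0# + y      ≈⟨ +-congʳ 0≈x-y ⟩
          x - y + y   ≈⟨ solve 2 (λ x y → x :- y :+ y := x) refl x y ⟩
          x           ∎)
        0<x+y = <-≤-trans 0<x-y (+-monoʳ-≤ x (≤-trans (≤-respʳ-≈ -0#≈0# (neg-mono-≤ 0≤y)) 0≤y))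
    in <⇒≱ (<-respʳ-≈ (solve 2 (λ x y → (x :- y) :* (x :+ y) := x :* x :- y :* y) refl x y)
                      (*-pos 0<x-y 0<x+y))
           (≤-respʳ-≈ (-‿inverseʳ (y * y)) (+-monoˡ-≤ (- (y * y)) xx≤yy))

  fromℕ-nonNeg : ∀ n → 0# ≤ fromℕ n
  fromℕ-nonNeg zero    = ≤-refl
  fromℕ-nonNeg (suc n) = +-nonNeg 0≤1 (fromℕ-nonNeg n)

  fromℕ-mono-≤ : ∀ {m n} → m ℕ.≤ n → fromℕ m ≤ fromℕ n
  fromℕ-mono-≤ {n = n} ℕ.z≤n = fromℕ-nonNeg n
  fromℕ-mono-≤ (ℕ.s≤s m≤n)   = +-monoʳ-≤ 1# (fromℕ-mono-≤ m≤n)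

  1≤fromℕ : ∀ {n} → 1 ℕ.≤ n → 1# ≤ fromℕ n
  1≤fromℕ 1≤n = ≤-trans (≤-reflexive (sym (+-identityʳ 1#))) (fromℕ-mono-≤ 1≤n)

  -- The Archimedean property and square roots.

  x≰x-1 : ∀ {x} → ¬ x ≤ x - 1#
  x≰x-1 {x} h = <⇒≱ 0<1 (begin
    1#              ≈⟨ solve 1 (λ x → con (+ 1) := con (+ 1) :- x :+ x) refl x ⟩
    1# - x + x      ≤⟨ +-monoʳ-≤ (1# - x) h ⟩
    1# - x + (x - 1#) ≈⟨ solve 1 (λ x → con (+ 1) :- x :+ (x :- con (+ 1)) := con (+ 0)) refl x ⟩
    0#              ∎)

  -- If the naturals were bounded they would have a supremum; as `n + 1` is natural with `n`, that
  -- supremum minus 1 would still be an upper bound.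
  archimedean : ∀ x → ∃ λ n → x ≤ fromℕ n
  archimedean x with em {∃ λ n → x ≤ fromℕ n}
  ... | yes h      = h
  ... | no unbounded = ⊥-elim (x≰x-1 (proj₂ isSup r-1-bounds))
    where
    Natural : ℝ → Set
    Natural t = ∃ λ n → t ≈ fromℕ n

    supremum : ∃ (IsSup Natural)
    supremum = complete Natural (0# , 0 , refl)
      (x , λ (n , t≈n) → ≤-respˡ-≈ (sym t≈n) (proj₁ (≰⇒> λ x≤n → unbounded (n , x≤n))))

    r = proj₁ supremum
    isSup = proj₂ supremum

    r-1-bounds : IsUpperBound Natural (r - 1#)
    r-1-bounds {t} (n , t≈n) = begin
      t                     ≈⟨ t≈n ⟩
      fromℕ n               ≈⟨ solve 1 (λ n → n := con (+ 1) :+ n :- con (+ 1)) refl (fromℕ n) ⟩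
      fromℕ (suc n) - 1#    ≤⟨ +-monoˡ-≤ (- 1#) (proj₁ isSup (suc n , refl)) ⟩
      r - 1#                ∎

  -- A search downwards from an Archimedean bound. It stops as soon as the predecessor `n` of the
  -- current bound fails `x ≤ fromℕ n`, and this failure gives the upper estimate.
  ceiling : ∀ {x} → 0# ≤ x → ∃ λ k → x ≤ fromℕ k × fromℕ k ≤ 1# + x
  ceiling {x} 0≤x = let n , x≤n = archimedean x in descend n x≤n
    where
    descend : ∀ n → x ≤ fromℕ n → ∃ λ k → x ≤ fromℕ k × fromℕ k ≤ 1# + x
    descend zero x≤0 = 0 , x≤0 , +-nonNeg 0≤1 0≤x
    descend (suc n) x≤n+1 with em {x ≤ fromℕ n}
    ... | yes x≤n = descend n x≤n
    ... | no x≰n  = suc n , x≤n+1 , +-monoʳ-≤ 1# (proj₁ (≰⇒> x≰n))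

  -- The root is the supremum `r` of the nonnegative numbers with square at most `s`. If
  -- `r * r < s`, a slightly larger number would still belong to the set; if `s < r * r`, Newton's
  -- iterate would be a smaller upper bound.
  sqrt-exists : ∀ {s} → 0# ≤ s → ∃ λ t → 0# ≤ t × t * t ≈ s
  sqrt-exists {s} 0≤s = r , 0≤r , antisym (≮⇒≥ s≮rr) (≮⇒≥ rr≮s)
    where
    Below : ℝ → Set
    Below t = 0# ≤ t × t * t ≤ s

    zero-below : Below 0#
    zero-below = ≤-refl , ≤-respˡ-≈ (sym (zeroˡ 0#)) 0≤s

    1+s-bounds : IsUpperBound Below (1# + s)
    1+s-bounds {t} (0≤t , tt≤s) = square-cancel-≤ (+-nonNeg 0≤1 0≤s) (begin
      t * t                         ≤⟨ tt≤s ⟩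
      s                             ≤⟨ difference⇒≤
        (solve 1 (λ s → (con (+ 1) :+ s) :* (con (+ 1) :+ s) :- s := con (+ 1) :+ s :+ s :* s) refl s)
        (+-nonNeg (+-nonNeg 0≤1 0≤s) (square-nonNeg s)) ⟩
      (1# + s) * (1# + s)           ∎)

    supremum : ∃ (IsSup Below)
    supremum = complete Below (0# , zero-below) (1# + s , 1+s-bounds)

    r = proj₁ supremum
    isSup = proj₂ supremum

    0≤r : 0# ≤ r
    0≤r = proj₁ isSup zero-below

    rr≮s : ¬ r * r < s
    rr≮s rr<s = 0<x⇒x≉0 0<ε (antisym ε≤0 (proj₁ 0<ε))
      where
      -- `D` is chosen so that `ε ≤ 1#` and the remaining gap `s - (r + ε) * (r + ε)` becomes
      -- `ε * (s + (1# - ε))`, which is visibly nonnegative.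
      D = s + r + r + 1#
      ε = (s - r * r) / D
      0<D : 0# < D
      0<D = <-≤-trans 0<1 (difference⇒≤
        (solve 2 (λ s r → s :+ r :+ r :+ con (+ 1) :- con (+ 1) := s :+ r :+ r) refl s r)
        (+-nonNeg (+-nonNeg 0≤s 0≤r) 0≤r))
      0<s-rr : 0# < s - r * r
      0<s-rr = x≤y⇒0≤y-x (proj₁ rr<s) , λ 0≈s-rr → proj₂ rr<s (begin-equality
        r * r                 ≈⟨ +-identityˡ _ ⟨
        0# + r * r            ≈⟨ +-congʳ 0≈s-rr ⟩
        s - r * r + r * r     ≈⟨ solve 2 (λ s r → s :- r :* r :+ r :* r := s) refl s r ⟩
        s                     ∎)
      0<ε : 0# < ε
      0<ε = *-pos 0<s-rr (⁻¹-pos 0<D)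
      εD≈ : ε * D ≈ s - r * r
      εD≈ = x/y*y≈x (0<x⇒x≉0 0<D)
      ε≤1 : ε ≤ 1#
      ε≤1 = *-cancelˡ-≤ 0<D (begin
        D * ε         ≈⟨ trans (*-comm D ε) εD≈ ⟩
        s - r * r     ≤⟨ difference⇒≤
          (solve 2 (λ s r → (s :+ r :+ r :+ con (+ 1)) :* con (+ 1) :- (s :- r :* r)
                         := r :+ r :+ con (+ 1) :+ r :* r) refl s r)
          (+-nonNeg (+-nonNeg (+-nonNeg 0≤r 0≤r) 0≤1) (square-nonNeg r)) ⟩
        D * 1#        ∎)
      r+ε-below : Below (r + ε)
      r+ε-below = +-nonNeg 0≤r (proj₁ 0<ε) , difference⇒≤ (begin-equality
        s - (r + ε) * (r + ε)
          ≈⟨ solve 3 (λ s r ε → s :- (r :+ ε) :* (r :+ ε)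
                             := s :- r :* r :- ε :* (r :+ r :+ ε)) refl s r ε ⟩
        s - r * r - ε * (r + r + ε)       ≈⟨ +-congʳ εD≈ ⟨
        ε * D - ε * (r + r + ε)
          ≈⟨ solve 3 (λ s r ε → ε :* (s :+ r :+ r :+ con (+ 1)) :- ε :* (r :+ r :+ ε)
                             := ε :* (s :+ (con (+ 1) :- ε))) refl s r ε ⟩
        ε * (s + (1# - ε))                ∎)
        (*-nonNeg (proj₁ 0<ε) (+-nonNeg 0≤s (x≤y⇒0≤y-x ε≤1)))
      ε≤0 : ε ≤ 0#
      ε≤0 = begin
        ε           ≈⟨ solve 2 (λ r ε → ε := r :+ ε :- r) refl r ε ⟩
        r + ε - r   ≤⟨ +-monoˡ-≤ (- r) (proj₁ isSup r+ε-below) ⟩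
        r - r       ≈⟨ -‿inverseʳ r ⟩
        0#          ∎

    s≮rr : ¬ s < r * r
    -- Since `newton` bounds the set, `r ≤ newton`. But `r * newton` is the midpoint of `r * r` and
    -- `s`, so it exceeds `r * r` only if `s` does so too.
    s≮rr s<rr = <⇒≱ s<rr (begin
      r * r                                      ≤⟨ *-monoˡ-≤ 0≤r (proj₂ isSup newton-bounds) ⟩
      r * newton                                 ≤⟨ difference⇒≤
        (begin-equality
          s - r * newton                         ≈⟨ difference ⟩
          r * newton - r * r                     ∎)
        (x≤y⇒0≤y-x (*-monoˡ-≤ 0≤r (proj₂ isSup newton-bounds))) ⟩
      s                                          ∎)
      where
      r≉0 : ¬ r ≈ 0#
      r≉0 r≈0 = <⇒≱ s<rr (≤-trans (≤-reflexive (trans (*-congˡ r≈0) (zeroʳ r))) 0≤s)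
      0<r : 0# < r
      0<r = 0≤r , r≉0 ∘ sym
      0<2r : 0# < r + r
      0<2r = <-≤-trans 0<r (≤-respˡ-≈ (+-identityˡ r) (+-monoˡ-≤ r 0≤r))
      -- Newton's iterate for the square root of s, starting from r.
      newton = (r * r + s) / (r + r)
      newton* : newton * (r + r) ≈ r * r + s
      newton* = x/y*y≈x (0<x⇒x≉0 0<2r)
      difference : s - r * newton ≈ r * newton - r * r
      difference = begin-equality
        s - r * newton
          ≈⟨ solve 3 (λ s r t → s :- r :* t := (r :* r :+ s) :- r :* r :- r :* t) refl s r newton ⟩
        (r * r + s) - r * r - r * newton       ≈⟨ +-congʳ (+-congʳ newton*) ⟨
        newton * (r + r) - r * r - r * newton
          ≈⟨ solve 2 (λ r t → t :* (r :+ r) :- r :* r :- r :* t := r :* t :- r :* r) refl r newton ⟩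
        r * newton - r * r ∎
      s≤newton² : s ≤ newton * newton
      s≤newton² = difference⇒≤ (begin-equality
        newton * newton - s
          ≈⟨ solve 3 (λ s r t → t :* t :- s := t :* t :+ r :* r :- (r :* r :+ s)) refl s r newton ⟩
        newton * newton + r * r - (r * r + s)             ≈⟨ +-congˡ (-‿cong newton*) ⟨
        newton * newton + r * r - newton * (r + r)
          ≈⟨ solve 2 (λ r t → t :* t :+ r :* r :- t :* (r :+ r) := (t :- r) :* (t :- r)) refl r newton ⟩
        (newton - r) * (newton - r) ∎)
        (square-nonNeg (newton - r))
      newton-bounds : IsUpperBound Below newton
      newton-bounds (_ , tt≤s) = square-cancel-≤
        (/-nonNeg (+-nonNeg (square-nonNeg r) 0≤s) 0<2r) (≤-trans tt≤s s≤newton²)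

  √-nonNeg : ∀ {x} → 0# ≤ x → 0# ≤ √ x
  √-nonNeg 0≤x = proj₁ (choose-satisfies 0# _ (sqrt-exists 0≤x))

  √-square : ∀ {x} → 0# ≤ x → √ x * √ x ≈ x
  √-square 0≤x = proj₂ (choose-satisfies 0# _ (sqrt-exists 0≤x))

  x^2≈xx : ∀ x → x ^ 2 ≈ x * x
  x^2≈xx x = *-congˡ (*-identityʳ x)

  √-^2 : ∀ {x} → 0# ≤ x → (√ x) ^ 2 ≈ x
  √-^2 0≤x = trans (x^2≈xx _) (√-square 0≤x)

  private variable
    k m n p size : ℕ
    U V W : Set

  -- Finite sums and the identity matrix.

  sum-zero : {f : Vector ℝ n} → (∀ i → f i ≈ 0#) → sum f ≈ 0#
  sum-zero {n} f≈0 = trans (sum-cong-≋ f≈0) (sum-replicate-zero n)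

  sum-mono-≤ : {f g : Vector ℝ n} → (∀ i → f i ≤ g i) → sum f ≤ sum g
  sum-mono-≤ {zero}  f≤g = ≤-refl
  sum-mono-≤ {suc n} f≤g = +-mono-≤ (f≤g zero) (sum-mono-≤ (f≤g ∘ suc))

  sum-nonNeg : {f : Vector ℝ n} → (∀ i → 0# ≤ f i) → 0# ≤ sum f
  sum-nonNeg {zero}  0≤f = ≤-refl
  sum-nonNeg {suc n} 0≤f = +-nonNeg (0≤f zero) (sum-nonNeg (0≤f ∘ suc))

  term≤sum : {f : Vector ℝ n} → (∀ i → 0# ≤ f i) → ∀ i → f i ≤ sum f
  term≤sum {f = f} 0≤f zero =
    ≤-trans (≤-reflexive (sym (+-identityʳ _))) (+-monoʳ-≤ (f zero) (sum-nonNeg (0≤f ∘ suc)))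
  term≤sum {f = f} 0≤f (suc i) = ≤-trans (term≤sum (0≤f ∘ suc) i)
    (≤-trans (≤-reflexive (sym (+-identityˡ _))) (+-monoˡ-≤ _ (0≤f zero)))

  sum-const : ∀ n x → ∑[ i < n ] x ≈ fromℕ n * x
  sum-const zero    x = sym (zeroˡ x)
  sum-const (suc n) x = begin-equality
    x + ∑[ i < n ] x       ≈⟨ +-congˡ (sum-const n x) ⟩
    x + fromℕ n * x        ≈⟨ solve 2 (λ x k → x :+ k :* x := (con (+ 1) :+ k) :* x) refl x (fromℕ n) ⟩
    (1# + fromℕ n) * x     ∎

  𝟏-diagonal : (i : Fin n) → 𝟏 i i ≈ 1#
  𝟏-diagonal zero    = refl
  𝟏-diagonal (suc i) = 𝟏-diagonal i

  𝟏-sym : (i j : Fin n) → 𝟏 i j ≈ 𝟏 j i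
  𝟏-sym zero    zero    = refl
  𝟏-sym zero    (suc j) = refl
  𝟏-sym (suc i) zero    = refl
  𝟏-sym (suc i) (suc j) = 𝟏-sym i j

  sum-𝟏ˡ : (i : Fin n) (v : Vector ℝ n) → ∑[ j < n ] (𝟏 i j * v j) ≈ v i
  sum-𝟏ˡ {suc n} zero    v = trans (+-cong (*-identityˡ _) (sum-zero {n} λ j → zeroˡ _)) (+-identityʳ _)
  sum-𝟏ˡ {suc n} (suc i) v = trans (+-cong (zeroˡ _) (sum-𝟏ˡ i (v ∘ suc))) (+-identityˡ _)

  sum-𝟏ʳ : (i : Fin n) (v : Vector ℝ n) → ∑[ j < n ] (v j * 𝟏 j i) ≈ v i
  sum-𝟏ʳ {n} i v = trans (sum-cong-≋ {n} λ j → trans (*-comm _ _) (*-congʳ (𝟏-sym j i))) (sum-𝟏ˡ i v)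

  -- Vectors

  infix 7.5 _∙_

  _∙_ : Vector ℝ m → Vector ℝ m → ℝ
  a ∙ b = ∑[ j < _ ] (a j * b j)

  infixl 8 _⊙_

  _⊙_ : Vector ℝ n → Matrix n m → Vector ℝ m
  (u ⊙ X) j = ∑[ i < _ ] (u i * X i j)

  ∙-cong : {a b c d : Vector ℝ m} → (∀ j → a j ≈ b j) → (∀ j → c j ≈ d j) → a ∙ c ≈ b ∙ d
  ∙-cong {m} a≈b c≈d = sum-cong-≋ {m} λ j → *-cong (a≈b j) (c≈d j)

  ∙-comm : (a b : Vector ℝ m) → a ∙ b ≈ b ∙ a
  ∙-comm {m} a b = sum-cong-≋ {m} λ j → *-comm _ _

  ∙-distribʳ-+ : (a b c : Vector ℝ m) → (λ j → a j + b j) ∙ c ≈ a ∙ c + b ∙ c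
  ∙-distribʳ-+ {m} a b c = trans (sum-cong-≋ {m} λ j → distribʳ _ _ _) (∑-distrib-+ {m} _ _)

  ∙-scaleˡ : ∀ s (a b : Vector ℝ m) → (λ j → s * a j) ∙ b ≈ s * (a ∙ b)
  ∙-scaleˡ {m} s a b = trans (sum-cong-≋ {m} λ j → *-assoc _ _ _) (sym (*-distribˡ-sum {m} s _))

  ∙-scaleʳ : ∀ s (a b : Vector ℝ m) → a ∙ (λ j → s * b j) ≈ s * (a ∙ b)
  ∙-scaleʳ s a b = trans (∙-comm a _) (trans (∙-scaleˡ s b a) (*-congˡ (∙-comm b a)))

  ∙-zeroˡ : {a b : Vector ℝ m} → (∀ j → a j ≈ 0#) → a ∙ b ≈ 0#
  ∙-zeroˡ {m} a≈0 = sum-zero {m} λ j → trans (*-congʳ (a≈0 j)) (zeroˡ _)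

  ∙-zeroʳ : {a b : Vector ℝ m} → (∀ j → b j ≈ 0#) → a ∙ b ≈ 0#
  ∙-zeroʳ {m} b≈0 = sum-zero {m} λ j → trans (*-congˡ (b≈0 j)) (zeroʳ _)

  ⊙-∙ : (u : Vector ℝ n) (X : Matrix n m) (b : Vector ℝ m) → u ⊙ X ∙ b ≈ u ∙ (λ i → X i ∙ b)
  ⊙-∙ {n} {m} u X b = begin-equality
    ∑[ j < _ ] ((u ⊙ X) j * b j)                    ≈⟨ sum-cong-≋ {m} (λ j → *-distribʳ-sum {n} (b j) _) ⟩
    ∑[ j < _ ] ∑[ i < _ ] (u i * X i j * b j)       ≈⟨ ∑-comm {m} {n} _ ⟩
    ∑[ i < _ ] ∑[ j < _ ] (u i * X i j * b j)       ≈⟨ sum-cong-≋ {n} (λ i → ∙-scaleˡ (u i) (X i) b) ⟩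
    ∑[ i < _ ] (u i * (X i ∙ b))                    ∎

  ∣_∣² : Vector ℝ m → ℝ
  ∣ a ∣² = a ∙ a

  ∣∣²-nonNeg : (a : Vector ℝ m) → 0# ≤ ∣ a ∣²
  ∣∣²-nonNeg a = sum-nonNeg λ j → square-nonNeg (a j)

  ∣a∣²≈0⇒a≈0 : {a : Vector ℝ m} → ∣ a ∣² ≈ 0# → ∀ j → a j ≈ 0#
  ∣a∣²≈0⇒a≈0 {a = a} h j = xx≈0⇒x≈0 (antisym
    (≤-trans (term≤sum (λ j → square-nonNeg (a j)) j) (≤-reflexive h)) (square-nonNeg (a j)))

  ∣∣²-+ : (a b : Vector ℝ m) → a ∙ b ≈ 0# → ∣ (λ j → a j + b j) ∣² ≈ ∣ a ∣² + ∣ b ∣²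
  ∣∣²-+ a b a⊥b = begin-equality
    (λ j → a j + b j) ∙ (λ j → a j + b j)          ≈⟨ ∙-distribʳ-+ a b _ ⟩
    a ∙ (λ j → a j + b j) + b ∙ (λ j → a j + b j)  ≈⟨ +-cong (∙-comm a _) (∙-comm b _) ⟩
    (λ j → a j + b j) ∙ a + (λ j → a j + b j) ∙ b  ≈⟨ +-cong (∙-distribʳ-+ a b a) (∙-distribʳ-+ a b b) ⟩
    (∣ a ∣² + b ∙ a) + (a ∙ b + ∣ b ∣²)            ≈⟨ +-cong (+-congˡ (trans (∙-comm b a) a⊥b)) (+-congʳ a⊥b) ⟩
    (∣ a ∣² + 0#) + (0# + ∣ b ∣²)                  ≈⟨ +-cong (+-identityʳ _) (+-identityˡ _) ⟩
    ∣ a ∣² + ∣ b ∣²                                ∎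

  -- Dual bases and the Gram–Schmidt process

  InSpan : Matrix n m → Vector ℝ m → Set
  InSpan {n} X y = ∃ λ (u : Vector ℝ n) → ∀ j → y j ≈ (u ⊙ X) j

  row-inSpan : (X : Matrix n m) (i : Fin n) → InSpan X (X i)
  row-inSpan X i = 𝟏 i , λ j → sym (sum-𝟏ˡ i (λ k → X k j))

  ⊙-inSpan : {X : Matrix n m} (u : Vector ℝ k) (Z : Matrix k m) → (∀ i → InSpan X (Z i)) → InSpan X (u ⊙ Z)
  ⊙-inSpan {X = X} u Z Z⊆ = u ⊙ (proj₁ ∘ Z⊆) , λ j → begin-equality
    ∑[ i < _ ] (u i * Z i j)                     ≈⟨ ∙-cong {a = u} (λ _ → refl) (λ i → proj₂ (Z⊆ i) j) ⟩
    u ∙ (λ i → proj₁ (Z⊆ i) ∙ (λ k → X k j))     ≈⟨ ⊙-∙ u (proj₁ ∘ Z⊆) (λ k → X k j) ⟨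
    u ⊙ (proj₁ ∘ Z⊆) ∙ (λ k → X k j)             ∎

  span-⊥ : {X : Matrix n m} {y b : Vector ℝ m} → InSpan X y → (∀ i → X i ∙ b ≈ 0#) → y ∙ b ≈ 0#
  span-⊥ {X = X} {y} {b} (u , y≈) X⊥b =
    trans (∙-cong y≈ (λ _ → refl)) (trans (⊙-∙ u X b) (∙-zeroʳ {a = u} X⊥b))

  -- Transposing `Y` gives the pseudo-inverse of `X` (`†-dual`) and, when `X` is square, its inverse
  -- (`dual-square`).
  record Dual (X Y : Matrix n m) : Set where
    field
      pairing : ∀ i j → Y i ∙ X j ≈ 𝟏 i j
      inSpan  : ∀ i → InSpan X (Y i)

  open Dual public

  -- The difference of two candidate rows lies in the span of the rows of `X` and is orthogonal to
  -- all of them, hence to itself.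
  dual-unique : {X Y Z : Matrix n m} → Dual X Y → Dual X Z → Y ≋ Z
  dual-unique {X = X} {Y} {Z} dualY dualZ i j = begin-equality
    Y i j                   ≈⟨ solve 2 (λ y z → y := y :+ :- con (+ 1) :* z :+ z) refl (Y i j) (Z i j) ⟩
    d j + Z i j             ≈⟨ +-congʳ (∣a∣²≈0⇒a≈0 {a = d} (span-⊥ {X = X} {y = d} d∈ λ k → trans (∙-comm (X k) d) (d⊥ k)) j) ⟩
    0# + Z i j              ≈⟨ +-identityˡ _ ⟩
    Z i j                   ∎
    where
    d : Vector ℝ _
    d j = Y i j + - 1# * Z i j
    d⊥ : ∀ k → d ∙ X k ≈ 0#
    d⊥ k = begin-equality
      d ∙ X k                               ≈⟨ ∙-distribʳ-+ (Y i) _ (X k) ⟩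
      Y i ∙ X k + (λ j → - 1# * Z i j) ∙ X k ≈⟨ +-congˡ (∙-scaleˡ (- 1#) (Z i) (X k)) ⟩
      Y i ∙ X k + - 1# * (Z i ∙ X k)        ≈⟨ +-cong (pairing dualY i k) (*-congˡ (pairing dualZ i k)) ⟩
      𝟏 i k + - 1# * 𝟏 i k                  ≈⟨ solve 1 (λ x → x :+ :- con (+ 1) :* x := con (+ 0)) refl (𝟏 i k) ⟩
      0#                                    ∎
    d∈ : InSpan X d
    d∈ = let u , Y≈ = inSpan dualY i
             v , Z≈ = inSpan dualZ i
      in (λ k → u k + - 1# * v k) , λ j → begin-equality
        Y i j + - 1# * Z i j                  ≈⟨ +-cong (Y≈ j) (*-congˡ (Z≈ j)) ⟩
        (u ⊙ X) j + - 1# * (v ⊙ X) j          ≈⟨ +-congˡ (∙-scaleˡ (- 1#) v _) ⟨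
        (u ⊙ X) j + ((λ k → - 1# * v k) ⊙ X) j ≈⟨ ∙-distribʳ-+ u _ _ ⟨
        ((λ k → u k + - 1# * v k) ⊙ X) j      ∎

  -- Pairing a linear combination of the rows of `X` with `Y i` recovers its i-th coefficient.
  dual⇒independent : {X Y : Matrix n m} → (∀ i j → Y i ∙ X j ≈ 𝟏 i j) → IndependentColumns (X ᵀ)
  dual⇒independent {X = X} {Y} YX≈𝟏 v Xv≈0 i = begin-equality
    v i                              ≈⟨ sum-𝟏ʳ i v ⟨
    v ∙ (λ k → 𝟏 k i)                ≈⟨ ∙-cong {a = v} (λ _ → refl) (λ k → trans (𝟏-sym k i) (sym (trans (∙-comm (X k) (Y i)) (YX≈𝟏 i k)))) ⟩
    v ∙ (λ k → X k ∙ Y i)            ≈⟨ ⊙-∙ v X (Y i) ⟨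
    v ⊙ X ∙ Y i                      ≈⟨ ∙-zeroˡ {b = Y i} (λ j → trans (∙-comm v _) (Xv≈0 j)) ⟩
    0#                               ∎

  multiplier : Matrix (suc n) m → Vector ℝ n
  multiplier X i = X (suc i) ∙ X zero / ∣ X zero ∣²

  eliminate : Vector ℝ n → Matrix (suc n) k → Matrix n k
  eliminate r C i j = C (suc i) j - r i * C zero j

  -- Gram–Schmidt with the row operations repeated on C: for independent rows
  -- with dual basis Y this is the squared Frobenius norm of Yᵀ ⊗ C.
  gramSchmidt : Matrix n m → Matrix n p → ℝ
  gramSchmidt {zero}  X C = 0#
  gramSchmidt {suc n} X C = ∣ C zero ∣² / ∣ X zero ∣²
    + gramSchmidt (eliminate (multiplier X) X) (eliminate (multiplier X) C)

  eliminate-⊥ : (X : Matrix (suc n) m) → ¬ ∣ X zero ∣² ≈ 0# → ∀ i → eliminate (multiplier X) X i ∙ X zero ≈ 0#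
  eliminate-⊥ X a≉0 i = begin-equality
    eliminate (multiplier X) X i ∙ X zero
      ≈⟨ ∙-distribʳ-+ (X (suc i)) _ (X zero) ⟩
    X (suc i) ∙ X zero + (λ j → - (r * X zero j)) ∙ X zero
      ≈⟨ +-congˡ (trans (∙-cong {c = X zero} (λ j → -‿distribˡ-* _ _) (λ _ → refl)) (∙-scaleˡ (- r) (X zero) (X zero))) ⟩
    X (suc i) ∙ X zero + - r * ∣ X zero ∣²
      ≈⟨ +-congˡ (trans (sym (-‿distribˡ-* _ _)) (-‿cong (x/y*y≈x a≉0))) ⟩
    X (suc i) ∙ X zero - X (suc i) ∙ X zero
      ≈⟨ -‿inverseʳ _ ⟩
    0# ∎
    where r = multiplier X i

  -- A relation `u` among the eliminated rows is a relation among the original ones once the first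
  -- row receives the coefficient `- (r ∙ u)`.
  eliminate-independent : (X : Matrix (suc n) m) (r : Vector ℝ n) →
    IndependentColumns (X ᵀ) → IndependentColumns (eliminate r X ᵀ)
  eliminate-independent {n} X r independent u h i = independent v v≈0 (suc i)
    where
    v : Vector ℝ (suc n)
    v = - (r ∙ u) Vector.∷ u
    v≈0 : ∀ j → ((X ᵀ) ·ᵛ v) j ≈ 0#
    v≈0 j = begin-equality
      X zero j * - (r ∙ u) + (λ i → X (suc i) j) ∙ u
        ≈⟨ +-congʳ (solve 2 (λ x s → x :* :- s := (:- x) :* s) refl (X zero j) (r ∙ u)) ⟩
      - X zero j * (r ∙ u) + (λ i → X (suc i) j) ∙ u
        ≈⟨ +-congʳ (∙-scaleˡ (- X zero j) r u) ⟨
      (λ i → - X zero j * r i) ∙ u + (λ i → X (suc i) j) ∙ u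
        ≈⟨ ∙-distribʳ-+ (λ i → - X zero j * r i) (λ i → X (suc i) j) u ⟨
      (λ i → - X zero j * r i + X (suc i) j) ∙ u
        ≈⟨ ∙-cong {c = u} (λ i → solve 3 (λ x r y → (:- x) :* r :+ y := y :- r :* x) refl (X zero j) (r i) (X (suc i) j)) (λ _ → refl) ⟩
      (λ i → eliminate r X i j) ∙ u
        ≈⟨ h j ⟩
      0# ∎

  independent⇒row≉0 : (X : Matrix (suc n) m) → IndependentColumns (X ᵀ) → ¬ ∣ X zero ∣² ≈ 0#
  independent⇒row≉0 X independent a≈0 = 0≉1 (sym (independent (𝟏 zero)
    (λ j → trans (trans (∙-comm (λ i → X i j) (𝟏 zero)) (sum-𝟏ˡ zero (λ i → X i j))) (∣a∣²≈0⇒a≈0 {a = X zero} a≈0 j)) zero))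

  -- Elimination leaves rows orthogonal to `X zero`, and so is their dual basis `Y′`, which lies in
  -- their span. Expressed through `Y`, each column of `C` splits into a multiple of `X zero` and
  -- the combination of `Y′` given by the eliminated column. By Pythagoras the squared norms add up,
  -- which is the recursion of `gramSchmidt`.
  gramSchmidt-dual : (X : Matrix n m) → IndependentColumns (X ᵀ) →
    ∃ λ Y → Dual X Y × (∀ {p} (C : Matrix n p) → gramSchmidt X C ≈ ∑[ l < p ] ∣ (C ᵀ) l ⊙ Y ∣²)
  gramSchmidt-dual {zero} {m} X independent = (λ ()) , record { pairing = λ () ; inSpan = λ () } ,
    λ {p} C → sym (sum-zero {p} λ l → ∙-zeroˡ {m} {b = λ _ → 0#} λ _ → refl)
  gramSchmidt-dual {suc n} {m} X independent = Y , record { pairing = pairing′ ; inSpan = inSpan′ } , value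
    where
    a = ∣ X zero ∣²
    r = multiplier X
    X′ = eliminate r X
    a≉0 = independent⇒row≉0 X independent

    recursive = gramSchmidt-dual X′ (eliminate-independent X r independent)
    Y′ = proj₁ recursive
    dual′ = proj₁ (proj₂ recursive)

    Y : Matrix (suc n) m
    -- The multiple `a ⁻¹` of `X zero` pairs to 1 with `X zero` but to `r j` with `X (suc j)`;
    -- subtracting the vectors `r i * Y′ i` removes the latter without disturbing the former.
    Y zero    = (a ⁻¹ Vector.∷ (λ i → - r i)) ⊙ (X zero Vector.∷ Y′)
    Y (suc i) = Y′ i

    Y′⊥X₀ : ∀ i → Y′ i ∙ X zero ≈ 0#
    Y′⊥X₀ i = span-⊥ {X = X′} (inSpan dual′ i) (eliminate-⊥ X a≉0)

    Y′∙X : ∀ i j → Y′ i ∙ X (suc j) ≈ 𝟏 i j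
    Y′∙X i j = begin-equality
      Y′ i ∙ X (suc j)
        ≈⟨ ∙-comm (Y′ i) _ ⟩
      X (suc j) ∙ Y′ i
        ≈⟨ ∙-cong {c = Y′ i} (λ k → solve 3 (λ x r y → x := x :- r :* y :+ r :* y) refl (X (suc j) k) (r j) (X zero k)) (λ _ → refl) ⟩
      (λ k → X′ j k + r j * X zero k) ∙ Y′ i
        ≈⟨ ∙-distribʳ-+ (X′ j) _ (Y′ i) ⟩
      X′ j ∙ Y′ i + (λ k → r j * X zero k) ∙ Y′ i
        ≈⟨ +-cong (trans (∙-comm (X′ j) (Y′ i)) (pairing dual′ i j)) (∙-scaleˡ (r j) (X zero) (Y′ i)) ⟩
      𝟏 i j + r j * (X zero ∙ Y′ i)
        ≈⟨ +-congˡ (trans (*-congˡ (trans (∙-comm (X zero) (Y′ i)) (Y′⊥X₀ i))) (zeroʳ _)) ⟩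
      𝟏 i j + 0#
        ≈⟨ +-identityʳ _ ⟩
      𝟏 i j ∎

    pairing′ : ∀ i j → Y i ∙ X j ≈ 𝟏 i j
    pairing′ zero j = trans (⊙-∙ (a ⁻¹ Vector.∷ (λ i → - r i)) (X zero Vector.∷ Y′) (X j)) (Y₀∙X j)
      where
      Y₀∙X : ∀ j → a ⁻¹ * (X zero ∙ X j) + (λ i → - r i) ∙ (λ i → Y′ i ∙ X j) ≈ 𝟏 zero j
      Y₀∙X zero = trans (+-cong (*-inverseˡ a≉0) (∙-zeroʳ {a = λ i → - r i} Y′⊥X₀)) (+-identityʳ _)
      Y₀∙X (suc j) = begin-equality
        a ⁻¹ * (X zero ∙ X (suc j)) + (λ i → - r i) ∙ (λ i → Y′ i ∙ X (suc j))
          ≈⟨ +-cong (trans (*-comm _ _) (*-congʳ (∙-comm (X zero) (X (suc j))))) (∙-cong {a = λ i → - r i} (λ _ → refl) (λ i → Y′∙X i j)) ⟩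
        r j + (λ i → - r i) ∙ (λ i → 𝟏 i j)
          ≈⟨ +-congˡ (sum-𝟏ʳ j (λ i → - r i)) ⟩
        r j - r j
          ≈⟨ -‿inverseʳ _ ⟩
        0# ∎
    pairing′ (suc i) zero    = Y′⊥X₀ i
    pairing′ (suc i) (suc j) = Y′∙X i j

    X′⊆ : ∀ i → InSpan X (X′ i)
    X′⊆ i = (λ k → 𝟏 (suc i) k + - r i * 𝟏 zero k) , λ j → begin-equality
      X (suc i) j - r i * X zero j
        ≈⟨ +-congˡ (-‿distribˡ-* _ _) ⟩
      X (suc i) j + - r i * X zero j
        ≈⟨ +-cong (sum-𝟏ˡ (suc i) (λ k → X k j)) (*-congˡ (sum-𝟏ˡ zero (λ k → X k j))) ⟨
      (𝟏 (suc i) ⊙ X) j + - r i * (𝟏 zero ⊙ X) j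
        ≈⟨ +-congˡ (∙-scaleˡ (- r i) (𝟏 zero) (λ k → X k j)) ⟨
      (𝟏 (suc i) ⊙ X) j + ((λ k → - r i * 𝟏 zero k) ⊙ X) j
        ≈⟨ ∙-distribʳ-+ (𝟏 (suc i)) (λ k → - r i * 𝟏 zero k) (λ k → X k j) ⟨
      ((λ k → 𝟏 (suc i) k + - r i * 𝟏 zero k) ⊙ X) j ∎

    Y′⊆ : ∀ i → InSpan X (Y′ i)
    Y′⊆ i = let u , Y′≈ = inSpan dual′ i
                v , ≈v = ⊙-inSpan {X = X} u X′ X′⊆
            in v , λ j → trans (Y′≈ j) (≈v j)

    inSpan′ : ∀ i → InSpan X (Y i)
    inSpan′ (suc i) = Y′⊆ i
    inSpan′ zero    = ⊙-inSpan {X = X} (a ⁻¹ Vector.∷ (λ i → - r i)) (X zero Vector.∷ Y′) λ where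
      zero    → row-inSpan X zero
      (suc i) → Y′⊆ i

    value : ∀ {p} (C : Matrix (suc n) p) → gramSchmidt X C ≈ ∑[ l < p ] ∣ (C ᵀ) l ⊙ Y ∣²
    value {p} C = begin-equality
      ∣ C zero ∣² / a + gramSchmidt X′ C′
        ≈⟨ +-cong (*-distribʳ-sum {p} (a ⁻¹) _) (proj₂ (proj₂ recursive) C′) ⟩
      ∑[ l < p ] (C zero l * C zero l / a) + ∑[ l < p ] ∣ (C′ ᵀ) l ⊙ Y′ ∣²
        ≈⟨ ∑-distrib-+ {p} _ _ ⟨
      ∑[ l < p ] (C zero l * C zero l / a + ∣ (C′ ᵀ) l ⊙ Y′ ∣²)
        ≈⟨ sum-cong-≋ {p} column ⟩
      ∑[ l < p ] ∣ (C ᵀ) l ⊙ Y ∣² ∎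
      where
      C′ = eliminate r C

      split : ∀ l j → ((C ᵀ) l ⊙ Y) j ≈ C zero l / a * X zero j + ((C′ ᵀ) l ⊙ Y′) j
      split l j = begin-equality
        c * (a ⁻¹ * x + (λ i → - r i) ∙ y) + cs ∙ y
          ≈⟨ solve 5 (λ c b x s t → c :* (b :* x :+ s) :+ t := c :* b :* x :+ (t :+ c :* s)) refl
               c (a ⁻¹) x ((λ i → - r i) ∙ y) (cs ∙ y) ⟩
        c / a * x + (cs ∙ y + c * ((λ i → - r i) ∙ y))
          ≈⟨ +-congˡ (+-congˡ (∙-scaleˡ c (λ i → - r i) y)) ⟨
        c / a * x + (cs ∙ y + (λ i → c * - r i) ∙ y)
          ≈⟨ +-congˡ (∙-distribʳ-+ cs (λ i → c * - r i) y) ⟨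
        c / a * x + (λ i → cs i + c * - r i) ∙ y
          ≈⟨ +-congˡ (∙-cong {c = y} (λ i → solve 3 (λ s c r → s :+ c :* :- r := s :- r :* c) refl (cs i) c (r i)) (λ _ → refl)) ⟩
        c / a * x + (λ i → cs i - r i * c) ∙ y ∎
        where
        c = C zero l
        cs = λ i → C (suc i) l
        x = X zero j
        y = λ i → Y′ i j

      column : ∀ l → C zero l * C zero l / a + ∣ (C′ ᵀ) l ⊙ Y′ ∣² ≈ ∣ (C ᵀ) l ⊙ Y ∣²
      column l = begin-equality
        c * c / a + ∣ (C′ ᵀ) l ⊙ Y′ ∣²
          ≈⟨ +-congʳ scaled-norm ⟨
        ∣ (λ j → c / a * X zero j) ∣² + ∣ (C′ ᵀ) l ⊙ Y′ ∣²
          ≈⟨ ∣∣²-+ (λ j → c / a * X zero j) ((C′ ᵀ) l ⊙ Y′) (trans (∙-scaleˡ (c / a) (X zero) _)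
               (trans (*-congˡ (trans (∙-comm (X zero) _)
                 (trans (⊙-∙ ((C′ ᵀ) l) Y′ (X zero)) (∙-zeroʳ {a = (C′ ᵀ) l} Y′⊥X₀)))) (zeroʳ _))) ⟨
        ∣ (λ j → c / a * X zero j + ((C′ ᵀ) l ⊙ Y′) j) ∣²
          ≈⟨ ∙-cong (split l) (split l) ⟨
        ∣ (C ᵀ) l ⊙ Y ∣² ∎
        where
        c = C zero l
        scaled-norm : ∣ (λ j → c / a * X zero j) ∣² ≈ c * c / a
        scaled-norm = begin-equality
          ∣ (λ j → c / a * X zero j) ∣²        ≈⟨ trans (∙-scaleˡ (c / a) (X zero) _) (*-congˡ (∙-scaleʳ (c / a) (X zero) (X zero))) ⟩
          c / a * (c / a * a)                  ≈⟨ *-congˡ (x/y*y≈x a≉0) ⟩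
          c / a * c                            ≈⟨ solve 2 (λ c b → c :* b :* c := c :* c :* b) refl c (a ⁻¹) ⟩
          c * c / a                            ∎

  gramSchmidt-𝟏 : {X Y : Matrix n m} → Dual X Y → gramSchmidt X 𝟏 ≈ ∑[ i < n ] ∣ Y i ∣²
  gramSchmidt-𝟏 {n} {m} {X} {Y} dual =
    let Z , dualZ , value = gramSchmidt-dual X (dual⇒independent {X = X} {Y} (pairing dual))
        𝟏⊙Z : ∀ l j → ((𝟏 ᵀ) l ⊙ Z) j ≈ Y l j
        𝟏⊙Z l j = trans (sum-cong-≋ {n} λ i → *-congʳ (𝟏-sym i l))
          (trans (sum-𝟏ˡ l (λ i → Z i j)) (dual-unique dualZ dual l j))
    in trans (value 𝟏) (sum-cong-≋ {n} λ l → ∙-cong (𝟏⊙Z l) (𝟏⊙Z l))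

  -- Inverses and pseudo-inverses

  ≋-trans : {A B C : Matrix n m} → A ≋ B → B ≋ C → A ≋ C
  ≋-trans A≋B B≋C i j = trans (A≋B i j) (B≋C i j)

  ⊗-cong : {A B : Matrix n m} {C D : Matrix m p} → A ≋ B → C ≋ D → A ⊗ C ≋ B ⊗ D
  ⊗-cong A≋B C≋D i j = ∙-cong (A≋B i) (λ k → C≋D k j)

  ⊗-congˡ : (A : Matrix n m) {C D : Matrix m p} → C ≋ D → A ⊗ C ≋ A ⊗ D
  ⊗-congˡ A = ⊗-cong {A = A} λ _ _ → refl

  ⊗-congʳ : (C : Matrix m p) {A B : Matrix n m} → A ≋ B → A ⊗ C ≋ B ⊗ C
  ⊗-congʳ C A≋B = ⊗-cong {C = C} A≋B λ _ _ → refl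

  ⊗-assoc : (A : Matrix n m) (B : Matrix m k) (C : Matrix k p) → A ⊗ B ⊗ C ≋ A ⊗ (B ⊗ C)
  ⊗-assoc A B C i j = ⊙-∙ (A i) B (λ k → C k j)

  ⊗-identityˡ : (A : Matrix n m) → 𝟏 ⊗ A ≋ A
  ⊗-identityˡ A i j = sum-𝟏ˡ i (λ k → A k j)

  ⊗-identityʳ : (A : Matrix n m) → A ⊗ 𝟏 ≋ A
  ⊗-identityʳ A i j = sum-𝟏ʳ j (A i)

  ᵀ-⊗ : (A : Matrix n m) (B : Matrix m p) → (A ⊗ B) ᵀ ≋ B ᵀ ⊗ A ᵀ
  ᵀ-⊗ A B i j = ∙-comm (A j) (λ k → B k i)

  left⇒right-inverse-unique : {A : Matrix n m} {B C : Matrix m n} → B ⊗ A ≋ 𝟏 → A ⊗ C ≋ 𝟏 → B ≋ C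
  left⇒right-inverse-unique {A = A} {B} {C} BA≋𝟏 AC≋𝟏 i j = begin-equality
    B i j              ≈⟨ ⊗-identityʳ B i j ⟨
    (B ⊗ 𝟏) i j        ≈⟨ ⊗-congˡ B AC≋𝟏 i j ⟨
    (B ⊗ (A ⊗ C)) i j  ≈⟨ ⊗-assoc B A C i j ⟨
    (B ⊗ A ⊗ C) i j    ≈⟨ ⊗-congʳ C BA≋𝟏 i j ⟩
    (𝟏 ⊗ C) i j        ≈⟨ ⊗-identityˡ C i j ⟩
    C i j              ∎

  ⁺-unique : {A : Matrix n m} {B : Matrix m n} → IsInverse A B → A ⁺ ≋ B
  ⁺-unique {A = A} {B} inverse = left⇒right-inverse-unique {A = A}
    (proj₂ (choose-satisfies 𝟎 (IsInverse A) (B , inverse))) (proj₁ inverse)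

  -- The span coefficients come from Bᵀ = Bᵀ (B A) = (Bᵀ B) A.
  inverse⇒dual : {A : Matrix n m} {B : Matrix m n} → IsInverse A B → Dual A (B ᵀ)
  inverse⇒dual {A = A} {B} (AB≋𝟏 , BA≋𝟏) = record
    { pairing = λ i j → trans (∙-comm ((B ᵀ) i) (A j)) (trans (AB≋𝟏 j i) (𝟏-sym j i))
    ; inSpan  = λ i → (B ᵀ ⊗ B) i , λ j → begin-equality
        (B ᵀ) i j                ≈⟨ ⊗-identityʳ (B ᵀ) i j ⟨
        (B ᵀ ⊗ 𝟏) i j            ≈⟨ ⊗-congˡ (B ᵀ) BA≋𝟏 i j ⟨
        (B ᵀ ⊗ (B ⊗ A)) i j      ≈⟨ ⊗-assoc (B ᵀ) B A i j ⟨
        (B ᵀ ⊗ B ⊗ A) i j        ∎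
    }

  dual-rightInverse : {X Y : Matrix n m} → Dual X Y → X ⊗ Y ᵀ ≋ 𝟏
  dual-rightInverse {X = X} {Y} dual i j =
    trans (∙-comm (X i) (Y j)) (trans (pairing dual j i) (𝟏-sym j i))

  -- The coefficients that express `Y i` in the rows of `X` are forced: pairing with `Y k` singles
  -- out the k-th one. They form a symmetric matrix, and this symmetry makes `Y ᵀ ⊗ X` symmetric.
  dual-gram : {X Y : Matrix n m} → Dual X Y → Y ≋ Y ⊗ Y ᵀ ⊗ X
  dual-gram {X = X} {Y} dual i j = let u , Y≈uX = inSpan dual i in begin-equality
    Y i j                       ≈⟨ Y≈uX j ⟩
    (u ⊙ X) j                   ≈⟨ ∙-cong {c = λ k → X k j} (λ k → begin-equality
        u k                         ≈⟨ sum-𝟏ʳ k u ⟨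
        u ∙ (λ q → 𝟏 q k)           ≈⟨ ∙-cong {a = u} (λ _ → refl) (λ q → dual-rightInverse dual q k) ⟨
        u ∙ (λ q → X q ∙ Y k)       ≈⟨ ⊙-∙ u X (Y k) ⟨
        u ⊙ X ∙ Y k                 ≈⟨ ∙-cong {c = Y k} Y≈uX (λ _ → refl) ⟨
        Y i ∙ Y k                   ∎) (λ _ → refl) ⟩
    (Y ⊗ Y ᵀ ⊗ X) i j           ∎

  dual-projection-sym : {X Y : Matrix n m} → Dual X Y → (Y ᵀ ⊗ X) ᵀ ≋ Y ᵀ ⊗ X
  dual-projection-sym {X = X} {Y} dual i j = begin-equality
    ((Y ᵀ ⊗ X) ᵀ) i j           ≈⟨ ᵀ-⊗ (Y ᵀ) X i j ⟩
    (X ᵀ ⊗ Y) i j               ≈⟨ ⊗-congˡ (X ᵀ) (dual-gram dual) i j ⟩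
    (X ᵀ ⊗ (N ⊗ X)) i j         ≈⟨ ⊗-assoc (X ᵀ) N X i j ⟨
    (X ᵀ ⊗ N ⊗ X) i j           ≈⟨ ⊗-congʳ X (⊗-congˡ (X ᵀ) (ᵀ-⊗ Y (Y ᵀ))) i j ⟨
    (X ᵀ ⊗ N ᵀ ⊗ X) i j         ≈⟨ ⊗-congʳ X (ᵀ-⊗ N X) i j ⟨
    ((N ⊗ X) ᵀ ⊗ X) i j         ≈⟨ ⊗-congʳ X (λ a b → dual-gram dual b a) i j ⟨
    (Y ᵀ ⊗ X) i j               ∎
    where N = Y ⊗ Y ᵀ

  dual⇒pseudoInverse : {X Y : Matrix n m} → Dual X Y → IsPseudoInverse X (Y ᵀ)
  dual⇒pseudoInverse {X = X} {Y} dual =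
      ≋-trans (⊗-congʳ X XP≋𝟏) (⊗-identityˡ X)
    , ≋-trans (⊗-assoc (Y ᵀ) X (Y ᵀ)) (≋-trans (⊗-congˡ (Y ᵀ) XP≋𝟏) (⊗-identityʳ (Y ᵀ)))
    , (λ i j → trans (XP≋𝟏 j i) (trans (𝟏-sym j i) (sym (XP≋𝟏 i j))))
    , dual-projection-sym dual
    where XP≋𝟏 = dual-rightInverse dual

  -- Of the chosen matrix only the Penrose conditions are known, so the usual uniqueness argument
  -- compares it with `Y ᵀ`.
  †-dual : {X Y : Matrix n m} → Dual X Y → X † ≋ Y ᵀ
  †-dual {X = X} {Y} dual i j = begin-equality
    B i j                  ≈⟨ ⊗-identityʳ B i j ⟨
    (B ⊗ 𝟏) i j            ≈⟨ ⊗-congˡ B XP≋𝟏 i j ⟨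
    (B ⊗ (X ⊗ P)) i j      ≈⟨ ⊗-assoc B X P i j ⟨
    (B ⊗ X ⊗ P) i j        ≈⟨ ⊗-congʳ P BX≋PX i j ⟩
    (P ⊗ X ⊗ P) i j        ≈⟨ PXP≋P i j ⟩
    P i j                  ∎
    where
    P = Y ᵀ
    B = X †
    XP≋𝟏 = dual-rightInverse dual
    pseudoP = dual⇒pseudoInverse dual
    PXP≋P = proj₁ (proj₂ pseudoP)
    pseudoB = choose-satisfies 𝟎 (IsPseudoInverse X) (P , pseudoP)
    BXᵀ≋BX = proj₂ (proj₂ (proj₂ pseudoB))
    -- Both products are symmetric, (B X)(P X) = B X and (P X)(B X) = P X. Transposing the first
    -- identity therefore turns it into the second.
    BX≋PX : B ⊗ X ≋ P ⊗ X
    BX≋PX i j = begin-equality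
      (B ⊗ X) i j                        ≈⟨ ⊗-congˡ B (proj₁ pseudoP) i j ⟨
      (B ⊗ (X ⊗ P ⊗ X)) i j              ≈⟨ ⊗-congˡ B (⊗-assoc X P X) i j ⟩
      (B ⊗ (X ⊗ (P ⊗ X))) i j            ≈⟨ ⊗-assoc B X (P ⊗ X) i j ⟨
      (B ⊗ X ⊗ (P ⊗ X)) i j              ≈⟨ ⊗-cong BXᵀ≋BX (dual-projection-sym dual) i j ⟨
      ((B ⊗ X) ᵀ ⊗ (P ⊗ X) ᵀ) i j        ≈⟨ ᵀ-⊗ (P ⊗ X) (B ⊗ X) i j ⟨
      (P ⊗ X ⊗ (B ⊗ X)) j i              ≈⟨ ⊗-assoc P X (B ⊗ X) j i ⟩
      (P ⊗ (X ⊗ (B ⊗ X))) j i            ≈⟨ ⊗-congˡ P (⊗-assoc X B X) j i ⟨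
      (P ⊗ (X ⊗ B ⊗ X)) j i              ≈⟨ ⊗-congˡ P (proj₁ pseudoB) j i ⟩
      (P ⊗ X) j i                        ≈⟨ dual-projection-sym dual i j ⟩
      (P ⊗ X) i j                        ∎

  -- The projection Q = Yᵀ ⊗ X has trace n, so 𝟏 - Q is a projection of trace 0,
  -- and the trace of a symmetric projection is its squared Frobenius norm.
  dual-square : {X Y : Matrix n m} → n ≡ m → Dual X Y → IsInverse X (Y ᵀ)
  dual-square {n} {m} {X} {Y} n≡m dual = dual-rightInverse dual , λ i j → begin-equality
    Q i j                            ≈⟨ solve 2 (λ q d → q := d :+ :- (d :- q)) refl (Q i j) (𝟏 i j) ⟩
    𝟏 i j - D i j                    ≈⟨ +-congˡ (trans (-‿cong (∣a∣²≈0⇒a≈0 {a = D i} (D≈0 i) j)) -0#≈0#) ⟩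
    𝟏 i j + 0#                       ≈⟨ +-identityʳ _ ⟩
    𝟏 i j                            ∎
    where
    Q D : Matrix m m
    Q = Y ᵀ ⊗ X
    D i j = 𝟏 i j - Q i j

    Q-sym : ∀ i j → Q i j ≈ Q j i
    Q-sym i j = dual-projection-sym dual j i

    Q-idempotent : ∀ i → Q i ∙ Q i ≈ Q i i
    Q-idempotent i = begin-equality
      Q i ∙ Q i                    ≈⟨ ∙-cong {a = Q i} (λ _ → refl) (Q-sym i) ⟩
      (Q ⊗ (Y ᵀ ⊗ X)) i i          ≈⟨ ⊗-assoc Q (Y ᵀ) X i i ⟨
      (Y ᵀ ⊗ X ⊗ Y ᵀ ⊗ X) i i      ≈⟨ ⊗-congʳ X (proj₁ (proj₂ (dual⇒pseudoInverse dual))) i i ⟩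
      Q i i                        ∎

    ∣D∣² : ∀ i → ∣ D i ∣² ≈ 1# + - 1# * Q i i
    ∣D∣² i = begin-equality
      D i ∙ D i
        ≈⟨ ∙-distribʳ-+ (𝟏 i) (λ j → - Q i j) (D i) ⟩
      𝟏 i ∙ D i + (λ j → - Q i j) ∙ D i
        ≈⟨ +-cong (sum-𝟏ˡ i (D i)) (begin-equality
             (λ j → - Q i j) ∙ D i
               ≈⟨ ∙-comm (λ j → - Q i j) (D i) ⟩
             D i ∙ (λ j → - Q i j)
               ≈⟨ ∙-distribʳ-+ (𝟏 i) (λ j → - Q i j) (λ j → - Q i j) ⟩
             𝟏 i ∙ (λ j → - Q i j) + (λ j → - Q i j) ∙ (λ j → - Q i j)
               ≈⟨ +-cong (sum-𝟏ˡ i (λ j → - Q i j)) (sum-cong-≋ {m} λ j → solve 1 (λ q → (:- q) :* (:- q) := q :* q) refl (Q i j)) ⟩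
             - Q i i + Q i ∙ Q i
               ≈⟨ +-congˡ (Q-idempotent i) ⟩
             - Q i i + Q i i ∎) ⟩
      𝟏 i i - Q i i + (- Q i i + Q i i)
        ≈⟨ +-congʳ (+-congʳ (𝟏-diagonal i)) ⟩
      1# - Q i i + (- Q i i + Q i i)
        ≈⟨ solve 1 (λ q → con (+ 1) :- q :+ (:- q :+ q) := con (+ 1) :+ :- con (+ 1) :* q) refl (Q i i) ⟩
      1# + - 1# * Q i i ∎

    trace : ∑[ i < m ] Q i i ≈ fromℕ n * 1#
    trace = begin-equality
      ∑[ i < m ] ∑[ l < n ] (Y l i * X l i)     ≈⟨ ∑-comm {m} {n} (λ i l → Y l i * X l i) ⟩
      ∑[ l < n ] (Y l ∙ X l)                    ≈⟨ sum-cong-≋ {n} (λ l → trans (pairing dual l l) (𝟏-diagonal l)) ⟩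
      ∑[ l < n ] 1#                             ≈⟨ sum-const n 1# ⟩
      fromℕ n * 1#                              ∎

    sum-D≈0 : ∑[ i < m ] ∣ D i ∣² ≈ 0#
    sum-D≈0 = begin-equality
      ∑[ i < m ] ∣ D i ∣²                       ≈⟨ sum-cong-≋ {m} ∣D∣² ⟩
      ∑[ i < m ] (1# + - 1# * Q i i)            ≈⟨ ∑-distrib-+ {m} (λ _ → 1#) (λ i → - 1# * Q i i) ⟩
      ∑[ i < m ] 1# + ∑[ i < m ] (- 1# * Q i i) ≈⟨ +-cong (sum-const m 1#) (sym (*-distribˡ-sum {m} (- 1#) (λ i → Q i i))) ⟩
      fromℕ m * 1# + - 1# * ∑[ i < m ] Q i i    ≈⟨ +-congˡ (*-congˡ trace) ⟩
      fromℕ m * 1# + - 1# * (fromℕ n * 1#)      ≡⟨ ≡.cong (λ k → fromℕ m * 1# + - 1# * (fromℕ k * 1#)) n≡m ⟩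
      fromℕ m * 1# + - 1# * (fromℕ m * 1#)      ≈⟨ solve 1 (λ x → x :+ :- con (+ 1) :* x := con (+ 0)) refl (fromℕ m * 1#) ⟩
      0#                                        ∎

    D≈0 : ∀ i → ∣ D i ∣² ≈ 0#
    D≈0 i = antisym (≤-trans (term≤sum (λ i → ∣∣²-nonNeg (D i)) i) (≤-reflexive sum-D≈0)) (∣∣²-nonNeg (D i))

  -- The `n` independent columns form a square matrix. The dual basis of its columns is a two-sided
  -- inverse, so its rows are independent too, and a relation among the rows of `X` restricts to one
  -- among these.
  fullRank⇒independent : {X : Matrix n m} → HasRank X n → IndependentColumns (X ᵀ)
  fullRank⇒independent {n} {m} {X} ((c , independent) , _) v Xv≈0 =
    dual⇒independent {X = Xᶜ} {Y = Y ᵀ} (λ i j → proj₂ (dual-square ≡.refl dual) i j) v (λ j → Xv≈0 (c j))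
    where
    Xᶜ : Matrix n n
    Xᶜ i j = X i (c j)
    construction = gramSchmidt-dual (Xᶜ ᵀ) independent
    Y = proj₁ construction
    dual = proj₁ (proj₂ construction)

  -- Norms

  frobenius : Matrix n m → ℝ
  frobenius {n} A = ∑[ i < n ] ∣ A i ∣²

  frobenius-nonNeg : (A : Matrix n m) → 0# ≤ frobenius A
  frobenius-nonNeg A = sum-nonNeg λ i → ∣∣²-nonNeg (A i)

  frobenius-cong : {A B : Matrix n m} → A ≋ B → frobenius A ≈ frobenius B
  frobenius-cong {n} A≋B = sum-cong-≋ {n} λ i → ∙-cong (A≋B i) (A≋B i)

  frobenius-ᵀ : (A : Matrix n m) → frobenius (A ᵀ) ≈ frobenius A
  frobenius-ᵀ {n} {m} A = ∑-comm {m} {n} λ i j → A j i * A j i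

  ‖‖F-square : (A : Matrix n m) → ‖ A ‖F ^ 2 ≈ frobenius A
  ‖‖F-square A = √-^2 (frobenius-nonNeg A)

  -- The vector `w` is chosen so that `∣ w ∣²` equals `B * (A * B - C * C)`; a positive `B` cancels
  -- from its nonnegativity, and for `B ≈ 0#` the vector `b` vanishes.
  cauchy-schwarz : (a b : Vector ℝ m) → a ∙ b * a ∙ b ≤ ∣ a ∣² * ∣ b ∣²
  cauchy-schwarz {m} a b with em {∣ b ∣² ≈ 0#}
  ... | yes b≈0 = ≤-trans (≤-reflexive (trans (*-congʳ (∙-zeroʳ {a = a} (∣a∣²≈0⇒a≈0 {a = b} b≈0))) (zeroˡ _)))
                          (*-nonNeg (∣∣²-nonNeg a) (∣∣²-nonNeg b))
  ... | no b≉0 = *-cancelˡ-≤ (∣∣²-nonNeg b , b≉0 ∘ sym) (difference⇒≤ (begin-equality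
      B * (A * B) - B * (C * C)
        ≈⟨ solve 3 (λ A B C → B :* (A :* B) :- B :* (C :* C)
             := B :* (B :* A :+ :- C :* C) :+ :- C :* (B :* C :+ :- C :* B)) refl A B C ⟩
      B * (B * A + - C * C) + - C * (B * C + - C * B)
        ≈⟨ +-cong (*-congˡ (expand a (∙-comm b a))) (*-congˡ (expand b refl)) ⟨
      B * (w ∙ a) + - C * (w ∙ b)
        ≈⟨ +-cong (*-congˡ (∙-comm w a)) (*-congˡ (∙-comm w b)) ⟩
      B * (a ∙ w) + - C * (b ∙ w)
        ≈⟨ +-cong (∙-scaleˡ B a w) (∙-scaleˡ (- C) b w) ⟨
      (λ j → B * a j) ∙ w + (λ j → - C * b j) ∙ w
        ≈⟨ ∙-distribʳ-+ (λ j → B * a j) (λ j → - C * b j) w ⟨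
      ∣ w ∣² ∎) (∣∣²-nonNeg w))
    where
    A = ∣ a ∣²
    B = ∣ b ∣²
    C = a ∙ b
    w : Vector ℝ m
    w j = B * a j + - C * b j
    expand : ∀ c {x} → b ∙ c ≈ x → w ∙ c ≈ B * (a ∙ c) + - C * x
    expand c bc≈x = trans (∙-distribʳ-+ (λ j → B * a j) (λ j → - C * b j) c)
      (+-cong (∙-scaleˡ B a c) (trans (∙-scaleˡ (- C) b c) (*-congˡ bc≈x)))

  ‖‖-square : (v : Vector ℝ n) → ‖ v ‖ * ‖ v ‖ ≈ ∣ v ∣²
  ‖‖-square v = √-square (∣∣²-nonNeg v)

  Stretch : Matrix n m → ℝ → Set
  Stretch {m = m} A t = ∃ λ (v : Vector ℝ m) → ‖ v ‖ ≤ 1# × t ≈ ‖ A ·ᵛ v ‖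

  ‖v‖≤1 : (v : Vector ℝ n) → ∣ v ∣² ≤ 1# → ‖ v ‖ ≤ 1#
  ‖v‖≤1 v ∣v∣²≤1 = square-cancel-≤ 0≤1
    (≤-trans (≤-reflexive (‖‖-square v)) (≤-trans ∣v∣²≤1 (≤-reflexive (sym (*-identityˡ 1#)))))

  zero-stretch : (A : Matrix n m) → Stretch A ‖ A ·ᵛ (λ _ → 0#) ‖
  zero-stretch {n} {m} A = (λ _ → 0#) , ‖v‖≤1 {m} (λ _ → 0#)
    (≤-trans (≤-reflexive (∙-zeroˡ {m} {b = λ _ → 0#} λ _ → refl)) 0≤1) , refl

  stretch≤‖‖F : (A : Matrix n m) → IsUpperBound (Stretch A) ‖ A ‖F
  stretch≤‖‖F {n} A {t} (v , ‖v‖≤1 , t≈) = ≤-trans (≤-reflexive t≈)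
    (square-cancel-≤ (√-nonNeg (frobenius-nonNeg A)) (begin
      ‖ A ·ᵛ v ‖ * ‖ A ·ᵛ v ‖           ≈⟨ ‖‖-square (A ·ᵛ v) ⟩
      ∑[ i < n ] (A i ∙ v * A i ∙ v)    ≤⟨ sum-mono-≤ {n} (λ i → begin
          A i ∙ v * A i ∙ v                ≤⟨ cauchy-schwarz (A i) v ⟩
          ∣ A i ∣² * ∣ v ∣²                ≈⟨ *-congˡ (‖‖-square v) ⟨
          ∣ A i ∣² * (‖ v ‖ * ‖ v ‖)       ≤⟨ *-monoˡ-≤ (∣∣²-nonNeg (A i)) (*-mono-≤ 0≤‖v‖ ‖v‖≤1 0≤‖v‖ ‖v‖≤1) ⟩
          ∣ A i ∣² * (1# * 1#)             ≈⟨ solve 1 (λ a → a :* (con (+ 1) :* con (+ 1)) := a) refl ∣ A i ∣² ⟩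
          ∣ A i ∣²                         ∎) ⟩
      frobenius A                       ≈⟨ √-square (frobenius-nonNeg A) ⟨
      ‖ A ‖F * ‖ A ‖F                   ∎))
    where
    0≤‖v‖ : 0# ≤ ‖ v ‖
    0≤‖v‖ = √-nonNeg (∣∣²-nonNeg v)

  ‖‖₂-isSup : (A : Matrix n m) → IsSup (Stretch A) ‖ A ‖₂
  ‖‖₂-isSup A = choose-satisfies 0# (IsSup (Stretch A))
    (complete (Stretch A) (_ , zero-stretch A) (‖ A ‖F , stretch≤‖‖F A))

  ‖‖₂-square-≤ : (A : Matrix n m) → ‖ A ‖₂ ^ 2 ≤ frobenius A
  ‖‖₂-square-≤ A = begin
    ‖ A ‖₂ ^ 2            ≈⟨ x^2≈xx _ ⟩
    ‖ A ‖₂ * ‖ A ‖₂       ≤⟨ *-mono-≤ 0≤‖A‖₂ ‖A‖₂≤‖A‖F 0≤‖A‖₂ ‖A‖₂≤‖A‖F ⟩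
    ‖ A ‖F * ‖ A ‖F       ≈⟨ √-square (frobenius-nonNeg A) ⟩
    frobenius A           ∎
    where
    ‖A‖₂≤‖A‖F = proj₂ (‖‖₂-isSup A) (stretch≤‖‖F A)
    0≤‖A‖₂ = ≤-trans (√-nonNeg (∣∣²-nonNeg (A ·ᵛ λ _ → 0#))) (proj₁ (‖‖₂-isSup A) (zero-stretch A))

  -- Every column is the image of a unit vector. Applied to `X †`, which has `n` columns, this
  -- produces the factor `fromℕ n` of the spectral bound.
  frobenius≤‖‖₂ : (A : Matrix n m) → frobenius A ≤ fromℕ m * ‖ A ‖₂ ^ 2
  frobenius≤‖‖₂ {n} {m} A = begin
    frobenius A                   ≈⟨ frobenius-ᵀ A ⟨
    frobenius (A ᵀ)               ≤⟨ sum-mono-≤ {m} column≤ ⟩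
    ∑[ j < m ] (‖ A ‖₂ ^ 2)       ≈⟨ sum-const m _ ⟩
    fromℕ m * ‖ A ‖₂ ^ 2          ∎
    where
    column≤ : ∀ j → ∣ (A ᵀ) j ∣² ≤ ‖ A ‖₂ ^ 2
    column≤ j = begin
      ∣ (A ᵀ) j ∣²                    ≈⟨ ∙-cong (λ i → sym (trans (∙-comm (A i) (𝟏 j)) (sum-𝟏ˡ j (A i))))
                                                (λ i → sym (trans (∙-comm (A i) (𝟏 j)) (sum-𝟏ˡ j (A i)))) ⟩
      ∣ A ·ᵛ 𝟏 j ∣²                   ≈⟨ ‖‖-square (A ·ᵛ 𝟏 j) ⟨
      ‖ A ·ᵛ 𝟏 j ‖ * ‖ A ·ᵛ 𝟏 j ‖     ≤⟨ *-mono-≤ 0≤ stretch≤ 0≤ stretch≤ ⟩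
      ‖ A ‖₂ * ‖ A ‖₂                 ≈⟨ x^2≈xx _ ⟨
      ‖ A ‖₂ ^ 2                      ∎
      where
      0≤ = √-nonNeg (∣∣²-nonNeg (A ·ᵛ 𝟏 j))
      stretch≤ = proj₁ (‖‖₂-isSup A) (𝟏 j , ‖v‖≤1 (𝟏 j)
        (≤-reflexive (trans (sum-𝟏ˡ j (𝟏 j)) (𝟏-diagonal j))) , refl)

  -- Exterior algebra

  -- Both index types are arbitrary, so that one set of consequences covers wedges in either
  -- argument, contractions and, with `J` equal to `Fin 1`, scalar-valued sums over subsets.
  record Linear {I J : Set} (L : (I → ℝ) → J → ℝ) : Set where
    field
      respects  : ∀ {f g} → (∀ i → f i ≈ g i) → ∀ j → L f j ≈ L g j
      additive   : ∀ f g j → L (λ i → f i + g i) j ≈ L f j + L g j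
      homogeneous : ∀ a f j → L (λ i → a * f i) j ≈ a * L f j

    null : ∀ {f} → (∀ i → f i ≈ 0#) → ∀ j → L f j ≈ 0#
    null {f} f≈0 j = trans (respects (λ i → trans (f≈0 i) (sym (zeroˡ (f i)))) j) (trans (homogeneous 0# f j) (zeroˡ _))

    negate : ∀ f j → L (λ i → - f i) j ≈ - L f j
    negate f j = trans (respects (λ i → solve 1 (λ x → :- x := :- con (+ 1) :* x) refl (f i)) j)
      (trans (homogeneous (- 1#) f j) (solve 1 (λ x → :- con (+ 1) :* x := :- x) refl (L f j)))

    respects-sum : (c : Vector ℝ n) (f : Fin n → I → ℝ) →
      ∀ j → L (λ i → ∑[ k < n ] (c k * f k i)) j ≈ ∑[ k < n ] (c k * L (f k) j)
    respects-sum {zero}  c f j = null (λ _ → refl) j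
    respects-sum {suc n} c f j = trans (additive _ _ j) (+-cong (homogeneous (c zero) (f zero) j) (respects-sum (c ∘ suc) (f ∘ suc) j))

  Form : ℕ → Set
  Form m = Subset m → ℝ

  infixr 6 _∧_ _⌟_

  -- A form in m + 1 variables is e ∧ α + β with e the first basis vector; its
  -- coefficients at inside ∷ T and outside ∷ T are those of α and β at T.
  _∧_ : Vector ℝ m → Form m → Form m
  (x ∧ ω) []            = 0#
  (x ∧ ω) (inside  ∷ T) = x zero * ω (outside ∷ T) - (x ∘ suc ∧ ω ∘ (inside ∷_)) T
  (x ∧ ω) (outside ∷ T) = (x ∘ suc ∧ ω ∘ (outside ∷_)) T

  -- The interior product: for ω = e ∧ α + β and y = y₀ e + y′ it is y₀ α - e ∧ (y′ ⌟ α) + y′ ⌟ β.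
  _⌟_ : Vector ℝ m → Form m → Form m
  (y ⌟ ω) []            = 0#
  (y ⌟ ω) (inside  ∷ T) = - (y ∘ suc ⌟ ω ∘ (inside ∷_)) T
  (y ⌟ ω) (outside ∷ T) = y zero * ω (inside ∷ T) + (y ∘ suc ⌟ ω ∘ (outside ∷_)) T

  ⟪_,_⟫ : Form m → Form m → ℝ
  ⟪ ω , τ ⟫ = sumSubsets λ T → ω T * τ T

  ∧-linearʳ : (x : Vector ℝ m) → Linear (x ∧_)
  ∧-linearʳ x = record { respects = respects x ; additive = additive x ; homogeneous = homogeneous x }
    where
    respects : (x : Vector ℝ m) {ω τ : Form m} → (∀ T → ω T ≈ τ T) → ∀ T → (x ∧ ω) T ≈ (x ∧ τ) T
    respects x ω≈τ []            = refl
    respects x ω≈τ (inside  ∷ T) = +-cong (*-congˡ (ω≈τ _)) (-‿cong (respects (x ∘ suc) (ω≈τ ∘ (inside ∷_)) T))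
    respects x ω≈τ (outside ∷ T) = respects (x ∘ suc) (ω≈τ ∘ (outside ∷_)) T
    additive : (x : Vector ℝ m) (ω τ : Form m) → ∀ T → (x ∧ (λ T → ω T + τ T)) T ≈ (x ∧ ω) T + (x ∧ τ) T
    additive x ω τ []            = sym (+-identityʳ 0#)
    additive x ω τ (inside  ∷ T) = trans (+-congˡ (-‿cong (additive (x ∘ suc) (ω ∘ (inside ∷_)) (τ ∘ (inside ∷_)) T)))
      (solve 5 (λ x a b c d → x :* (a :+ b) :- (c :+ d) := (x :* a :- c) :+ (x :* b :- d)) refl _ _ _ _ _)
    additive x ω τ (outside ∷ T) = additive (x ∘ suc) (ω ∘ (outside ∷_)) (τ ∘ (outside ∷_)) T
    homogeneous : (x : Vector ℝ m) (a : ℝ) (ω : Form m) → ∀ T → (x ∧ (λ T → a * ω T)) T ≈ a * (x ∧ ω) T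
    homogeneous x a ω []            = sym (zeroʳ a)
    homogeneous x a ω (inside  ∷ T) = trans (+-congˡ (-‿cong (homogeneous (x ∘ suc) a (ω ∘ (inside ∷_)) T)))
      (solve 4 (λ x a b c → x :* (a :* b) :- a :* c := a :* (x :* b :- c)) refl _ _ _ _)
    homogeneous x a ω (outside ∷ T) = homogeneous (x ∘ suc) a (ω ∘ (outside ∷_)) T

  ∧-linearˡ : (ω : Form m) → Linear (_∧ ω)
  ∧-linearˡ ω = record { respects = respects ω ; additive = additive ω ; homogeneous = homogeneous ω }
    where
    respects : (ω : Form m) {x y : Vector ℝ m} → (∀ j → x j ≈ y j) → ∀ T → (x ∧ ω) T ≈ (y ∧ ω) T
    respects ω x≈y []            = refl
    respects ω x≈y (inside  ∷ T) = +-cong (*-congʳ (x≈y zero)) (-‿cong (respects (ω ∘ (inside ∷_)) (x≈y ∘ suc) T))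
    respects ω x≈y (outside ∷ T) = respects (ω ∘ (outside ∷_)) (x≈y ∘ suc) T
    additive : (ω : Form m) (x y : Vector ℝ m) → ∀ T → ((λ j → x j + y j) ∧ ω) T ≈ (x ∧ ω) T + (y ∧ ω) T
    additive ω x y []            = sym (+-identityʳ 0#)
    additive ω x y (inside  ∷ T) = trans (+-congˡ (-‿cong (additive (ω ∘ (inside ∷_)) (x ∘ suc) (y ∘ suc) T)))
      (solve 5 (λ x y a c d → (x :+ y) :* a :- (c :+ d) := (x :* a :- c) :+ (y :* a :- d)) refl _ _ _ _ _)
    additive ω x y (outside ∷ T) = additive (ω ∘ (outside ∷_)) (x ∘ suc) (y ∘ suc) T
    homogeneous : (ω : Form m) (a : ℝ) (x : Vector ℝ m) → ∀ T → ((λ j → a * x j) ∧ ω) T ≈ a * (x ∧ ω) T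
    homogeneous ω a x []            = sym (zeroʳ a)
    homogeneous ω a x (inside  ∷ T) = trans (+-congˡ (-‿cong (homogeneous (ω ∘ (inside ∷_)) a (x ∘ suc) T)))
      (solve 4 (λ x a b c → a :* x :* b :- a :* c := a :* (x :* b :- c)) refl _ _ _ _)
    homogeneous ω a x (outside ∷ T) = homogeneous (ω ∘ (outside ∷_)) a (x ∘ suc) T

  ⌟-linearʳ : (y : Vector ℝ m) → Linear (y ⌟_)
  ⌟-linearʳ y = record { respects = respects y ; additive = additive y ; homogeneous = homogeneous y }
    where
    respects : (y : Vector ℝ m) {ω τ : Form m} → (∀ T → ω T ≈ τ T) → ∀ T → (y ⌟ ω) T ≈ (y ⌟ τ) T
    respects y ω≈τ []            = refl
    respects y ω≈τ (inside  ∷ T) = -‿cong (respects (y ∘ suc) (ω≈τ ∘ (inside ∷_)) T)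
    respects y ω≈τ (outside ∷ T) = +-cong (*-congˡ (ω≈τ _)) (respects (y ∘ suc) (ω≈τ ∘ (outside ∷_)) T)
    additive : (y : Vector ℝ m) (ω τ : Form m) → ∀ T → (y ⌟ (λ T → ω T + τ T)) T ≈ (y ⌟ ω) T + (y ⌟ τ) T
    additive y ω τ []            = sym (+-identityʳ 0#)
    additive y ω τ (inside  ∷ T) = trans (-‿cong (additive (y ∘ suc) (ω ∘ (inside ∷_)) (τ ∘ (inside ∷_)) T))
      (solve 2 (λ a b → :- (a :+ b) := :- a :+ :- b) refl _ _)
    additive y ω τ (outside ∷ T) = trans (+-congˡ (additive (y ∘ suc) (ω ∘ (outside ∷_)) (τ ∘ (outside ∷_)) T))
      (solve 5 (λ x a b c d → x :* (a :+ b) :+ (c :+ d) := (x :* a :+ c) :+ (x :* b :+ d)) refl _ _ _ _ _)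
    homogeneous : (y : Vector ℝ m) (a : ℝ) (ω : Form m) → ∀ T → (y ⌟ (λ T → a * ω T)) T ≈ a * (y ⌟ ω) T
    homogeneous y a ω []            = sym (zeroʳ a)
    homogeneous y a ω (inside  ∷ T) = trans (-‿cong (homogeneous (y ∘ suc) a (ω ∘ (inside ∷_)) T))
      (solve 2 (λ a b → :- (a :* b) := a :* :- b) refl _ _)
    homogeneous y a ω (outside ∷ T) = trans (+-congˡ (homogeneous (y ∘ suc) a (ω ∘ (outside ∷_)) T))
      (solve 4 (λ x a b c → x :* (a :* b) :+ a :* c := a :* (x :* b :+ c)) refl _ _ _ _)

  module ∧ʳ {m} (x : Vector ℝ m) = Linear (∧-linearʳ x)
  module ∧ˡ {m} (ω : Form m) = Linear (∧-linearˡ ω)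
  module ⌟ʳ {m} (y : Vector ℝ m) = Linear (⌟-linearʳ y)

  -- Sums over subsets, and the wedge and contraction identities.

  sumSubsets-cong : {f g : Form m} → (∀ T → f T ≈ g T) → sumSubsets f ≈ sumSubsets g
  sumSubsets-cong {zero}  f≈g = f≈g []
  sumSubsets-cong {suc m} f≈g =
    +-cong (sumSubsets-cong (f≈g ∘ (inside ∷_))) (sumSubsets-cong (f≈g ∘ (outside ∷_)))

  sumSubsets-linear : Linear {Subset m} {Fin 1} λ f _ → sumSubsets f
  sumSubsets-linear = record { respects = λ f≈g _ → sumSubsets-cong f≈g ; additive = λ f g _ → additive f g ; homogeneous = λ a f _ → homogeneous a f }
    where
    additive : (f g : Form m) → sumSubsets (λ T → f T + g T) ≈ sumSubsets f + sumSubsets g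
    additive {zero}  f g = refl
    additive {suc m} f g = trans (+-cong (additive (f ∘ (inside ∷_)) (g ∘ (inside ∷_))) (additive (f ∘ (outside ∷_)) (g ∘ (outside ∷_))))
      (solve 4 (λ a b c d → (a :+ b) :+ (c :+ d) := (a :+ c) :+ (b :+ d)) refl _ _ _ _)
    homogeneous : (a : ℝ) (f : Form m) → sumSubsets (λ T → a * f T) ≈ a * sumSubsets f
    homogeneous {zero}  a f = refl
    homogeneous {suc m} a f = trans (+-cong (homogeneous a (f ∘ (inside ∷_))) (homogeneous a (f ∘ (outside ∷_)))) (sym (distribˡ a _ _))

  sumSubsets-+ : (f g : Form m) → sumSubsets (λ T → f T + g T) ≈ sumSubsets f + sumSubsets g
  sumSubsets-+ f g = Linear.additive sumSubsets-linear f g zero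

  sumSubsets-* : (a : ℝ) (f : Form m) → sumSubsets (λ T → a * f T) ≈ a * sumSubsets f
  sumSubsets-* a f = Linear.homogeneous sumSubsets-linear a f zero

  sumSubsets-zero : {f : Form m} → (∀ T → f T ≈ 0#) → sumSubsets f ≈ 0#
  sumSubsets-zero f≈0 = Linear.null sumSubsets-linear f≈0 zero

  sumSubsets-neg : (f : Form m) → sumSubsets (λ T → - f T) ≈ - sumSubsets f
  sumSubsets-neg f = Linear.negate sumSubsets-linear f zero

  ⟪⟫-comm : (ω τ : Form m) → ⟪ ω , τ ⟫ ≈ ⟪ τ , ω ⟫
  ⟪⟫-comm {m} ω τ = sumSubsets-cong {m} λ T → *-comm _ _

  ⟪⟫-congʳ : (ω : Form m) {σ τ : Form m} → (∀ T → σ T ≈ τ T) → ⟪ ω , σ ⟫ ≈ ⟪ ω , τ ⟫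
  ⟪⟫-congʳ {m} ω σ≈τ = sumSubsets-cong {m} λ T → *-congˡ (σ≈τ T)

  ∧-⌟-adjoint : (x : Vector ℝ m) (ω τ : Form m) → ⟪ x ∧ ω , τ ⟫ ≈ ⟪ ω , x ⌟ τ ⟫
  ∧-⌟-adjoint {zero}  x ω τ = trans (zeroˡ _) (sym (zeroʳ _))
  ∧-⌟-adjoint {suc m} x ω τ = begin-equality
    sumSubsets (λ T → (x₀ * ωₒ T - (x′ ∧ ωᵢ) T) * τᵢ T) + ⟪ x′ ∧ ωₒ , τₒ ⟫
      ≈⟨ +-congʳ (trans (sumSubsets-cong {m} λ T → solve 4 (λ x a b c → (x :* a :- b) :* c := x :* (a :* c) :+ :- (b :* c)) refl x₀ (ωₒ T) _ _)
           (trans (sumSubsets-+ {m} _ _) (+-cong (sumSubsets-* {m} x₀ _) (sumSubsets-neg {m} _)))) ⟩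
    (x₀ * ⟪ ωₒ , τᵢ ⟫ - ⟪ x′ ∧ ωᵢ , τᵢ ⟫) + ⟪ x′ ∧ ωₒ , τₒ ⟫
      ≈⟨ +-cong (+-congˡ (-‿cong (∧-⌟-adjoint x′ ωᵢ τᵢ))) (∧-⌟-adjoint x′ ωₒ τₒ) ⟩
    (x₀ * ⟪ ωₒ , τᵢ ⟫ - ⟪ ωᵢ , x′ ⌟ τᵢ ⟫) + ⟪ ωₒ , x′ ⌟ τₒ ⟫
      ≈⟨ solve 3 (λ a b c → (a :- b) :+ c := :- b :+ (a :+ c)) refl _ _ _ ⟩
    - ⟪ ωᵢ , x′ ⌟ τᵢ ⟫ + (x₀ * ⟪ ωₒ , τᵢ ⟫ + ⟪ ωₒ , x′ ⌟ τₒ ⟫)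
      ≈⟨ +-cong (sumSubsets-neg {m} _) (trans (sumSubsets-+ {m} _ _) (+-congʳ (sumSubsets-* {m} x₀ _))) ⟨
    sumSubsets (λ T → - (ωᵢ T * (x′ ⌟ τᵢ) T)) + sumSubsets (λ T → x₀ * (ωₒ T * τᵢ T) + ωₒ T * (x′ ⌟ τₒ) T)
      ≈⟨ +-cong (sumSubsets-cong {m} λ T → -‿distribʳ-* _ _)
           (sumSubsets-cong {m} λ T → solve 4 (λ x a b c → x :* (a :* b) :+ a :* c := a :* (x :* b :+ c)) refl x₀ (ωₒ T) _ _) ⟩
    sumSubsets (λ T → ωᵢ T * - (x′ ⌟ τᵢ) T) + sumSubsets (λ T → ωₒ T * (x₀ * τᵢ T + (x′ ⌟ τₒ) T)) ∎
    where
    x₀ = x zero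
    x′ = x ∘ suc
    ωᵢ = ω ∘ (inside ∷_)
    ωₒ = ω ∘ (outside ∷_)
    τᵢ = τ ∘ (inside ∷_)
    τₒ = τ ∘ (outside ∷_)

  -- The basic rule of the calculus. The norm of a contraction, its dependence on products alone,
  -- the nonvanishing of wedges and the expansion into minors all rest on it.
  ⌟-antiderivation : (y x : Vector ℝ m) (ω : Form m) → ∀ T → (y ⌟ x ∧ ω) T ≈ y ∙ x * ω T - (x ∧ y ⌟ ω) T
  ⌟-antiderivation y x ω [] = solve 1 (λ w → con (+ 0) := con (+ 0) :* w :- con (+ 0)) refl (ω [])
  ⌟-antiderivation y x ω (inside ∷ T) = begin-equality
    - (y′ ⌟ (λ U → x₀ * ωₒ U - (x′ ∧ ωᵢ) U)) T
      ≈⟨ -‿cong (trans (⌟ʳ.additive y′ _ _ T) (+-cong (⌟ʳ.homogeneous y′ x₀ ωₒ T) (trans (⌟ʳ.negate y′ _ T) (-‿cong (⌟-antiderivation y′ x′ ωᵢ T))))) ⟩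
    - (x₀ * (y′ ⌟ ωₒ) T - (y′ ∙ x′ * ωᵢ T - (x′ ∧ y′ ⌟ ωᵢ) T))
      ≈⟨ solve 6 (λ y₀ x₀ s w a b → :- (x₀ :* a :- (s :* w :- b))
           := (y₀ :* x₀ :+ s) :* w :- (x₀ :* (y₀ :* w :+ a) :- :- b)) refl y₀ x₀ (y′ ∙ x′) (ωᵢ T) _ _ ⟩
    (y₀ * x₀ + y′ ∙ x′) * ωᵢ T - (x₀ * (y₀ * ωᵢ T + (y′ ⌟ ωₒ) T) - - (x′ ∧ y′ ⌟ ωᵢ) T)
      ≈⟨ +-congˡ (-‿cong (+-congˡ (-‿cong (∧ʳ.negate x′ _ T)))) ⟨
    (y₀ * x₀ + y′ ∙ x′) * ωᵢ T - (x₀ * (y₀ * ωᵢ T + (y′ ⌟ ωₒ) T) - (x′ ∧ (λ U → - (y′ ⌟ ωᵢ) U)) T) ∎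
    where
    y₀ = y zero
    y′ = y ∘ suc
    x₀ = x zero
    x′ = x ∘ suc
    ωᵢ = ω ∘ (inside ∷_)
    ωₒ = ω ∘ (outside ∷_)
  ⌟-antiderivation y x ω (outside ∷ T) = begin-equality
    y₀ * (x₀ * ωₒ T - (x′ ∧ ωᵢ) T) + (y′ ⌟ x′ ∧ ωₒ) T
      ≈⟨ +-congˡ (⌟-antiderivation y′ x′ ωₒ T) ⟩
    y₀ * (x₀ * ωₒ T - (x′ ∧ ωᵢ) T) + (y′ ∙ x′ * ωₒ T - (x′ ∧ y′ ⌟ ωₒ) T)
      ≈⟨ solve 6 (λ y₀ x₀ s w a b → y₀ :* (x₀ :* w :- a) :+ (s :* w :- b)
           := (y₀ :* x₀ :+ s) :* w :- (y₀ :* a :+ b)) refl y₀ x₀ (y′ ∙ x′) (ωₒ T) _ _ ⟩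
    (y₀ * x₀ + y′ ∙ x′) * ωₒ T - (y₀ * (x′ ∧ ωᵢ) T + (x′ ∧ y′ ⌟ ωₒ) T)
      ≈⟨ +-congˡ (-‿cong (trans (∧ʳ.additive x′ _ _ T) (+-congʳ (∧ʳ.homogeneous x′ y₀ ωᵢ T)))) ⟨
    (y₀ * x₀ + y′ ∙ x′) * ωₒ T - (x′ ∧ (λ U → y₀ * ωᵢ U + (y′ ⌟ ωₒ) U)) T ∎
    where
    y₀ = y zero
    y′ = y ∘ suc
    x₀ = x zero
    x′ = x ∘ suc
    ωᵢ = ω ∘ (inside ∷_)
    ωₒ = ω ∘ (outside ∷_)

  ∧-anticomm : (x y : Vector ℝ m) (ω : Form m) → ∀ T → (x ∧ y ∧ ω) T ≈ - (y ∧ x ∧ ω) T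
  ∧-anticomm x y ω []            = sym -0#≈0#
  ∧-anticomm x y ω (outside ∷ T) = ∧-anticomm (x ∘ suc) (y ∘ suc) (ω ∘ (outside ∷_)) T
  ∧-anticomm {suc m} x y ω (inside ∷ T) = begin-equality
    (x ∧ y ∧ ω) (inside ∷ T)
      ≈⟨ expand x y ⟩
    x₀ * (y′ ∧ ωₒ) T - (y₀ * (x′ ∧ ωₒ) T - (x′ ∧ y′ ∧ ωᵢ) T)
      ≈⟨ +-congˡ (-‿cong (+-congˡ (-‿cong (∧-anticomm x′ y′ ωᵢ T)))) ⟩
    x₀ * (y′ ∧ ωₒ) T - (y₀ * (x′ ∧ ωₒ) T - - (y′ ∧ x′ ∧ ωᵢ) T)
      ≈⟨ solve 5 (λ x₀ a y₀ b c → x₀ :* a :- (y₀ :* b :- :- c) := :- (y₀ :* b :- (x₀ :* a :- c))) refl x₀ _ y₀ _ _ ⟩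
    - (y₀ * (x′ ∧ ωₒ) T - (x₀ * (y′ ∧ ωₒ) T - (y′ ∧ x′ ∧ ωᵢ) T))
      ≈⟨ -‿cong (expand y x) ⟨
    - (y ∧ x ∧ ω) (inside ∷ T) ∎
    where
    y₀ = y zero
    y′ = y ∘ suc
    x₀ = x zero
    x′ = x ∘ suc
    ωᵢ = ω ∘ (inside ∷_)
    ωₒ = ω ∘ (outside ∷_)
    expand : (x y : Vector ℝ (suc m)) → (x ∧ y ∧ ω) (inside ∷ T) ≈
      x zero * (y ∘ suc ∧ ωₒ) T - (y zero * (x ∘ suc ∧ ωₒ) T - (x ∘ suc ∧ y ∘ suc ∧ ωᵢ) T)
    expand x y = +-congˡ (-‿cong (trans (∧ʳ.additive (x ∘ suc) _ _ T)
      (+-cong (∧ʳ.homogeneous (x ∘ suc) (y zero) ωₒ T) (∧ʳ.negate (x ∘ suc) _ T))))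

  -- A consequence of the order; it turns anticommutativity into the vanishing of `x ∧ x ∧ ω`.
  x≈-x⇒x≈0 : ∀ {x} → x ≈ - x → x ≈ 0#
  x≈-x⇒x≈0 {x} x≈-x with total x 0#
  ... | inj₁ x≤0 = antisym x≤0 (≤-trans (≤-trans (≤-reflexive (sym -0#≈0#)) (neg-mono-≤ x≤0)) (≤-reflexive (sym x≈-x)))
  ... | inj₂ 0≤x = antisym (≤-trans (≤-reflexive x≈-x) (≤-trans (neg-mono-≤ 0≤x) (≤-reflexive -0#≈0#))) 0≤x

  -- Degrees and wedge products of rows.

  unit : Form m
  unit []            = 1#
  unit (inside  ∷ T) = 0#
  unit (outside ∷ T) = unit T

  unit-empty : ∀ m → unit (empty {m}) ≈ 1#
  unit-empty zero    = refl
  unit-empty (suc m) = unit-empty m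

  unit-degree : (T : Subset m) → ∣ T ∣ ≢ 0 → unit T ≈ 0#
  unit-degree []            ∣T∣≢0 = contradiction ≡.refl ∣T∣≢0
  unit-degree (inside  ∷ T) ∣T∣≢0 = refl
  unit-degree (outside ∷ T) ∣T∣≢0 = unit-degree T ∣T∣≢0

  -- The coefficient at `T` reads `ω` only at sets with one element fewer. Phrasing this through
  -- vanishing allows forms of mixed degree.
  ∧-degree : (x : Vector ℝ m) (ω : Form m) (T : Subset m) →
    (∀ U → suc ∣ U ∣ ≡ ∣ T ∣ → ω U ≈ 0#) → (x ∧ ω) T ≈ 0#
  ∧-degree x ω []            ω≈0 = refl
  ∧-degree x ω (inside  ∷ T) ω≈0 = begin-equality
    x zero * ω (outside ∷ T) - (x ∘ suc ∧ ω ∘ (inside ∷_)) T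
      ≈⟨ +-cong (*-congˡ (ω≈0 (outside ∷ T) ≡.refl))
           (-‿cong (∧-degree (x ∘ suc) (ω ∘ (inside ∷_)) T λ U eq → ω≈0 (inside ∷ U) (≡.cong suc eq))) ⟩
    x zero * 0# - 0#
      ≈⟨ solve 1 (λ x → x :* con (+ 0) :- con (+ 0) := con (+ 0)) refl (x zero) ⟩
    0# ∎
  ∧-degree x ω (outside ∷ T) ω≈0 = ∧-degree (x ∘ suc) (ω ∘ (outside ∷_)) T λ U → ω≈0 (outside ∷ U)

  ⌟-degree : (y : Vector ℝ m) (ω : Form m) (T : Subset m) →
    (∀ U → ∣ U ∣ ≡ suc ∣ T ∣ → ω U ≈ 0#) → (y ⌟ ω) T ≈ 0#
  ⌟-degree y ω []            ω≈0 = refl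
  ⌟-degree y ω (inside  ∷ T) ω≈0 = trans
    (-‿cong (⌟-degree (y ∘ suc) (ω ∘ (inside ∷_)) T λ U eq → ω≈0 (inside ∷ U) (≡.cong suc eq))) -0#≈0#
  ⌟-degree y ω (outside ∷ T) ω≈0 = trans
    (+-cong (trans (*-congˡ (ω≈0 (inside ∷ T) ≡.refl)) (zeroʳ _))
            (⌟-degree (y ∘ suc) (ω ∘ (outside ∷_)) T λ U → ω≈0 (outside ∷ U)))
    (+-identityʳ 0#)

  ⌟-unit : (y : Vector ℝ m) (T : Subset m) → (y ⌟ unit) T ≈ 0#
  ⌟-unit y T = ⌟-degree y unit T λ U ∣U∣≡ → unit-degree U λ ∣U∣≡0 → ℕ.0≢1+n (≡.trans (≡.sym ∣U∣≡0) ∣U∣≡)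

  wedge : Matrix n m → Form m
  wedge {zero}  X = unit
  wedge {suc n} X = X zero ∧ wedge (X ∘ suc)

  wedge-degree : (X : Matrix n m) (T : Subset m) → ∣ T ∣ ≢ n → wedge X T ≈ 0#
  wedge-degree {zero}  X T ∣T∣≢0 = unit-degree T ∣T∣≢0
  wedge-degree {suc n} X T ∣T∣≢n = ∧-degree (X zero) (wedge (X ∘ suc)) T λ U ∣U∣≡ →
    wedge-degree (X ∘ suc) U λ ∣U∣≡n → ∣T∣≢n (≡.trans (≡.sym ∣U∣≡) (≡.cong suc ∣U∣≡n))

  row-∧-wedge : (X : Matrix n m) (i : Fin n) → ∀ T → (X i ∧ wedge X) T ≈ 0#
  row-∧-wedge X zero    T = x≈-x⇒x≈0 (∧-anticomm (X zero) (X zero) (wedge (X ∘ suc)) T)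
  row-∧-wedge X (suc i) T = begin-equality
    (X (suc i) ∧ X zero ∧ wedge (X ∘ suc)) T      ≈⟨ ∧-anticomm (X (suc i)) (X zero) (wedge (X ∘ suc)) T ⟩
    - (X zero ∧ X (suc i) ∧ wedge (X ∘ suc)) T    ≈⟨ -‿cong (∧ʳ.null (X zero) (row-∧-wedge (X ∘ suc) i) T) ⟩
    - 0#                                          ≈⟨ -0#≈0# ⟩
    0#                                            ∎

  span-∧-wedge : {X : Matrix n m} {y : Vector ℝ m} → InSpan X y → ∀ T → (y ∧ wedge X) T ≈ 0#
  span-∧-wedge {n} {X = X} (u , y≈uX) T = trans (∧ˡ.respects (wedge X) y≈uX T)
    (trans (∧ˡ.respects-sum (wedge X) u X T) (sum-zero {n} λ i → trans (*-congˡ (row-∧-wedge X i T)) (zeroʳ _)))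

  -- Contracting y ∧ w = 0 with y gives y ∧ (y ⌟ w) = ∣y∣² w. Pairing with w and moving the outer
  -- wedge across the pairing yields the norm.
  ⌟-wedge-norm : {X : Matrix n m} {y : Vector ℝ m} → InSpan X y →
    ⟪ y ⌟ wedge X , y ⌟ wedge X ⟫ ≈ ∣ y ∣² * ⟪ wedge X , wedge X ⟫
  ⌟-wedge-norm {m = m} {X = X} {y} y∈X = begin-equality
    ⟪ y ⌟ w , y ⌟ w ⟫
      ≈⟨ ∧-⌟-adjoint y (y ⌟ w) w ⟨
    ⟪ y ∧ y ⌟ w , w ⟫
      ≈⟨ sumSubsets-cong {m} (λ T → solve 3 (λ s w a → a :* w := s :* (w :* w) :+ :- (w :* (s :* w :- a))) refl ∣ y ∣² (w T) ((y ∧ y ⌟ w) T)) ⟩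
    sumSubsets (λ T → ∣ y ∣² * (w T * w T) + - (w T * (∣ y ∣² * w T - (y ∧ y ⌟ w) T)))
      ≈⟨ trans (sumSubsets-+ {m} _ _) (+-cong (sumSubsets-* {m} ∣ y ∣² _) (sumSubsets-zero {m} λ T → trans
           (-‿cong (trans (*-congˡ (trans (sym (⌟-antiderivation y y w T)) (⌟ʳ.null y (span-∧-wedge y∈X) T))) (zeroʳ _))) -0#≈0#)) ⟩
    ∣ y ∣² * ⟪ w , w ⟫ + 0#
      ≈⟨ +-identityʳ _ ⟩
    ∣ y ∣² * ⟪ w , w ⟫ ∎
    where w = wedge X

  ⌟-wedge-cong : (X : Matrix n m) {y z : Vector ℝ m} → (∀ i → y ∙ X i ≈ z ∙ X i) → ∀ T → (y ⌟ wedge X) T ≈ (z ⌟ wedge X) T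
  ⌟-wedge-cong {zero}  X {y} {z} y≈z T = trans (⌟-unit y T) (sym (⌟-unit z T))
  ⌟-wedge-cong {suc n} X {y} {z} y≈z T = begin-equality
    (y ⌟ X zero ∧ w) T                          ≈⟨ ⌟-antiderivation y (X zero) w T ⟩
    y ∙ X zero * w T - (X zero ∧ y ⌟ w) T       ≈⟨ +-cong (*-congʳ (y≈z zero)) (-‿cong (∧ʳ.respects (X zero) (⌟-wedge-cong (X ∘ suc) (y≈z ∘ suc)) T)) ⟩
    z ∙ X zero * w T - (X zero ∧ z ⌟ w) T       ≈⟨ ⌟-antiderivation z (X zero) w T ⟨
    (z ⌟ X zero ∧ w) T                          ∎
    where w = wedge (X ∘ suc)

  ⌟-wedge-⊥ : (X : Matrix n m) {y : Vector ℝ m} → (∀ i → y ∙ X i ≈ 0#) → ∀ T → (y ⌟ wedge X) T ≈ 0#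
  ⌟-wedge-⊥ {zero}  X {y} y⊥X T = ⌟-unit y T
  ⌟-wedge-⊥ {suc n} X {y} y⊥X T = begin-equality
    (y ⌟ X zero ∧ w) T                          ≈⟨ ⌟-antiderivation y (X zero) w T ⟩
    y ∙ X zero * w T - (X zero ∧ y ⌟ w) T       ≈⟨ +-cong (*-congʳ (y⊥X zero)) (-‿cong (∧ʳ.null (X zero) (⌟-wedge-⊥ (X ∘ suc) (y⊥X ∘ suc)) T)) ⟩
    0# * w T - 0#                               ≈⟨ solve 1 (λ w → con (+ 0) :* w :- con (+ 0) := con (+ 0)) refl (w T) ⟩
    0#                                          ∎
    where w = wedge (X ∘ suc)

  -- `Y zero` is orthogonal to all rows but the first, so contraction with it strips exactly that
  -- row from the wedge. A vanishing wedge would thus descend to `unit`.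
  paired⇒wedge≉0 : (X Y : Matrix n m) → (∀ i j → Y i ∙ X j ≈ 𝟏 i j) → ¬ (∀ T → wedge X T ≈ 0#)
  paired⇒wedge≉0 {zero}  {m} X Y paired w≈0 = 0≉1 (trans (sym (w≈0 empty)) (unit-empty m))
  paired⇒wedge≉0 {suc n} X Y paired w≈0 =
    paired⇒wedge≉0 (X ∘ suc) (Y ∘ suc) (λ i j → paired (suc i) (suc j)) λ T → begin-equality
      w T
        ≈⟨ solve 1 (λ w → w := con (+ 1) :* w :- con (+ 0)) refl (w T) ⟩
      1# * w T - 0#
        ≈⟨ +-cong (*-congʳ (paired zero zero)) (-‿cong (∧ʳ.null (X zero) (⌟-wedge-⊥ (X ∘ suc) (λ j → paired zero (suc j))) T)) ⟨
      Y zero ∙ X zero * w T - (X zero ∧ Y zero ⌟ w) T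
        ≈⟨ ⌟-antiderivation (Y zero) (X zero) w T ⟨
      (Y zero ⌟ X zero ∧ w) T
        ≈⟨ ⌟ʳ.null (Y zero) w≈0 T ⟩
      0# ∎
    where w = wedge (X ∘ suc)

  -- In a relation, `v zero * X zero` lies in the span of the other rows, so its wedge with theirs
  -- vanishes; evaluation at `T` forces `v zero ≈ 0#`. The wedge of the other rows is again nonzero
  -- somewhere, and the induction continues.
  wedge≉0⇒independent : (X : Matrix n m) → ∃ (λ T → ¬ wedge X T ≈ 0#) → IndependentColumns (X ᵀ)
  wedge≉0⇒independent {suc n} X (T , w≉0) v Xv≈0 = λ where
      zero    → v₀≈0
      (suc i) → wedge≉0⇒independent X′ nonzero v′ (λ j → begin-equality
        (λ i → X′ i j) ∙ v′                     ≈⟨ +-identityˡ _ ⟨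
        0# + (λ i → X′ i j) ∙ v′                ≈⟨ +-congʳ (trans (*-congˡ v₀≈0) (zeroʳ _)) ⟨
        X zero j * v zero + (λ i → X′ i j) ∙ v′ ≈⟨ Xv≈0 j ⟩
        0#                                      ∎) i
    where
    X′ = X ∘ suc
    v′ = v ∘ suc
    w′ = wedge X′
    v₀X₀ : ∀ j → v zero * X zero j ≈ - (v′ ⊙ X′) j
    v₀X₀ j = begin-equality
      v zero * X zero j
        ≈⟨ solve 3 (λ v x s → v :* x := (x :* v :+ s) :- s) refl (v zero) (X zero j) _ ⟩
      (X zero j * v zero + (λ i → X′ i j) ∙ v′) - (λ i → X′ i j) ∙ v′
        ≈⟨ +-cong (Xv≈0 j) (-‿cong (∙-comm (λ i → X′ i j) v′)) ⟩
      0# - (v′ ⊙ X′) j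
        ≈⟨ +-identityˡ _ ⟩
      - (v′ ⊙ X′) j ∎
    v₀≈0 : v zero ≈ 0#
    v₀≈0 = xy≈0⇒y≈0 w≉0 (begin-equality
      wedge X T * v zero                     ≈⟨ *-comm _ _ ⟩
      v zero * (X zero ∧ w′) T               ≈⟨ ∧ˡ.homogeneous w′ (v zero) (X zero) T ⟨
      ((λ j → v zero * X zero j) ∧ w′) T     ≈⟨ ∧ˡ.respects w′ v₀X₀ T ⟩
      ((λ j → - (v′ ⊙ X′) j) ∧ w′) T         ≈⟨ ∧ˡ.negate w′ (v′ ⊙ X′) T ⟩
      - (v′ ⊙ X′ ∧ w′) T                     ≈⟨ -‿cong (span-∧-wedge {X = X′} (v′ , λ _ → refl) T) ⟩
      - 0#                                   ≈⟨ -0#≈0# ⟩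
      0#                                     ∎)
    nonzero : ∃ λ U → ¬ w′ U ≈ 0#
    nonzero with em {∃ λ U → ¬ w′ U ≈ 0#}
    ... | yes h = h
    ... | no none = contradiction (∧ʳ.null (X zero) (λ U → vanishes U em) T) w≉0
      where
      vanishes : ∀ U → Dec (w′ U ≈ 0#) → w′ U ≈ 0#
      vanishes U (yes w≈0) = w≈0
      vanishes U (no w≉0)  = contradiction (U , w≉0) none

  -- Volumes of column subsets

  ⟪unit,unit⟫ : ∀ m → ⟪ unit {m} , unit {m} ⟫ ≈ 1#
  ⟪unit,unit⟫ zero    = *-identityˡ 1#
  ⟪unit,unit⟫ (suc m) = trans (+-cong (sumSubsets-zero {m} λ T → zeroˡ 0#) (⟪unit,unit⟫ m)) (+-identityˡ 1#)

  sign : Fin n → ℝ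
  sign j = (- 1#) ^ toℕ j

  -- Iterating the antiderivation rule creates the same signs and the same omitted indices as the
  -- recursion defining `det`.
  ⌟-wedge-expansion : (y : Vector ℝ m) (B : Matrix (suc n) m) → ∀ T →
    (y ⌟ wedge B) T ≈ ∑[ j < suc n ] (sign j * y ∙ B j * wedge (λ k → B (punchIn j k)) T)
  ⌟-wedge-expansion {n = n} y B T = trans (⌟-antiderivation y (B zero) (wedge B′) T)
    (+-cong (solve 2 (λ s w → s :* w := con (+ 1) :* s :* w) refl (y ∙ B zero) (wedge B′ T)) (remaining n B))
    where
    B′ = B ∘ suc
    remaining : ∀ n (B : Matrix (suc n) _) → - (B zero ∧ y ⌟ wedge (B ∘ suc)) T ≈
      ∑[ j < n ] (sign (suc j) * y ∙ B (suc j) * wedge (λ k → B (punchIn (suc j) k)) T)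
    remaining zero    B = trans (-‿cong (∧ʳ.null (B zero) (⌟-unit y) T)) -0#≈0#
    remaining (suc n) B = begin-equality
      - (B zero ∧ y ⌟ wedge (B ∘ suc)) T
        ≈⟨ -‿cong (∧ʳ.respects (B zero) (⌟-wedge-expansion y (B ∘ suc)) T) ⟩
      - (B zero ∧ (λ U → ∑[ j < suc n ] (c j * minor j U))) T
        ≈⟨ -‿cong (∧ʳ.respects-sum (B zero) c minor T) ⟩
      - ∑[ j < suc n ] (c j * (B zero ∧ minor j) T)
        ≈⟨ solve 1 (λ x → :- x := :- con (+ 1) :* x) refl (∑[ j < suc n ] (c j * (B zero ∧ minor j) T)) ⟩
      - 1# * ∑[ j < suc n ] (c j * (B zero ∧ minor j) T)
        ≈⟨ *-distribˡ-sum {suc n} (- 1#) (λ j → c j * (B zero ∧ minor j) T) ⟩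
      ∑[ j < suc n ] (- 1# * (c j * (B zero ∧ minor j) T))
        ≈⟨ sum-cong-≋ {suc n} (λ j → solve 4 (λ a s d w → a :* (s :* d :* w) := a :* s :* d :* w) refl (- 1#) (sign j) (y ∙ B (suc j)) ((B zero ∧ minor j) T)) ⟩
      ∑[ j < suc n ] (- 1# * sign j * y ∙ B (suc j) * (B zero ∧ minor j) T) ∎
      where
      c = λ (j : Fin (suc n)) → sign j * y ∙ B (suc j)
      minor = λ j → wedge λ k → B (suc (punchIn j k))

  -- The Cauchy-Binet formula. The first row of the Gram matrix consists of the products of `A zero`
  -- with the rows of `B`, so expanding along it contracts `wedge B` with `A zero`; adjointness
  -- turns this into a wedge on the other side.
  det-gram : (A B : Matrix n m) → det (λ i j → A i ∙ B j) ≈ ⟪ wedge A , wedge B ⟫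
  det-gram {zero}  {m} A B = sym (⟪unit,unit⟫ m)
  det-gram {suc n} {m} A B = begin-equality
    ∑[ j < suc n ] (c j * det (λ i k → A (suc i) ∙ B (punchIn j k)))
      ≈⟨ sum-cong-≋ {suc n} (λ j → *-congˡ {c j} (trans (det-gram (A ∘ suc) (λ k → B (punchIn j k))) (⟪⟫-comm wA (minor j)))) ⟩
    ∑[ j < suc n ] (c j * ⟪ minor j , wA ⟫)
      ≈⟨ pair-combine ⟨
    ⟪ (λ T → ∑[ j < suc n ] (c j * minor j T)) , wA ⟫
      ≈⟨ ⟪⟫-comm _ wA ⟩
    ⟪ wA , (λ T → ∑[ j < suc n ] (c j * minor j T)) ⟫
      ≈⟨ ⟪⟫-congʳ wA (⌟-wedge-expansion (A zero) B) ⟨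
    ⟪ wA , A zero ⌟ wedge B ⟫
      ≈⟨ ∧-⌟-adjoint (A zero) wA (wedge B) ⟨
    ⟪ A zero ∧ wA , wedge B ⟫ ∎
    where
    wA = wedge (A ∘ suc)
    c = λ j → sign j * A zero ∙ B j
    minor = λ j → wedge λ k → B (punchIn j k)
    pair-linear : (τ : Form m) → Linear {J = Fin 1} λ ω _ → ⟪ ω , τ ⟫
    pair-linear τ = record
      { respects    = λ ω≈σ _ → sumSubsets-cong {m} λ T → *-congʳ (ω≈σ T)
      ; additive    = λ ω σ _ → trans (sumSubsets-cong {m} λ T → distribʳ (τ T) (ω T) (σ T)) (sumSubsets-+ {m} _ _)
      ; homogeneous = λ a ω _ → trans (sumSubsets-cong {m} λ T → *-assoc a (ω T) (τ T)) (sumSubsets-* {m} a _)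
      }
    pair-combine : ⟪ (λ T → ∑[ j < suc n ] (c j * minor j T)) , wA ⟫ ≈ ∑[ j < suc n ] (c j * ⟪ minor j , wA ⟫)
    pair-combine = Linear.respects-sum (pair-linear wA) c minor zero

  embed : (T : Subset m) → Subset ∣ T ∣ → Subset m
  embed []            U       = []
  embed (inside  ∷ T) (b ∷ U) = b ∷ embed T U
  embed (outside ∷ T) U       = outside ∷ embed T U

  embed-full : (T : Subset m) → embed T full ≡ T
  embed-full []            = ≡.refl
  embed-full (inside  ∷ T) = ≡.cong (inside ∷_) (embed-full T)
  embed-full (outside ∷ T) = ≡.cong (outside ∷_) (embed-full T)

  -- At a subset of `T`, a wedge reads its form only at subsets of `T` and its vector only at
  -- elements of `T`, so restriction to the columns in `T` commutes with wedging.
  ∧-embed : (T : Subset m) (x : Vector ℝ m) (ω : Form m) → ∀ U → (x ∧ ω) (embed T U) ≈ (x ∘ element T ∧ ω ∘ embed T) U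
  ∧-embed []            x ω []            = refl
  ∧-embed (inside  ∷ T) x ω (inside  ∷ U) = +-congˡ (-‿cong (∧-embed T (x ∘ suc) (ω ∘ (inside ∷_)) U))
  ∧-embed (inside  ∷ T) x ω (outside ∷ U) = ∧-embed T (x ∘ suc) (ω ∘ (outside ∷_)) U
  ∧-embed (outside ∷ T) x ω U             = ∧-embed T (x ∘ suc) (ω ∘ (outside ∷_)) U

  unit-embed : (T : Subset m) → ∀ U → unit (embed T U) ≈ unit U
  unit-embed []            []            = refl
  unit-embed (inside  ∷ T) (inside  ∷ U) = refl
  unit-embed (inside  ∷ T) (outside ∷ U) = unit-embed T U
  unit-embed (outside ∷ T) U             = unit-embed T U

  wedge-columns : (X : Matrix n m) (T : Subset m) → ∀ U → wedge (columns X T) U ≈ wedge X (embed T U)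
  wedge-columns {zero}  X T U = sym (unit-embed T U)
  wedge-columns {suc n} X T U = trans
    (∧ʳ.respects (X zero ∘ element T) (wedge-columns (X ∘ suc) T) U)
    (sym (∧-embed T (X zero) (wedge (X ∘ suc)) U))

  wedge-columns-full : (X : Matrix n m) (T : Subset m) → wedge (columns X T) full ≈ wedge X T
  wedge-columns-full X T = trans (wedge-columns X T full) (reflexive (≡.cong (wedge X) (embed-full T)))

  sumSubsets-full : {f : Form m} → (∀ U → ∣ U ∣ ≢ m → f U ≈ 0#) → sumSubsets f ≈ f full
  sumSubsets-full {zero}      f≈0 = refl
  sumSubsets-full {suc m} {f} f≈0 = trans
    (+-cong (sumSubsets-full (λ U ∣U∣≢m → f≈0 (inside ∷ U) (∣U∣≢m ∘ ℕ.suc-injective)))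
            (sumSubsets-zero {m} λ U → f≈0 (outside ∷ U) (ℕ.<⇒≢ (ℕ.s≤s (∣p∣≤n U)))))
    (+-identityʳ _)

  if-does : {P : Set} (P? : Dec P) {x y z : ℝ} → (P → x ≈ z) → (¬ P → y ≈ z) → (if does P? then x else y) ≈ z
  if-does (yes p) x≈z y≈z = x≈z p
  if-does (no ¬p) x≈z y≈z = y≈z ¬p

  -- When `T` has `n` elements the wedge of the selected columns has top degree, so the Cauchy-Binet
  -- sum reduces to its term at `full`. For other sizes both sides vanish.
  volume-wedge : (X : Matrix n m) (T : Subset m) → volume X T ≈ wedge X T * wedge X T
  volume-wedge {n} X T = if-does (∣ T ∣ ℕ.≟ n)
    (λ ∣T∣≡n → begin-equality
      det (λ i j → columns X T i ∙ columns X T j)   ≈⟨ det-gram (columns X T) (columns X T) ⟩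
      ⟪ w , w ⟫                                     ≈⟨ sumSubsets-full (λ U ∣U∣≢ → trans (*-congʳ (wedge-degree (columns X T) U
                                                         λ ∣U∣≡n → ∣U∣≢ (≡.trans ∣U∣≡n (≡.sym ∣T∣≡n)))) (zeroˡ _)) ⟩
      w full * w full                               ≈⟨ *-cong (wedge-columns-full X T) (wedge-columns-full X T) ⟩
      wedge X T * wedge X T                         ∎)
    (λ ∣T∣≢n → sym (trans (*-congʳ (wedge-degree X T ∣T∣≢n)) (zeroˡ _)))
    where w = wedge (columns X T)

  -- The expected squared norm of the inverse

  -- The sum of f (T \ {j}) over the elements j of T.
  deletions : Form m → Form m
  deletions f []            = 0#
  deletions f (inside  ∷ T) = f (outside ∷ T) + deletions (f ∘ (inside ∷_)) T
  deletions f (outside ∷ T) = deletions (f ∘ (outside ∷_)) T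

  deletions-cong : {f g : Form m} → (∀ U → f U ≈ g U) → ∀ T → deletions f T ≈ deletions g T
  deletions-cong f≈g []            = refl
  deletions-cong f≈g (inside  ∷ T) = +-cong (f≈g _) (deletions-cong (f≈g ∘ (inside ∷_)) T)
  deletions-cong f≈g (outside ∷ T) = deletions-cong (f≈g ∘ (outside ∷_)) T

  deletions-nonNeg : {f : Form m} → (∀ U → 0# ≤ f U) → ∀ T → 0# ≤ deletions f T
  deletions-nonNeg 0≤f []            = ≤-refl
  deletions-nonNeg 0≤f (inside  ∷ T) = +-nonNeg (0≤f _) (deletions-nonNeg (0≤f ∘ (inside ∷_)) T)
  deletions-nonNeg 0≤f (outside ∷ T) = deletions-nonNeg (0≤f ∘ (outside ∷_)) T

  -- A set U arises by deleting an element from exactly m - |U| sets.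
  sumSubsets-deletions : (f : Form m) → sumSubsets (deletions f) ≈ sumSubsets λ U → fromℕ (m ℕ.∸ ∣ U ∣) * f U
  sumSubsets-deletions {zero}  f = sym (zeroˡ _)
  sumSubsets-deletions {suc m} f = begin-equality
    sumSubsets (λ T → fₒ T + deletions fᵢ T) + sumSubsets (deletions fₒ)
      ≈⟨ +-cong (sumSubsets-+ {m} _ _) (sumSubsets-deletions fₒ) ⟩
    (sumSubsets fₒ + sumSubsets (deletions fᵢ)) + sumSubsets (λ U → fromℕ (m ℕ.∸ ∣ U ∣) * fₒ U)
      ≈⟨ solve 3 (λ a b c → (a :+ b) :+ c := b :+ (a :+ c)) refl _ _ _ ⟩
    sumSubsets (deletions fᵢ) + (sumSubsets fₒ + sumSubsets (λ U → fromℕ (m ℕ.∸ ∣ U ∣) * fₒ U))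
      ≈⟨ +-cong (sumSubsets-deletions fᵢ) (sym (sumSubsets-+ {m} _ _)) ⟩
    sumSubsets (λ U → fromℕ (m ℕ.∸ ∣ U ∣) * fᵢ U) + sumSubsets (λ U → fₒ U + fromℕ (m ℕ.∸ ∣ U ∣) * fₒ U)
      ≈⟨ +-congˡ (sumSubsets-cong {m} λ U → trans
           (solve 2 (λ x k → x :+ k :* x := (con (+ 1) :+ k) :* x) refl (fₒ U) (fromℕ (m ℕ.∸ ∣ U ∣)))
           (*-congʳ (reflexive (≡.cong fromℕ (≡.sym (ℕ.+-∸-assoc 1 (∣p∣≤n U))))))) ⟩
    sumSubsets (λ U → fromℕ (m ℕ.∸ ∣ U ∣) * fᵢ U) + sumSubsets (λ U → fromℕ (suc m ℕ.∸ ∣ U ∣) * fₒ U) ∎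
    where
    fᵢ = f ∘ (inside ∷_)
    fₒ = f ∘ (outside ∷_)

  extend : (T : Subset m) → Vector ℝ ∣ T ∣ → Vector ℝ m
  extend (inside  ∷ T) b zero    = b zero
  extend (inside  ∷ T) b (suc j) = extend T (b ∘ suc) j
  extend (outside ∷ T) b zero    = 0#
  extend (outside ∷ T) b (suc j) = extend T b j

  extend-∙ : (T : Subset m) (b : Vector ℝ ∣ T ∣) (x : Vector ℝ m) → extend T b ∙ x ≈ b ∙ (x ∘ element T)
  extend-∙ []            b x = refl
  extend-∙ (inside  ∷ T) b x = +-congˡ (extend-∙ T (b ∘ suc) (x ∘ suc))
  extend-∙ (outside ∷ T) b x = trans (+-cong (zeroˡ _) (extend-∙ T b (x ∘ suc))) (+-identityˡ _)

  -- The coefficient of a contraction at `T` involves only components of the vector outside `T`, and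
  -- those are zero here.
  extend-⌟ : (T : Subset m) (b : Vector ℝ ∣ T ∣) (ω : Form m) → (extend T b ⌟ ω) T ≈ 0#
  extend-⌟ []            b ω = refl
  extend-⌟ (inside  ∷ T) b ω = trans (-‿cong (extend-⌟ T (b ∘ suc) (ω ∘ (inside ∷_)))) -0#≈0#
  extend-⌟ (outside ∷ T) b ω = trans (+-cong (zeroˡ _) (extend-⌟ T b (ω ∘ (outside ∷_)))) (+-identityˡ 0#)

  infix 9 _²

  _² : Form m → Form m
  (ω ²) T = ω T * ω T

  -- At `T` without its j-th element, only the j-th component of `b` can restore a set on which the
  -- vector is supported: the coefficient is `b j * ω T` up to a sign, which squaring removes.
  deletions-extend : (T : Subset m) (b : Vector ℝ ∣ T ∣) (ω : Form m) →
    deletions ((extend T b ⌟ ω) ²) T ≈ ∣ b ∣² * (ω ²) T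
  deletions-extend []            b ω = sym (zeroˡ _)
  deletions-extend (inside  ∷ T) b ω = begin-equality
    ((extend (inside ∷ T) b ⌟ ω) ²) (outside ∷ T) + deletions (λ U → - (e ⌟ ωᵢ) U * - (e ⌟ ωᵢ) U) T
      ≈⟨ +-cong (*-cong coefficient₀ coefficient₀)
           (trans (deletions-cong (λ U → solve 1 (λ x → :- x :* :- x := x :* x) refl ((e ⌟ ωᵢ) U)) T)
                  (deletions-extend T (b ∘ suc) ωᵢ)) ⟩
    b zero * ωᵢ T * (b zero * ωᵢ T) + ∣ b ∘ suc ∣² * (ωᵢ T * ωᵢ T)
      ≈⟨ solve 3 (λ b w s → b :* w :* (b :* w) :+ s :* (w :* w) := (b :* b :+ s) :* (w :* w)) refl (b zero) (ωᵢ T) _ ⟩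
    (b zero * b zero + ∣ b ∘ suc ∣²) * (ωᵢ T * ωᵢ T) ∎
    where
    e = extend T (b ∘ suc)
    ωᵢ = ω ∘ (inside ∷_)
    coefficient₀ : (extend (inside ∷ T) b ⌟ ω) (outside ∷ T) ≈ b zero * ωᵢ T
    coefficient₀ = trans (+-congˡ (extend-⌟ T (b ∘ suc) (ω ∘ (outside ∷_)))) (+-identityʳ _)
  deletions-extend (outside ∷ T) b ω = trans
    (deletions-cong (λ U → *-cong (drop U) (drop U)) T) (deletions-extend T b (ω ∘ (outside ∷_)))
    where
    drop : ∀ U → (extend (outside ∷ T) b ⌟ ω) (outside ∷ U) ≈ (extend T b ⌟ ω ∘ (outside ∷_)) U
    drop U = trans (+-congʳ (zeroˡ _)) (+-identityˡ _)

  -- Stands for the squared norm of X_T⁻¹ times w(T)², in a form that makes sense and is nonnegative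
  -- even where X_T is singular.
  inverseWeight : (X Y : Matrix n m) → Form m
  inverseWeight {n} X Y T = ∑[ i < n ] deletions ((Y i ⌟ wedge X) ²) T

  inverseWeight-nonNeg : (X Y : Matrix n m) → ∀ T → 0# ≤ inverseWeight X Y T
  inverseWeight-nonNeg {n} X Y T = sum-nonNeg {n} λ i → deletions-nonNeg (λ U → square-nonNeg _) T

  -- Contraction with y depends only on the products of y with the rows of X, so
  -- rows of the inverse of X_T, extended by zero, may replace those of Y.
  frobenius-inverse : {X Y : Matrix n m} (T : Subset m) {B : Matrix n ∣ T ∣} → Dual X Y → Dual (columns X T) B →
    frobenius B * (wedge X ²) T ≈ inverseWeight X Y T
  frobenius-inverse {n} {X = X} {Y} T {B} dualY dualB = begin-equality
    frobenius B * (wedge X ²) T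
      ≈⟨ *-distribʳ-sum {n} _ _ ⟩
    ∑[ i < n ] (∣ B i ∣² * (wedge X ²) T)
      ≈⟨ sum-cong-≋ {n} (λ i → deletions-extend T (B i) (wedge X)) ⟨
    ∑[ i < n ] deletions ((extend T (B i) ⌟ wedge X) ²) T
      ≈⟨ sum-cong-≋ {n} (λ i → deletions-cong (λ U → *-cong (same i U) (same i U)) T) ⟩
    inverseWeight X Y T ∎
    where
    same : ∀ i U → (extend T (B i) ⌟ wedge X) U ≈ (Y i ⌟ wedge X) U
    same i = ⌟-wedge-cong X λ j → trans (extend-∙ T (B i) (X j)) (trans (pairing dualB i j) (sym (pairing dualY i j)))

  sumSubsets-sum : (f : Fin n → Form m) → sumSubsets (λ T → ∑[ i < n ] f i T) ≈ ∑[ i < n ] sumSubsets (f i)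
  sumSubsets-sum {zero}  {m} f = sumSubsets-zero {m} λ _ → refl
  sumSubsets-sum {suc n} {m} f = trans (sumSubsets-+ {m} _ _) (+-congˡ (sumSubsets-sum (f ∘ suc)))

  sum-inverseWeight : {X Y : Matrix n m} → 1 ℕ.≤ n → n ℕ.≤ m → Dual X Y →
    sumSubsets (inverseWeight X Y) ≈ fromℕ (m ℕ.∸ n ℕ.+ 1) * frobenius Y * sumSubsets (wedge X ²)
  sum-inverseWeight {suc n} {m} {X} {Y} _ n<m dual = begin-equality
    sumSubsets (inverseWeight X Y)
      ≈⟨ sumSubsets-sum {suc n} {m} (λ i → deletions ((Y i ⌟ w) ²)) ⟩
    ∑[ i < suc n ] sumSubsets (deletions ((Y i ⌟ w) ²))
      ≈⟨ sum-cong-≋ {suc n} row ⟩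
    ∑[ i < suc n ] (K * (∣ Y i ∣² * sumSubsets (w ²)))
      ≈⟨ *-distribˡ-sum {suc n} K (λ i → ∣ Y i ∣² * sumSubsets (w ²)) ⟨
    K * ∑[ i < suc n ] (∣ Y i ∣² * sumSubsets (w ²))
      ≈⟨ *-congˡ (*-distribʳ-sum {suc n} (sumSubsets (w ²)) (λ i → ∣ Y i ∣²)) ⟨
    K * (frobenius Y * sumSubsets (w ²))
      ≈⟨ *-assoc _ _ _ ⟨
    K * frobenius Y * sumSubsets (w ²) ∎
    where
    w = wedge X
    K = fromℕ (m ℕ.∸ suc n ℕ.+ 1)
    -- With `suc n` rows the contractions live on sets of `n` elements, each obtained by deletion
    -- from `m ∸ n` sets; `n < m` makes this the expected factor.
    m∸n≡ : m ℕ.∸ n ≡ m ℕ.∸ suc n ℕ.+ 1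
    m∸n≡ = ≡.trans (ℕ.+-∸-assoc 1 n<m) (ℕ.+-comm 1 _)
    weigh : ∀ i U → fromℕ (m ℕ.∸ ∣ U ∣) * ((Y i ⌟ w) ²) U ≈ K * ((Y i ⌟ w) ²) U
    weigh i U with ∣ U ∣ ℕ.≟ n
    ... | yes ∣U∣≡n = *-congʳ (reflexive (≡.cong fromℕ (≡.trans (≡.cong (m ℕ.∸_) ∣U∣≡n) m∸n≡)))
    ... | no ∣U∣≢n  = trans (trans (*-congˡ vanishes) (zeroʳ _)) (sym (trans (*-congˡ vanishes) (zeroʳ _)))
      where
      vanishes : ((Y i ⌟ w) ²) U ≈ 0#
      vanishes = trans (*-congˡ (⌟-degree (Y i) w U λ V ∣V∣≡ → wedge-degree X V λ ∣V∣≡1+n →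
        ∣U∣≢n (ℕ.suc-injective (≡.trans (≡.sym ∣V∣≡) ∣V∣≡1+n)))) (zeroʳ _)
    row : ∀ i → sumSubsets (deletions ((Y i ⌟ w) ²)) ≈ K * (∣ Y i ∣² * sumSubsets (w ²))
    row i = begin-equality
      sumSubsets (deletions ((Y i ⌟ w) ²))                     ≈⟨ sumSubsets-deletions ((Y i ⌟ w) ²) ⟩
      sumSubsets (λ U → fromℕ (m ℕ.∸ ∣ U ∣) * ((Y i ⌟ w) ²) U) ≈⟨ sumSubsets-cong {m} (weigh i) ⟩
      sumSubsets (λ U → K * ((Y i ⌟ w) ²) U)                   ≈⟨ sumSubsets-* {m} K _ ⟩
      K * sumSubsets ((Y i ⌟ w) ²)                             ≈⟨ *-congˡ (⌟-wedge-norm {X = X} (inSpan dual i)) ⟩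
      K * (∣ Y i ∣² * sumSubsets (w ²))                        ∎

  -- Straight-line programs

  rename : (V → W) → Program V → Program W
  rename f (output x)        = output (f x)
  rename f (numeral a P)     = numeral a (rename (Maybe.map f) P)
  rename f (compute o x y P) = compute o (f x) (f y) (rename (Maybe.map f) P)
  rename f (compare x y P Q) = compare (f x) (f y) (rename f P) (rename f Q)

  -- Environments are compared pointwise, so register contents may be presented by whatever function
  -- is convenient. Both the output and the operation count are preserved.
  run-rename : (f : V → W) (P : Program V) {ρ : W → ℝ} {ρ′ : V → ℝ} → (∀ v → ρ′ v ≡ ρ (f v)) →
    run (rename f P) ρ ≡ run P ρ′
  run-rename f (output x) h = ≡.cong (_, 0) (≡.sym (h x))
  run-rename f (numeral a P) h = run-rename (Maybe.map f) P λ where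
    nothing  → ≡.refl
    (just v) → h v
  run-rename f (compute o x y P) h = ≡.cong (map₂ suc) (run-rename (Maybe.map f) P λ where
    nothing  → ≡.cong₂ ⟦ o ⟧ (h x) (h y)
    (just v) → h v)
  run-rename f (compare x y P Q) {ρ} {ρ′} h =
    ≡.cong (map₂ suc) (branch (h x) (h y) (run-rename f P h) (run-rename f Q h))
    where
    -- Propositional equality of the compared values turns both tests into the same call of `em`;
    -- the setoid equality would not identify them.
    branch : ∀ {a b a′ b′} {s t s′ t′ : ℝ × ℕ} → a′ ≡ a → b′ ≡ b → s ≡ s′ → t ≡ t′ →
      (if does (em {a ≤ b}) then s else t) ≡ (if does (em {a′ ≤ b′}) then s′ else t′)
    branch ≡.refl ≡.refl ≡.refl ≡.refl = ≡.refl

  data Expr (V : Set) : Set where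
    var : V → Expr V
    lit : ℕ → Expr V
    op  : Op → Expr V → Expr V → Expr V

  value : Expr V → (V → ℝ) → ℝ
  value (var x)    ρ = ρ x
  value (lit a)    ρ = fromℕ a
  value (op o a b) ρ = ⟦ o ⟧ (value a ρ) (value b ρ)

  cost : Expr V → ℕ
  cost (var x)    = 0
  cost (lit a)    = 0
  cost (op o a b) = cost a ℕ.+ (cost b ℕ.+ 1)

  -- The expression is over the registers U of an earlier context, so that the
  -- recursion on it is structural.
  store : (U → V) → Expr U → Program (Maybe V) → Program V
  store σ (var x)    P = rename (maybe id (σ x)) P
  store σ (lit a)    P = numeral a (rename id P)
  store σ (op o a b) P =
    store σ a (store (just ∘ σ) b (compute o (just nothing) nothing (rename (Maybe.map (just ∘ just)) P)))

  -- A variable is free of charge because `store` identifies the new register with the old one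
  -- instead of copying. Intermediate results of an operation stay in registers hidden from `P`.
  run-store : (σ : U → V) (e : Expr U) (P : Program (Maybe V)) {ρ : V → ℝ} {ρ′ : Maybe V → ℝ} →
    ρ′ nothing ≡ value e (ρ ∘ σ) → (∀ v → ρ′ (just v) ≡ ρ v) →
    run (store σ e P) ρ ≡ map₂ (cost e ℕ.+_) (run P ρ′)
  run-store σ (var x) P new old = run-rename (maybe id (σ x)) P λ where
    nothing  → new
    (just v) → old v
  run-store σ (lit a) P new old = run-rename id P λ where
    nothing  → new
    (just v) → old v
  run-store σ (op o a b) P {ρ} {ρ′} new old = ≡.trans
    (run-store σ a _ {ρ′ = ρ₁} ≡.refl (λ _ → ≡.refl))
    (≡.trans (≡.cong (map₂ (cost a ℕ.+_)) (≡.trans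
      (run-store (just ∘ σ) b _ {ρ₁} {ρ₂} ≡.refl (λ _ → ≡.refl))
      (≡.cong (map₂ (cost b ℕ.+_) ∘ map₂ suc) (run-rename _ P λ where
        nothing  → new
        (just v) → old v))))
      (≡.cong (proj₁ (run P ρ′) ,_) (Counting.store-regroup (cost a) (cost b) (proj₂ (run P ρ′)))))
    where
    ρ₁ = maybe ρ (value a (ρ ∘ σ))
    ρ₂ = maybe ρ₁ (value b (ρ ∘ σ))

  costs : (Fin size → Expr V) → ℕ
  costs {zero}  e = 0
  costs {suc size} e = cost (e zero) ℕ.+ costs (e ∘ suc)

  costs-≤ : (e : Fin size → Expr V) {b : ℕ} → (∀ i → cost (e i) ℕ.≤ b) → costs e ℕ.≤ size ℕ.* b
  costs-≤ {zero}  e e≤b = ℕ.z≤n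
  costs-≤ {suc size} e e≤b = ℕ.+-mono-≤ (e≤b zero) (costs-≤ (e ∘ suc) (e≤b ∘ suc))

  totalₑ : (Fin size → Expr V) → Expr V
  totalₑ {zero}  e = lit 0
  totalₑ {suc size} e = op add (e zero) (totalₑ (e ∘ suc))

  value-totalₑ : (e : Fin size → Expr V) (ρ : V → ℝ) → value (totalₑ e) ρ ≡ ∑[ i < size ] value (e i) ρ
  value-totalₑ {zero}  e ρ = ≡.refl
  value-totalₑ {suc size} e ρ = ≡.cong (λ x → value (e zero) ρ + x) (value-totalₑ (e ∘ suc) ρ)

  cost-totalₑ : (e : Fin size → Expr V) {b : ℕ} → (∀ i → cost (e i) ℕ.≤ b) → cost (totalₑ e) ℕ.≤ size ℕ.* (b ℕ.+ 1)
  cost-totalₑ {zero}  e e≤b = ℕ.z≤n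
  cost-totalₑ {suc size} e {b} e≤b = ℕ.≤-trans
    (ℕ.+-mono-≤ (e≤b zero) (ℕ.+-monoˡ-≤ 1 (cost-totalₑ (e ∘ suc) (e≤b ∘ suc))))
    (ℕ.≤-reflexive (Counting.total-bound b size))

  -- Simultaneous assignment: all expressions range over the earlier context `U`, so none of them
  -- sees a value stored by another.
  storeAll : (U → V) → (Fin size → Expr U) → Program (V ⊎ Fin size) → Program V
  storeAll {size = zero}  σ e P = rename [ id , (λ ()) ]′ P
  storeAll {size = suc size} σ e P = store σ (e zero) (storeAll (just ∘ σ) (e ∘ suc) (rename [ inj₁ ∘ just , shift ]′ P))
    where
    shift : Fin (suc size) → Maybe _ ⊎ Fin size
    shift zero    = inj₁ nothing
    shift (suc i) = inj₂ i

  run-storeAll : (σ : U → V) (e : Fin size → Expr U) (P : Program (V ⊎ Fin size)) {ρ : V → ℝ} {ρ′ : V ⊎ Fin size → ℝ} →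
    (∀ i → ρ′ (inj₂ i) ≡ value (e i) (ρ ∘ σ)) → (∀ v → ρ′ (inj₁ v) ≡ ρ v) →
    run (storeAll σ e P) ρ ≡ map₂ (costs e ℕ.+_) (run P ρ′)
  run-storeAll {size = zero} σ e P new old = run-rename _ P λ where
    (inj₁ v) → old v
  run-storeAll {V = V} {size = suc size} σ e P {ρ} {ρ′} new old = ≡.trans
    (run-store σ (e zero) _ {ρ′ = ρ₁} ≡.refl (λ _ → ≡.refl))
    (≡.trans (≡.cong (map₂ (cost (e zero) ℕ.+_)) (≡.trans
      (run-storeAll (just ∘ σ) (e ∘ suc) _ {ρ₁} {ρ₂} (λ i → new (suc i)) (λ _ → ≡.refl))
      (≡.cong (map₂ (costs (e ∘ suc) ℕ.+_)) (run-rename _ P λ where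
        (inj₁ v)       → old v
        (inj₂ zero)    → new zero
        (inj₂ (suc i)) → ≡.refl))))
      (≡.cong (proj₁ (run P ρ′) ,_) (≡.sym (ℕ.+-assoc (cost (e zero)) _ _))))
    where
    ρ₁ : Maybe V → ℝ
    ρ₁ = maybe ρ (value (e zero) (ρ ∘ σ))
    ρ₂ : Maybe V ⊎ Fin size → ℝ
    ρ₂ = [ ρ₁ , ρ′ ∘ inj₂ ∘ suc ]′

  storeMatrix : (U → V) → (Fin n → Fin m → Expr U) → Program (V ⊎ (Fin n × Fin m)) → Program V
  storeMatrix {m = m} σ e P = storeAll σ (uncurry e ∘ remQuot m) (rename (Sum.map₂ (uncurry combine)) P)

  run-storeMatrix : (σ : U → V) (e : Fin n → Fin m → Expr U) (P : Program (V ⊎ (Fin n × Fin m)))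
    {ρ : V → ℝ} {ρ′ : V ⊎ (Fin n × Fin m) → ℝ} →
    (∀ i j → ρ′ (inj₂ (i , j)) ≡ value (e i j) (ρ ∘ σ)) → (∀ v → ρ′ (inj₁ v) ≡ ρ v) →
    run (storeMatrix σ e P) ρ ≡ map₂ (costs (uncurry e ∘ remQuot m) ℕ.+_) (run P ρ′)
  run-storeMatrix {m = m} σ e P {ρ} {ρ′} new old = ≡.trans
    (run-storeAll σ (uncurry e ∘ remQuot m) _ {ρ′ = [ ρ , (λ k → value (uncurry e (remQuot m k)) (ρ ∘ σ)) ]′} (λ _ → ≡.refl) (λ _ → ≡.refl))
    (≡.cong (map₂ (costs (uncurry e ∘ remQuot m) ℕ.+_)) (run-rename _ P λ where
      (inj₁ v)       → old v
      (inj₂ (i , j)) → ≡.trans (new i j) (≡.cong (λ q → value (uncurry e q) (ρ ∘ σ)) (≡.sym (remQuot-combine i j)))))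

  -- The Gram–Schmidt program

  data Register (n m p : ℕ) : Set where
    acc : Register n m p
    xᵣ  : Fin n → Fin m → Register n m p
    cᵣ  : Fin n → Fin p → Register n m p


  xMatrix : (Register n m p → ℝ) → Matrix n m
  xMatrix ρ i j = ρ (xᵣ i j)

  cMatrix : (Register n m p → ℝ) → Matrix n p
  cMatrix ρ i j = ρ (cᵣ i j)

  dotₑ : (Fin m → Expr V) → (Fin m → Expr V) → Expr V
  dotₑ a b = totalₑ λ j → op multiply (a j) (b j)

  value-dotₑ : (a b : Fin m → Expr V) (ρ : V → ℝ) → value (dotₑ a b) ρ ≡ (λ j → value (a j) ρ) ∙ (λ j → value (b j) ρ)
  value-dotₑ a b = value-totalₑ λ j → op multiply (a j) (b j)

  cost-dotₑ : (a b : Fin k → V) → cost (dotₑ (var ∘ a) (var ∘ b)) ℕ.≤ k ℕ.* 2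
  cost-dotₑ a b = cost-totalₑ (λ j → op multiply (var (a j)) (var (b j))) λ _ → ℕ.≤-refl

  module Step (n m p : ℕ) where

    row : Fin (suc n) → Fin m → Expr (Register (suc n) m p)
    row i j = var (xᵣ i j)

    row₀ : Fin p → Expr (Register (suc n) m p)
    row₀ j = var (cᵣ zero j)

    -- The squared norm of the first row is recomputed for every multiplier, at the price of a
    -- larger constant in the cost bound only.
    multiplierₑ : Fin n → Expr (Register (suc n) m p)
    multiplierₑ i = op divide (dotₑ (row (suc i)) (row zero)) (dotₑ (row zero) (row zero))

    accₑ : Expr (Register (suc n) m p)
    accₑ = op add (var acc) (op divide (dotₑ row₀ row₀) (dotₑ (row zero) (row zero)))

    xₑ : Fin n → Fin m → Expr (Register (suc n) m p ⊎ Fin n)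
    xₑ i j = op subtract (var (inj₁ (xᵣ (suc i) j))) (op multiply (var (inj₂ i)) (var (inj₁ (xᵣ zero j))))

    cₑ : Fin n → Fin p → Expr (Register (suc n) m p ⊎ Fin n)
    cₑ i j = op subtract (var (inj₁ (cᵣ (suc i) j))) (op multiply (var (inj₂ i)) (var (inj₁ (cᵣ zero j))))

    layout : Register n m p → (Maybe (Register (suc n) m p ⊎ Fin n) ⊎ (Fin n × Fin m)) ⊎ (Fin n × Fin p)
    layout acc      = inj₁ (inj₁ nothing)
    layout (xᵣ i j) = inj₁ (inj₂ (i , j))
    layout (cᵣ i j) = inj₂ (i , j)

    step : Program (Register n m p) → Program (Register (suc n) m p)
    step P = storeAll id multiplierₑ (store inj₁ accₑ (storeMatrix just xₑ (storeMatrix (inj₁ ∘ just) cₑ (rename layout P))))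

    stepCost : ℕ
    stepCost = costs multiplierₑ ℕ.+ (cost accₑ ℕ.+ (costs (uncurry xₑ ∘ remQuot m) ℕ.+ costs (uncurry cₑ ∘ remQuot p)))

    next : (Register (suc n) m p → ℝ) → Register n m p → ℝ
    next ρ acc      = ρ acc + ∣ cMatrix ρ zero ∣² / ∣ xMatrix ρ zero ∣²
    next ρ (xᵣ i j) = eliminate (multiplier (xMatrix ρ)) (xMatrix ρ) i j
    next ρ (cᵣ i j) = eliminate (multiplier (xMatrix ρ)) (cMatrix ρ) i j

    run-step : (P : Program (Register n m p)) (ρ : Register (suc n) m p → ℝ) →
      run (step P) ρ ≡ map₂ (stepCost ℕ.+_) (run P (next ρ))
    run-step P ρ = ≡.trans
      (run-storeAll id multiplierₑ _ {ρ} {ρ₁}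
        (λ i → ≡.sym (≡.cong₂ _/_ (value-dotₑ (row (suc i)) (row zero) ρ) (value-dotₑ (row zero) (row zero) ρ))) (λ _ → ≡.refl))
      (≡.trans (≡.cong (map₂ (costs multiplierₑ ℕ.+_)) (≡.trans
        (run-store inj₁ accₑ _ {ρ₁} {ρ₂}
          (≡.sym (≡.cong (λ x → ρ acc + x) (≡.cong₂ _/_ (value-dotₑ row₀ row₀ ρ) (value-dotₑ (row zero) (row zero) ρ)))) (λ _ → ≡.refl))
        (≡.cong (map₂ (cost accₑ ℕ.+_)) (≡.trans
          (run-storeMatrix just xₑ _ {ρ₂} {ρ₃} (λ _ _ → ≡.refl) (λ _ → ≡.refl))
          (≡.cong (map₂ (costs (uncurry xₑ ∘ remQuot m) ℕ.+_)) (≡.trans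
            (run-storeMatrix (inj₁ ∘ just) cₑ _ {ρ₃} {ρ₄} (λ _ _ → ≡.refl) (λ _ → ≡.refl))
            (≡.cong (map₂ (costs (uncurry cₑ ∘ remQuot p) ℕ.+_)) (run-rename layout P λ where
              acc      → ≡.refl
              (xᵣ i j) → ≡.refl
              (cᵣ i j) → ≡.refl))))))))
        (≡.cong (proj₁ (run P (next ρ)) ,_) (Counting.step-regroup (costs multiplierₑ) (cost accₑ)
          (costs (uncurry xₑ ∘ remQuot m)) (costs (uncurry cₑ ∘ remQuot p)) (proj₂ (run P (next ρ))))))
      where
      ρ₁ = [ ρ , multiplier (xMatrix ρ) ]′
      ρ₂ = maybe ρ₁ (next ρ acc)
      ρ₃ = [ ρ₂ , uncurry (eliminate (multiplier (xMatrix ρ)) (xMatrix ρ)) ]′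
      ρ₄ = [ ρ₃ , uncurry (eliminate (multiplier (xMatrix ρ)) (cMatrix ρ)) ]′

    stepCost-≤ : 1 ℕ.≤ m → p ℕ.≤ m → stepCost ℕ.≤ 9 ℕ.* m ℕ.* suc n
    stepCost-≤ 1≤m p≤m = ℕ.≤-trans
      (ℕ.+-mono-≤
        (costs-≤ multiplierₑ λ i → ℕ.+-mono-≤ (cost-dotₑ {m} (xᵣ (suc i)) (xᵣ zero)) (ℕ.+-monoˡ-≤ 1 (cost-dotₑ {m} (xᵣ zero) (xᵣ zero))))
        (ℕ.+-mono-≤
          (ℕ.+-monoˡ-≤ 1 (ℕ.+-mono-≤ (cost-dotₑ {p} (cᵣ zero) (cᵣ zero)) (ℕ.+-monoˡ-≤ 1 (cost-dotₑ {m} (xᵣ zero) (xᵣ zero)))))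
          (ℕ.+-mono-≤ (costs-≤ (uncurry xₑ ∘ remQuot m) λ _ → ℕ.≤-refl) (costs-≤ (uncurry cₑ ∘ remQuot p) λ _ → ℕ.≤-refl))))
      (Counting.step-bound n 1≤m p≤m)

  sweep : ∀ n m p → Program (Register n m p)
  sweep zero    m p = output acc
  sweep (suc n) m p = Step.step n m p (sweep n m p)

  value-sweep : ∀ n m p (ρ : Register n m p → ℝ) →
    proj₁ (run (sweep n m p) ρ) ≈ ρ acc + gramSchmidt (xMatrix ρ) (cMatrix ρ)
  value-sweep zero    m p ρ = sym (+-identityʳ _)
  value-sweep (suc n) m p ρ = begin-equality
    proj₁ (run (sweep (suc n) m p) ρ)      ≡⟨ ≡.cong proj₁ (Step.run-step n m p (sweep n m p) ρ) ⟩
    proj₁ (run (sweep n m p) (next ρ))     ≈⟨ value-sweep n m p (next ρ) ⟩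
    next ρ acc + rest                      ≈⟨ +-assoc (ρ acc) _ rest ⟩
    ρ acc + gramSchmidt (xMatrix ρ) (cMatrix ρ) ∎
    where
    open Step n m p using (next)
    rest = gramSchmidt (xMatrix (next ρ)) (cMatrix (next ρ))

  cost-sweep : ∀ n m p (ρ : Register n m p → ℝ) → 1 ℕ.≤ m → p ℕ.≤ m →
    proj₂ (run (sweep n m p) ρ) ℕ.≤ 9 ℕ.* m ℕ.* (n ℕ.* n)
  cost-sweep zero    m p ρ 1≤m p≤m = ℕ.z≤n
  cost-sweep (suc n) m p ρ 1≤m p≤m = ℕ.≤-trans
    (ℕ.≤-reflexive (≡.cong proj₂ (Step.run-step n m p (sweep n m p) ρ)))
    (ℕ.≤-trans (ℕ.+-mono-≤ (stepCost-≤ 1≤m p≤m) (cost-sweep n m p (next ρ) 1≤m p≤m)) (Counting.sweep-bound m n))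
    where open Step n m p using (next; stepCost-≤)

  -- The program for the squared norms of inverses and pseudo-inverses.

  gramSchmidt-congʳ : (X : Matrix n m) {C D : Matrix n p} → C ≋ D → gramSchmidt X C ≈ gramSchmidt X D
  gramSchmidt-congʳ {zero}  X C≋D = refl
  gramSchmidt-congʳ {suc n} X C≋D = +-cong
    (*-congʳ (∙-cong (C≋D zero) (C≋D zero)))
    (gramSchmidt-congʳ (eliminate (multiplier X) X) λ i j → +-cong (C≋D (suc i) j) (-‿cong (*-congˡ (C≋D zero j))))

  -- The identity block and the initial accumulator are loaded as numerals, for which no operation
  -- is charged, so the whole cost is that of `sweep`.
  normProgram : ∀ n m → Program (Fin n × Fin m)
  normProgram n m = storeMatrix id (λ i j → lit (identity i j)) (store id (lit 0) (rename layout (sweep n m n)))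
    module NormProgram where
    identity : Fin n → Fin n → ℕ
    identity i j = if does (i ≟ᶠ j) then 1 else 0
    layout : Register n m n → Maybe ((Fin n × Fin m) ⊎ (Fin n × Fin n))
    layout acc      = nothing
    layout (xᵣ i j) = just (inj₁ (i , j))
    layout (cᵣ i j) = just (inj₂ (i , j))
    initial : Matrix n m → Register n m n → ℝ
    initial X acc      = 0#
    initial X (xᵣ i j) = X i j
    initial X (cᵣ i j) = fromℕ (identity i j)

  costs-lit : (f : Fin size → ℕ) → costs {V = V} (lit ∘ f) ≡ 0
  costs-lit {zero}  f = ≡.refl
  costs-lit {suc size} f = costs-lit (f ∘ suc)

  run-normProgram : (X : Matrix n m) → run (normProgram n m) (entries X) ≡ run (sweep n m n) (NormProgram.initial n m X)
  run-normProgram {n} {m} X = ≡.trans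
    (run-storeMatrix id (λ i j → lit (identity i j)) _ {entries X} {[ entries X , uncurry (λ i j → fromℕ (identity i j)) ]′} (λ _ _ → ≡.refl) (λ _ → ≡.refl))
    (≡.trans (≡.cong₂ (λ c → map₂ (c ℕ.+_)) (costs-lit {n ℕ.* n} (uncurry identity ∘ remQuot n))
      (run-store id (lit 0) (rename layout (sweep n m n)) {ρ′ = maybe [ entries X , uncurry (λ i j → fromℕ (identity i j)) ]′ 0#} ≡.refl (λ _ → ≡.refl)))
      (run-rename layout (sweep n m n) {maybe [ entries X , uncurry (λ i j → fromℕ (identity i j)) ]′ 0#} λ where
        acc      → ≡.refl
        (xᵣ i j) → ≡.refl
        (cᵣ i j) → ≡.refl))
    where open NormProgram n m

  value-normProgram : (X : Matrix n m) → proj₁ (run (normProgram n m) (entries X)) ≈ gramSchmidt X 𝟏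
  value-normProgram {n} {m} X = begin-equality
    proj₁ (run (normProgram n m) (entries X))       ≡⟨ ≡.cong proj₁ (run-normProgram X) ⟩
    proj₁ (run (sweep n m n) (initial X))           ≈⟨ value-sweep n m n (initial X) ⟩
    0# + gramSchmidt X (λ i j → fromℕ (identity i j)) ≈⟨ +-identityˡ _ ⟩
    gramSchmidt X (λ i j → fromℕ (identity i j))    ≈⟨ gramSchmidt-congʳ X fromℕ-identity ⟩
    gramSchmidt X 𝟏                                 ∎
    where
    open NormProgram n m
    fromℕ-identity : ∀ i j → fromℕ (identity i j) ≈ 𝟏 i j
    fromℕ-identity i j with does (i ≟ᶠ j)
    ... | true  = +-identityʳ 1#
    ... | false = refl

  cost-normProgram : (X : Matrix n m) → 1 ℕ.≤ m → n ℕ.≤ m → proj₂ (run (normProgram n m) (entries X)) ℕ.≤ 9 ℕ.* m ℕ.* (n ℕ.* n)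
  cost-normProgram {n} {m} X 1≤m n≤m = ℕ.≤-trans
    (ℕ.≤-reflexive (≡.cong proj₂ (run-normProgram X))) (cost-sweep n m n _ 1≤m n≤m)

  value-normProgram-dual : {X Y : Matrix n m} → Dual X Y → proj₁ (run (normProgram n m) (entries X)) ≈ frobenius Y
  value-normProgram-dual {X = X} dual = trans (value-normProgram X) (gramSchmidt-𝟏 dual)

  inverse-frobenius : {A : Matrix n m} (inverse : Invertible A) → ‖ A ⁺ ‖F ^ 2 ≈ frobenius (proj₁ inverse ᵀ)
  inverse-frobenius {A = A} (B , inverse) = begin-equality
    ‖ A ⁺ ‖F ^ 2       ≈⟨ ‖‖F-square (A ⁺) ⟩
    frobenius (A ⁺)    ≈⟨ frobenius-cong (⁺-unique inverse) ⟩
    frobenius B        ≈⟨ frobenius-ᵀ B ⟨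
    frobenius (B ᵀ)    ∎

  pseudoInverse-frobenius : {X Y : Matrix n m} → Dual X Y → ‖ X † ‖F ^ 2 ≈ frobenius Y
  pseudoInverse-frobenius {X = X} {Y} dual = begin-equality
    ‖ X † ‖F ^ 2       ≈⟨ ‖‖F-square (X †) ⟩
    frobenius (X †)    ≈⟨ frobenius-cong (†-dual dual) ⟩
    frobenius (Y ᵀ)    ≈⟨ frobenius-ᵀ Y ⟩
    frobenius Y        ∎

  fullRank-dual : {X : Matrix n m} → HasRank X n → ∃ (Dual X)
  fullRank-dual {X = X} rank = let Y , dual , _ = gramSchmidt-dual X (fullRank⇒independent rank) in Y , dual

  subroutines : Subroutines
  subroutines = record
    { invNorm²          = normProgram
    ; pinvNorm²         = normProgram
    ; invNorm²-correct  = λ A _ inverse → trans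
        (value-normProgram-dual (inverse⇒dual (proj₂ inverse))) (sym (inverse-frobenius inverse))
    ; pinvNorm²-correct = λ X _ rank → let Y , dual = fullRank-dual rank in
        trans (value-normProgram-dual dual) (sym (pseudoInverse-frobenius dual))
    }

  -- Volume sampling

  sumSubsets-mono-≤ : {f g : Form m} → (∀ T → f T ≤ g T) → sumSubsets f ≤ sumSubsets g
  sumSubsets-mono-≤ {zero}  f≤g = f≤g []
  sumSubsets-mono-≤ {suc m} f≤g =
    +-mono-≤ (sumSubsets-mono-≤ (f≤g ∘ (inside ∷_))) (sumSubsets-mono-≤ (f≤g ∘ (outside ∷_)))

  sumSubsets-nonNeg : {f : Form m} → (∀ T → 0# ≤ f T) → 0# ≤ sumSubsets f
  sumSubsets-nonNeg {m} 0≤f = ≤-respˡ-≈ (sumSubsets-zero {m} λ _ → refl) (sumSubsets-mono-≤ 0≤f)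

  term≤sumSubsets : {f : Form m} → (∀ T → 0# ≤ f T) → ∀ T → f T ≤ sumSubsets f
  term≤sumSubsets 0≤f [] = ≤-refl
  term≤sumSubsets 0≤f (inside ∷ T) = ≤-trans (≤-reflexive (sym (+-identityʳ _)))
    (+-mono-≤ (term≤sumSubsets (0≤f ∘ (inside ∷_)) T) (sumSubsets-nonNeg (0≤f ∘ (outside ∷_))))
  term≤sumSubsets 0≤f (outside ∷ T) = ≤-trans (≤-reflexive (sym (+-identityˡ _)))
    (+-mono-≤ (sumSubsets-nonNeg (0≤f ∘ (inside ∷_))) (term≤sumSubsets (0≤f ∘ (outside ∷_)) T))

  totalVolume : (X : Matrix n m) → sumSubsets (volume X) ≈ sumSubsets (wedge X ²)
  totalVolume X = sumSubsets-cong (volume-wedge X)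

  -- Full rank enters the sampling here: the dual basis keeps the wedge from vanishing everywhere,
  -- so `volSamp` divides by a nonzero number.
  totalVolume-pos : {X Y : Matrix n m} → Dual X Y → 0# < sumSubsets (wedge X ²)
  totalVolume-pos {X = X} {Y} dual = sumSubsets-nonNeg (λ T → square-nonNeg (wedge X T)) , λ 0≈Z →
    paired⇒wedge≉0 X Y (pairing dual) λ T → xx≈0⇒x≈0 (antisym
      (≤-trans (term≤sumSubsets (λ T → square-nonNeg (wedge X T)) T) (≤-reflexive (sym 0≈Z)))
      (square-nonNeg (wedge X T)))

  volSamp-wedge : (X : Matrix n m) (T : Subset m) → volSamp X T ≈ (wedge X ²) T / sumSubsets (wedge X ²)
  volSamp-wedge X T = *-cong (volume-wedge X T) (⁻¹-cong (totalVolume X))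

  volSamp-nonNeg : {X Y : Matrix n m} → Dual X Y → ∀ T → 0# ≤ volSamp X T
  volSamp-nonNeg {X = X} dual T = ≤-respʳ-≈ (sym (volSamp-wedge X T))
    (/-nonNeg (square-nonNeg (wedge X T)) (totalVolume-pos dual))

  volSamp-expectation : (X : Matrix n m) (f : Form m) →
    sumSubsets (λ T → volSamp X T * f T) ≈ sumSubsets (λ T → (wedge X ²) T * f T) / sumSubsets (wedge X ²)
  volSamp-expectation {m = m} X f = begin-equality
    sumSubsets (λ T → volSamp X T * f T)
      ≈⟨ sumSubsets-cong {m} (λ T → trans (*-congʳ (volSamp-wedge X T))
           (solve 3 (λ w z f → w :* z :* f := z :* (w :* f)) refl ((wedge X ²) T) (Z ⁻¹) (f T))) ⟩
    sumSubsets (λ T → Z ⁻¹ * ((wedge X ²) T * f T))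
      ≈⟨ sumSubsets-* {m} (Z ⁻¹) _ ⟩
    Z ⁻¹ * sumSubsets (λ T → (wedge X ²) T * f T)
      ≈⟨ *-comm _ _ ⟩
    sumSubsets (λ T → (wedge X ²) T * f T) / Z ∎
    where Z = sumSubsets (wedge X ²)

  volSamp-total : {X Y : Matrix n m} → Dual X Y → sumSubsets (volSamp X) ≈ 1#
  volSamp-total {m = m} {X = X} dual = begin-equality
    sumSubsets (volSamp X)                              ≈⟨ sumSubsets-cong {m} (λ T → *-identityʳ _) ⟨
    sumSubsets (λ T → volSamp X T * 1#)                 ≈⟨ volSamp-expectation X (λ _ → 1#) ⟩
    sumSubsets (λ T → (wedge X ²) T * 1#) / Z           ≈⟨ *-congʳ (sumSubsets-cong {m} λ T → *-identityʳ _) ⟩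
    Z / Z                                               ≈⟨ *-inverseʳ (0<x⇒x≉0 (totalVolume-pos dual)) ⟩
    1#                                                  ∎
    where Z = sumSubsets (wedge X ²)

  wedge≉0⇒columns-dual : (X : Matrix n m) (T : Subset m) → ¬ wedge X T ≈ 0# → ∃ (Dual (columns X T))
  wedge≉0⇒columns-dual X T w≉0 =
    let B , dual , _ = gramSchmidt-dual (columns X T) (wedge≉0⇒independent (columns X T)
          (_ , λ w≈0 → w≉0 (trans (sym (wedge-columns-full X T)) w≈0)))
    in B , dual

  wedge≉0⇒∣T∣≡n : (X : Matrix n m) (T : Subset m) → ¬ wedge X T ≈ 0# → ∣ T ∣ ≡ n
  wedge≉0⇒∣T∣≡n {n} X T w≉0 with ∣ T ∣ ℕ.≟ n
  ... | yes ∣T∣≡n = ∣T∣≡n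
  ... | no ∣T∣≢n  = contradiction (wedge-degree X T ∣T∣≢n) w≉0

  volSamp-pos⇒wedge≉0 : (X : Matrix n m) (T : Subset m) → 0# < volSamp X T → ¬ wedge X T ≈ 0#
  volSamp-pos⇒wedge≉0 X T 0<p w≈0 = 0<x⇒x≉0 0<p (trans (volSamp-wedge X T)
    (trans (*-congʳ (trans (*-congʳ w≈0) (zeroˡ _))) (zeroˡ _)))

  -- Independent draws

  expect-cong : (p : Form m) {f g : Vec (Subset m) k → ℝ} → (∀ Ts → f Ts ≈ g Ts) → expect p k f ≈ expect p k g
  expect-cong {k = zero}      p f≈g = f≈g []
  expect-cong {m} {k = suc k} p f≈g = sumSubsets-cong {m} λ T → *-congˡ (expect-cong p λ Ts → f≈g (T ∷ Ts))

  -- A draw of probability zero contributes nothing to either side. The restriction to possible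
  -- draws matters, since the cost of a draw is bounded only for sets of `n` columns.
  expect-mono-≤ : {p : Form m} → (∀ T → 0# ≤ p T) → {f g : Vec (Subset m) k → ℝ} →
    (∀ Ts → All (λ T → 0# < p T) Ts → f Ts ≤ g Ts) → expect p k f ≤ expect p k g
  expect-mono-≤ {k = zero} 0≤p f≤g = f≤g [] []
  expect-mono-≤ {m} {k = suc k} {p} 0≤p {f} {g} f≤g = sumSubsets-mono-≤ {m} λ T → weighted T em
    where
    weighted : ∀ T → Dec (0# ≈ p T) → p T * expect p k (λ Ts → f (T ∷ Ts)) ≤ p T * expect p k (λ Ts → g (T ∷ Ts))
    weighted T (yes 0≈p) = ≤-reflexive (trans (vanishes _) (sym (vanishes _)))
      where
      vanishes : ∀ x → p T * x ≈ 0#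
      vanishes x = trans (*-congʳ (sym 0≈p)) (zeroˡ x)
    weighted T (no 0≉p) = *-monoˡ-≤ (0≤p T) (expect-mono-≤ 0≤p λ Ts pos → f≤g (T ∷ Ts) ((0≤p T , 0≉p) ∷ pos))

  allOf : Form m → Vec (Subset m) k → ℝ
  allOf r []       = 1#
  allOf r (T ∷ Ts) = r T * allOf r Ts

  -- The affine shape closes the induction: after a draw `T` the same expression recurs with
  -- `b * r T` in place of `b`.
  expect-allOf : {p : Form m} → sumSubsets p ≈ 1# → (r : Form m) → ∀ k a b →
    expect p k (λ Ts → a - b * allOf r Ts) ≈ a - b * sumSubsets (λ T → p T * r T) ^ k
  expect-allOf total r zero a b = refl
  expect-allOf {m} {p} total r (suc k) a b = begin-equality
    sumSubsets (λ T → p T * expect p k (λ Ts → a - b * (r T * allOf r Ts)))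
      ≈⟨ sumSubsets-cong {m} (λ T → *-congˡ (trans
           (expect-cong {k = k} p λ Ts → +-congˡ (-‿cong (sym (*-assoc b (r T) (allOf r Ts)))))
           (expect-allOf total r k a (b * r T)))) ⟩
    sumSubsets (λ T → p T * (a - b * r T * q ^ k))
      ≈⟨ sumSubsets-cong {m} (λ T → solve 5 (λ p a b r s → p :* (a :- b :* r :* s) := a :* p :+ (:- (b :* s)) :* (p :* r)) refl (p T) a b (r T) (q ^ k)) ⟩
    sumSubsets (λ T → a * p T + - (b * q ^ k) * (p T * r T))
      ≈⟨ trans (sumSubsets-+ {m} _ _) (+-cong (sumSubsets-* {m} a p) (sumSubsets-* {m} (- (b * q ^ k)) _)) ⟩
    a * sumSubsets p + - (b * q ^ k) * q
      ≈⟨ +-congʳ (*-congˡ total) ⟩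
    a * 1# + - (b * q ^ k) * q
      ≈⟨ solve 4 (λ a b s q → a :* con (+ 1) :+ (:- (b :* s)) :* q := a :- b :* (q :* s)) refl a b (q ^ k) q ⟩
    a - b * (q * q ^ k) ∎
    where q = sumSubsets λ T → p T * r T

  prob≤1 : {p : Form m} → (∀ T → 0# ≤ p T) → sumSubsets p ≈ 1# → ∀ k (E : Vec (Subset m) k → Set) → prob p k E ≤ 1#
  prob≤1 {m} {p} 0≤p total k E = begin
    prob p k E                                      ≤⟨ expect-mono-≤ 0≤p (λ Ts _ → indicator≤ Ts em) ⟩
    -- The constant 1 is written as the case `b = 0#` of `expect-allOf`, which shows that the total
    -- mass is 1.
    expect p k (λ Ts → 1# - 0# * allOf p Ts)        ≈⟨ expect-allOf total p k 1# 0# ⟩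
    1# - 0# * sumSubsets (λ T → p T * p T) ^ k      ≈⟨ solve 1 (λ x → con (+ 1) :- con (+ 0) :* x := con (+ 1)) refl _ ⟩
    1#                                              ∎
    where
    indicator≤ : ∀ Ts (E? : Dec (E Ts)) → (if does E? then 1# else 0#) ≤ 1# - 0# * allOf p Ts
    indicator≤ Ts E? = ≤-respʳ-≈ (solve 1 (λ x → con (+ 1) := con (+ 1) :- con (+ 0) :* x) refl (allOf p Ts)) (bound E?)
      where
      bound : (E? : Dec (E Ts)) → (if does E? then 1# else 0#) ≤ 1#
      bound (yes _) = ≤-refl
      bound (no _)  = 0≤1

  -- The bound by 1 guarantees that the supremum defining `prob∞` exists, so that `sup` returns it
  -- and not the default value.
  prob≤prob∞ : {p : Form m} → (∀ T → 0# ≤ p T) → sumSubsets p ≈ 1# →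
    (E : ∀ {k} → Vec (Subset m) k → Set) → ∀ k → prob p k E ≤ prob∞ p E
  prob≤prob∞ {p = p} 0≤p total E k = proj₁ (choose-satisfies 0# (IsSup Prefix) supremum) (k , refl)
    where
    Prefix : ℝ → Set
    Prefix q = ∃ λ k → q ≈ prob p k E
    supremum : ∃ (IsSup Prefix)
    supremum = complete Prefix (_ , 0 , refl) (1# , λ (k , q≈) → ≤-trans (≤-reflexive q≈) (prob≤1 0≤p total k E))

  -- The rejection loop

  if-yes : {P A : Set} (P? : Dec P) {x y : A} → P → (if does P? then x else y) ≡ x
  if-yes (yes _) p = ≡.refl
  if-yes (no ¬p) p = contradiction p ¬p

  if-no : {P A : Set} (P? : Dec P) {x y : A} → ¬ P → (if does P? then x else y) ≡ y
  if-no (yes p) ¬p = contradiction p ¬p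
  if-no (no _)  ¬p = ≡.refl

  map₂-just : {A : Set} {f : ℕ → ℕ} (r : Maybe (A × ℕ)) {x : A} {t : ℕ} →
    Maybe.map (map₂ f) r ≡ just (x , t) → ∃ λ s → r ≡ just (x , s)
  map₂-just (just (x , s)) ≡.refl = s , ≡.refl

  module Loop {n m} (X : Matrix n m) (d : ℕ) (α : ℝ) where

    estimate : Subset m → ℝ
    estimate T = proj₁ (run (normProgram n ∣ T ∣) (entries (columns X T)))

    drawCost : Subset m → ℕ
    drawCost T = d ℕ.+ proj₂ (run (normProgram n ∣ T ∣) (entries (columns X T))) ℕ.+ 1

    Accepted : Subset m → Set
    Accepted T = estimate T ≤ α

    rejection : Subset m → ℝ
    rejection T = if does (em {Accepted T}) then 0# else 1#

    rejection-nonNeg : ∀ T → 0# ≤ rejection T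
    rejection-nonNeg T with does (em {Accepted T})
    ... | true  = ≤-refl
    ... | false = 0≤1

    allOf-rejection-nonNeg : (Ts : Vec (Subset m) k) → 0# ≤ allOf rejection Ts
    allOf-rejection-nonNeg []       = 0≤1
    allOf-rejection-nonNeg (T ∷ Ts) = *-nonNeg (rejection-nonNeg T) (allOf-rejection-nonNeg Ts)

    -- The predicate `P` hands a fact about every draw on to the output; it will be the positivity
    -- of the sampling probability.
    loop-sound : {P : Subset m → Set} (Ts : Vec (Subset m) k) {T : Subset m} {t : ℕ} → All P Ts →
      loop subroutines d X α Ts ≡ just (T , t) → P T × Accepted T
    loop-sound {P = P} (U ∷ Ts) {T} {t} (PU ∷ PTs) result = go em
      where
      go : Dec (Accepted U) → P T × Accepted T
      go (yes accepted) with ≡.trans (≡.sym result) (if-yes em accepted)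
      ... | ≡.refl = PU , accepted
      go (no rejected) = loop-sound Ts PTs (proj₂ (map₂-just _ (≡.trans (≡.sym (if-no em rejected)) result)))

    -- Failure means that all draws are rejected. It is phrased by the product of rejection
    -- indicators, whose expectation `expect-allOf` computes.
    loop-terminates : (u : ℕ) (Ts : Vec (Subset m) k) → All (λ T → drawCost T ℕ.≤ u) Ts →
      (∃₂ λ T t → loop subroutines d X α Ts ≡ just (T , t) × t ℕ.≤ k ℕ.* u) ⊎ allOf rejection Ts ≈ 1#
    loop-terminates u [] [] = inj₂ refl
    loop-terminates {suc k} u (U ∷ Ts) (U≤u ∷ Ts≤u) = go em (loop-terminates u Ts Ts≤u)
      where
      go : Dec (Accepted U) →
        (∃₂ λ T t → loop subroutines d X α Ts ≡ just (T , t) × t ℕ.≤ k ℕ.* u) ⊎ allOf rejection Ts ≈ 1# →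
        (∃₂ λ T t → loop subroutines d X α (U ∷ Ts) ≡ just (T , t) × t ℕ.≤ suc k ℕ.* u) ⊎ allOf rejection (U ∷ Ts) ≈ 1#
      go (yes accepted) _ = inj₁ (U , drawCost U , if-yes em accepted , ℕ.≤-trans U≤u (ℕ.m≤m+n u (k ℕ.* u)))
      go (no rejected) (inj₁ (T , t , result , t≤)) = inj₁ (T , drawCost U ℕ.+ t ,
        ≡.trans (if-no em rejected) (≡.cong (Maybe.map (map₂ (drawCost U ℕ.+_))) result) , ℕ.+-mono-≤ U≤u t≤)
      go (no rejected) (inj₂ ≈1) = inj₂ (trans (*-cong (reflexive (if-no em rejected)) ≈1) (*-identityˡ 1#))

  -- Markov's inequality: rejected sets have squared inverse norm above 1 + η
  -- times the bound on its mean.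
  rejection-probability : {X Y : Matrix n m} → 1 ℕ.≤ n → n ℕ.≤ m → Dual X Y → ∀ d {η} → 0# < η →
    let open Loop X d (threshold n m η (proj₁ (run (normProgram n m) (entries X)))) in
    sumSubsets (λ T → volSamp X T * rejection T) * (1# + η) ≤ 1#
  rejection-probability {n@(suc _)} {m} {X} {Y} 1≤n n≤m dual d {η} 0<η = *-cancelˡ-≤ (*-pos 0<μ 0<Z) (begin
    μ * Z * (sumSubsets (λ T → volSamp X T * rejection T) * (1# + η))
      ≈⟨ *-congˡ (*-congʳ (volSamp-expectation X rejection)) ⟩
    μ * Z * (sumSubsets (λ T → (w ²) T * rejection T) / Z * (1# + η))
      ≈⟨ solve 5 (λ μ z s i h → μ :* z :* (s :* i :* h) := h :* μ :* s :* (z :* i)) refl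
           μ Z (sumSubsets (λ T → (w ²) T * rejection T)) (Z ⁻¹) (1# + η) ⟩
    (1# + η) * μ * sumSubsets (λ T → (w ²) T * rejection T) * (Z * Z ⁻¹)
      ≈⟨ trans (*-congˡ (*-inverseʳ (0<x⇒x≉0 0<Z))) (*-identityʳ _) ⟩
    (1# + η) * μ * sumSubsets (λ T → (w ²) T * rejection T)
      ≈⟨ sumSubsets-* {m} _ _ ⟨
    sumSubsets (λ T → (1# + η) * μ * ((w ²) T * rejection T))
      ≤⟨ sumSubsets-mono-≤ {m} (λ T → pointwise T em em) ⟩
    sumSubsets (inverseWeight X Y)
      ≈⟨ sum-inverseWeight 1≤n n≤m dual ⟩
    μ * Z
      ≈⟨ *-identityʳ _ ⟨
    μ * Z * 1# ∎)
    where
    w = wedge X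
    Z = sumSubsets (w ²)
    K = fromℕ (m ℕ.∸ n ℕ.+ 1)
    μ = K * frobenius Y
    α = threshold n m η (proj₁ (run (normProgram n m) (entries X)))
    open Loop X d α

    0<Z : 0# < Z
    0<Z = totalVolume-pos dual

    0<K : 0# < K
    0<K = <-≤-trans 0<1 (1≤fromℕ (ℕ.m≤n+m 1 (m ℕ.∸ n)))

    -- The existence of a first row is essential: `Y zero` pairs to 1 with `X zero` and so cannot be
    -- zero. This makes `μ` cancellable.
    0<frobenius : 0# < frobenius Y
    0<frobenius = frobenius-nonNeg Y , λ 0≈F → 0≉1 (begin-equality
      0#                    ≈⟨ ∙-zeroˡ {b = X zero} (∣a∣²≈0⇒a≈0 {a = Y zero} (antisym
                                 (≤-trans (term≤sum (λ i → ∣∣²-nonNeg (Y i)) zero) (≤-reflexive (sym 0≈F)))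
                                 (∣∣²-nonNeg (Y zero)))) ⟨
      Y zero ∙ X zero       ≈⟨ pairing dual zero zero ⟩
      1#                    ∎)

    0<μ : 0# < μ
    0<μ = *-pos 0<K 0<frobenius

    α≈ : α ≈ (1# + η) * μ
    α≈ = trans (*-congˡ (value-normProgram-dual dual)) (*-assoc _ _ _)

    pointwise : ∀ T → Dec (w T ≈ 0#) → Dec (Accepted T) → (1# + η) * μ * ((w ²) T * rejection T) ≤ inverseWeight X Y T
    pointwise T (yes w≈0) _ = ≤-trans
      (≤-reflexive (trans (*-congˡ (trans (*-congʳ (trans (*-congʳ w≈0) (zeroˡ _))) (zeroˡ _))) (zeroʳ _)))
      (inverseWeight-nonNeg X Y T)
    pointwise T (no w≉0) (yes accepted) = ≤-trans
      (≤-reflexive (trans (*-congˡ (trans (*-congˡ (reflexive (if-yes em accepted))) (zeroʳ _))) (zeroʳ _)))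
      (inverseWeight-nonNeg X Y T)
    pointwise T (no w≉0) (no rejected) = let B , dualB = wedge≉0⇒columns-dual X T w≉0 in begin
      (1# + η) * μ * ((w ²) T * rejection T)   ≈⟨ *-cong (sym α≈) (trans (*-congˡ (reflexive (if-no em rejected))) (*-identityʳ _)) ⟩
      α * (w ²) T                              ≤⟨ *-monoʳ-≤ (square-nonNeg (w T)) (proj₁ (≰⇒> rejected)) ⟩
      estimate T * (w ²) T                     ≈⟨ *-congʳ (value-normProgram-dual dualB) ⟩
      frobenius B * (w ²) T                    ≈⟨ frobenius-inverse T dual dualB ⟩
      inverseWeight X Y T                      ∎

  accepted-bounds : {X : Matrix n m} → 1 ℕ.≤ n → HasRank X n → ∀ d {η} → 0# < η → (T : Subset m) → 0# < volSamp X T →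
    Loop.Accepted X d (threshold n m η (proj₁ (run (normProgram n m) (entries X)))) T →
      ∣ T ∣ ≡ n
    × Invertible (columns X T)
    × ‖ columns X T ⁺ ‖F ^ 2 ≤ (1# + η) * fromℕ (m ℕ.∸ n ℕ.+ 1) * ‖ X † ‖F ^ 2
    × ‖ columns X T ⁺ ‖₂ ^ 2 ≤ (1# + η) * fromℕ (m ℕ.∸ n ℕ.+ 1) * fromℕ n * ‖ X † ‖₂ ^ 2
  accepted-bounds {n} {m} {X} 1≤n rank d {η} 0<η T 0<p accepted =
    ∣T∣≡n , invertible , frobenius≤ , (begin
      ‖ columns X T ⁺ ‖₂ ^ 2              ≤⟨ ‖‖₂-square-≤ (columns X T ⁺) ⟩
      frobenius (columns X T ⁺)           ≈⟨ ‖‖F-square (columns X T ⁺) ⟨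
      ‖ columns X T ⁺ ‖F ^ 2              ≤⟨ frobenius≤ ⟩
      c * ‖ X † ‖F ^ 2                    ≈⟨ *-congˡ (‖‖F-square (X †)) ⟩
      c * frobenius (X †)                 ≤⟨ *-monoˡ-≤ 0≤c (frobenius≤‖‖₂ (X †)) ⟩
      c * (fromℕ n * ‖ X † ‖₂ ^ 2)        ≈⟨ *-assoc _ _ _ ⟨
      c * fromℕ n * ‖ X † ‖₂ ^ 2          ∎)
    where
    c = (1# + η) * fromℕ (m ℕ.∸ n ℕ.+ 1)
    0≤c : 0# ≤ c
    0≤c = *-nonNeg (+-nonNeg 0≤1 (proj₁ 0<η)) (fromℕ-nonNeg (m ℕ.∸ n ℕ.+ 1))
    w≉0 = volSamp-pos⇒wedge≉0 X T 0<p
    ∣T∣≡n = wedge≉0⇒∣T∣≡n X T w≉0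
    dualB = proj₂ (wedge≉0⇒columns-dual X T w≉0)
    invertible : Invertible (columns X T)
    invertible = _ , dual-square (≡.sym ∣T∣≡n) dualB
    frobenius≤ : ‖ columns X T ⁺ ‖F ^ 2 ≤ c * ‖ X † ‖F ^ 2
    frobenius≤ = begin
      ‖ columns X T ⁺ ‖F ^ 2      ≈⟨ Subroutines.invNorm²-correct subroutines (columns X T) 1≤n invertible ⟨
      Loop.estimate X d 0# T      ≤⟨ accepted ⟩
      threshold n m η _           ≈⟨ *-congˡ (Subroutines.pinvNorm²-correct subroutines X 1≤n rank) ⟩
      c * ‖ X † ‖F ^ 2            ∎

  -- The number of draws

  ^-pos : ∀ {x} → 0# < x → ∀ k → 0# < x ^ k
  ^-pos 0<x zero    = 0<1
  ^-pos 0<x (suc k) = *-pos 0<x (^-pos 0<x k)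

  -- Raises Markov's bound, in its division-free form `q * (1# + η) ≤ 1#`, to a power. Nonnegativity
  -- of the powers travels along because multiplying inequalities requires it.
  ^-product≤1 : ∀ {x y} → 0# ≤ x → 0# ≤ y → x * y ≤ 1# → ∀ k → 0# ≤ x ^ k × 0# ≤ y ^ k × x ^ k * y ^ k ≤ 1#
  ^-product≤1 0≤x 0≤y xy≤1 zero = 0≤1 , 0≤1 , ≤-reflexive (*-identityˡ 1#)
  ^-product≤1 {x} {y} 0≤x 0≤y xy≤1 (suc k) = let 0≤xᵏ , 0≤yᵏ , xᵏyᵏ≤1 = ^-product≤1 0≤x 0≤y xy≤1 k in
    *-nonNeg 0≤x 0≤xᵏ , *-nonNeg 0≤y 0≤yᵏ , (begin
      x * x ^ k * (y * y ^ k)        ≈⟨ solve 4 (λ x s y t → x :* s :* (y :* t) := x :* y :* (s :* t)) refl x (x ^ k) y (y ^ k) ⟩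
      x * y * (x ^ k * y ^ k)        ≤⟨ *-mono-≤ (*-nonNeg 0≤x 0≤y) xy≤1 (*-nonNeg 0≤xᵏ 0≤yᵏ) xᵏyᵏ≤1 ⟩
      1# * 1#                        ≈⟨ *-identityˡ 1# ⟩
      1#                             ∎)

  module Logarithm {log : ℝ → ℝ} (isLogarithm : IsLogarithm log) where
    open IsLogarithm isLogarithm

    log-1 : log 1# ≈ 0#
    log-1 = begin-equality
      log 1#                           ≈⟨ solve 1 (λ x → x := (x :+ x) :- x) refl (log 1#) ⟩
      log 1# + log 1# - log 1#         ≈⟨ +-congʳ (log-* 0<1 0<1) ⟨
      log (1# * 1#) - log 1#           ≈⟨ +-congʳ (log-cong (*-pos 0<1 0<1) (*-identityˡ 1#)) ⟩
      log 1# - log 1#                  ≈⟨ -‿inverseʳ _ ⟩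
      0#                               ∎

    log-^ : ∀ {x} → 0# < x → ∀ k → log (x ^ k) ≈ fromℕ k * log x
    log-^ 0<x zero = trans log-1 (sym (zeroˡ _))
    log-^ {x} 0<x (suc k) = begin-equality
      log (x * x ^ k)            ≈⟨ log-* 0<x (^-pos 0<x k) ⟩
      log x + log (x ^ k)        ≈⟨ +-congˡ (log-^ 0<x k) ⟩
      log x + fromℕ k * log x    ≈⟨ solve 2 (λ l k → l :+ k :* l := (con (+ 1) :+ k) :* l) refl (log x) (fromℕ k) ⟩
      (1# + fromℕ k) * log x     ∎

    log-pos : ∀ {x} → 1# < x → 0# < log x
    log-pos 1<x = let log1≤ , log1≉ = log-mono 0<1 1<x in
      ≤-respˡ-≈ log-1 log1≤ , λ 0≈ → log1≉ (trans log-1 0≈)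

    -- For `k` the ceiling of L = log y / log x, a power `x ^ k` below `y` would contradict
    -- monotonicity of `log`. Rounding gives `k` at most 1 + L, hence at most twice the maximum of 1
    -- and L; the 1 must stay, as L may be arbitrarily small while a draw is still made.
    sufficient-draws : ∀ {x y} → 1# < x → 1# < y →
      ∃ λ k → y ≤ x ^ k × fromℕ k ≤ (1# ⊔ (log y / log x)) + (1# ⊔ (log y / log x))
    sufficient-draws {x} {y} 1<x 1<y =
      let k , L≤k , k≤1+L = ceiling (/-nonNeg (proj₁ (log-pos 1<y)) 0<log) in
      k , ≮⇒≥ (λ xᵏ<y → <⇒≱ (log-mono (^-pos 0<x k) xᵏ<y) (begin
        log y                     ≈⟨ x/y*y≈x (0<x⇒x≉0 0<log) ⟨
        log y / log x * log x     ≤⟨ *-monoʳ-≤ (proj₁ 0<log) L≤k ⟩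
        fromℕ k * log x           ≈⟨ log-^ 0<x k ⟨
        log (x ^ k)               ∎)) ,
      ≤-trans k≤1+L (+-mono-≤ (x≤x⊔y 1# _) (x≤y⊔x 1# _))
      where
      0<x = ≤-trans 0≤1 (proj₁ 1<x) , λ 0≈x → <⇒≱ 1<x (≤-trans (≤-reflexive (sym 0≈x)) 0≤1)
      0<log = log-pos 1<x

  -- Termination within the budget.

  1<1/δ : ∀ {δ} → 0# < δ → δ < 1# → 1# < 1# / δ
  1<1/δ {δ} 0<δ δ<1 = ≰⇒> λ 1/δ≤1 → <⇒≱ δ<1 (begin
    1#               ≈⟨ x/y*y≈x (0<x⇒x≉0 0<δ) ⟨
    1# / δ * δ       ≤⟨ *-monoʳ-≤ (proj₁ 0<δ) 1/δ≤1 ⟩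
    1# * δ           ≈⟨ *-identityˡ δ ⟩
    δ                ∎)

  -- A single finite horizon suffices, as `prob∞` dominates it. There the indicator of success is at
  -- least 1 minus the product of the rejection indicators, and that product has expectation
  -- `q ^ rounds` by independence.
  termination-probability : {X : Matrix n m} → 1 ℕ.≤ n → n ℕ.≤ m → HasRank X n →
    ∀ {d c} → d ℕ.≤ c ℕ.* (n ℕ.^ 3 ℕ.* m) → ∀ {η} → 0# < η →
    ∀ {log} → IsLogarithm log → ∀ {δ} → 0# < δ → δ < 1# →
    1# - δ ≤ prob∞ (volSamp X) (TerminatesWithin subroutines d X η
      (fromℕ ((14 ℕ.+ ((c ℕ.+ 10) ℕ.+ (c ℕ.+ 10))) ℕ.* (m ℕ.* n ℕ.^ 3)) * (1# ⊔ (log (1# / δ) / log (1# + η)))))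
  termination-probability {n} {m} {X} 1≤n n≤m rank {d} {c} d≤ {η} 0<η {log} isLogarithm {δ} 0<δ δ<1 = begin
    1# - δ
      ≤⟨ +-monoʳ-≤ 1# (neg-mono-≤ qᵏ≤δ) ⟩
    1# - q ^ rounds
      ≈⟨ +-congˡ (-‿cong (*-identityˡ _)) ⟨
    1# - 1# * q ^ rounds
      ≈⟨ expect-allOf (volSamp-total dual) rejection rounds 1# 1# ⟨
    expect (volSamp X) rounds (λ Ts → 1# - 1# * allOf rejection Ts)
      ≤⟨ expect-mono-≤ 0≤p (λ Ts pos → indicator Ts em (loop-terminates u Ts (All.map (λ {T} → drawCost≤u T) pos))) ⟩
    prob (volSamp X) rounds E
      ≤⟨ prob≤prob∞ 0≤p (volSamp-total dual) E rounds ⟩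
    prob∞ (volSamp X) E ∎
    where
    dual = proj₂ (fullRank-dual rank)
    0≤p = volSamp-nonNeg dual
    pinv = run (normProgram n m) (entries X)
    open Loop X d (threshold n m η (proj₁ pinv))
    open Logarithm isLogarithm

    N u : ℕ
    N = m ℕ.* n ℕ.^ 3
    u = (c ℕ.+ 10) ℕ.* N
    M b : ℝ
    M = 1# ⊔ (log (1# / δ) / log (1# + η))
    b = fromℕ ((14 ℕ.+ ((c ℕ.+ 10) ℕ.+ (c ℕ.+ 10))) ℕ.* N) * M

    E : ∀ {k} → Vec (Subset m) k → Set
    E = TerminatesWithin subroutines d X η b

    1<1+η : 1# < 1# + η
    1<1+η = difference⇒≤ (solve 1 (λ h → con (+ 1) :+ h :- con (+ 1) := h) refl η) (proj₁ 0<η) ,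
      λ 1≈1+η → proj₂ 0<η (+-cancelˡ 1# _ _ (trans (+-identityʳ 1#) 1≈1+η))

    draws = sufficient-draws 1<1+η (1<1/δ 0<δ δ<1)
    rounds = proj₁ draws

    q = sumSubsets λ T → volSamp X T * rejection T

    qᵏ≤δ : q ^ rounds ≤ δ
    qᵏ≤δ = let 0≤qᵏ , _ , product≤1 = ^-product≤1 (sumSubsets-nonNeg λ T → *-nonNeg (0≤p T) (rejection-nonNeg T))
                 (+-nonNeg 0≤1 (proj₁ 0<η)) (rejection-probability 1≤n n≤m dual d 0<η) rounds in begin
      q ^ rounds                       ≈⟨ x/y*y≈x (0<x⇒x≉0 0<δ) ⟨
      q ^ rounds / δ * δ               ≈⟨ *-congʳ (*-congˡ (*-identityˡ _)) ⟨
      -- `1# / δ` is enlarged to `(1# + η) ^ rounds`, whose product with `q ^ rounds` is at most 1.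
      q ^ rounds * (1# / δ) * δ        ≤⟨ *-monoʳ-≤ (proj₁ 0<δ) (≤-trans (*-monoˡ-≤ 0≤qᵏ (proj₁ (proj₂ draws))) product≤1) ⟩
      1# * δ                      ≈⟨ *-identityˡ δ ⟩
      δ                           ∎

    drawCost≤u : ∀ T → 0# < volSamp X T → drawCost T ℕ.≤ u
    drawCost≤u T 0<p = Counting.draw-cost c 1≤n (ℕ.≤-trans 1≤n n≤m)
      (ℕ.≤-trans (cost-normProgram (columns X T) (ℕ.≤-trans 1≤n (ℕ.≤-reflexive (≡.sym ∣T∣≡n))) (ℕ.≤-reflexive (≡.sym ∣T∣≡n)))
        (ℕ.*-monoˡ-≤ (n ℕ.* n) (ℕ.*-monoʳ-≤ 9 (ℕ.≤-trans (ℕ.≤-reflexive ∣T∣≡n) n≤m)))) d≤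
      where ∣T∣≡n = wedge≉0⇒∣T∣≡n X T (volSamp-pos⇒wedge≉0 X T 0<p)

    setup≤ : proj₂ pinv ℕ.+ 5 ℕ.≤ 14 ℕ.* N
    setup≤ = Counting.setup-cost 1≤n (ℕ.≤-trans 1≤n n≤m) (cost-normProgram X (ℕ.≤-trans 1≤n n≤m) n≤m)

    within-budget : ∀ {t} → t ℕ.≤ rounds ℕ.* u → fromℕ (proj₂ pinv ℕ.+ 5 ℕ.+ t) ≤ b
    within-budget {t} t≤ = begin
      fromℕ (proj₂ pinv ℕ.+ 5 ℕ.+ t)             ≤⟨ fromℕ-mono-≤ (ℕ.+-mono-≤ setup≤ t≤) ⟩
      fromℕ (14 ℕ.* N ℕ.+ rounds ℕ.* u)               ≈⟨ fromℕ-+ (14 ℕ.* N) (rounds ℕ.* u) ⟩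
      fromℕ (14 ℕ.* N) + fromℕ (rounds ℕ.* u)         ≈⟨ +-congˡ (fromℕ-* rounds u) ⟩
      -- `M` is at least 1 and thereby absorbs the set-up cost; the bound `M + M` on the number of
      -- rounds accounts for the two copies of `u`.
      fromℕ (14 ℕ.* N) + fromℕ rounds * fromℕ u       ≤⟨ +-mono-≤
          (≤-trans (≤-reflexive (sym (*-identityʳ _))) (*-monoˡ-≤ (fromℕ-nonNeg (14 ℕ.* N)) (x≤x⊔y 1# (log (1# / δ) / log (1# + η)))))
          (*-monoʳ-≤ (fromℕ-nonNeg u) (proj₂ (proj₂ draws))) ⟩
      fromℕ (14 ℕ.* N) * M + (M + M) * fromℕ u   ≈⟨ solve 3 (λ s M u → s :* M :+ (M :+ M) :* u := (s :+ (u :+ u)) :* M) refl (fromℕ (14 ℕ.* N)) M (fromℕ u) ⟩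
      (fromℕ (14 ℕ.* N) + (fromℕ u + fromℕ u)) * M ≈⟨ *-congʳ (trans (fromℕ-+ (14 ℕ.* N) (u ℕ.+ u)) (+-congˡ (fromℕ-+ u u))) ⟨
      fromℕ (14 ℕ.* N ℕ.+ (u ℕ.+ u)) * M         ≡⟨ ≡.cong (λ j → fromℕ j * M) (Counting.budget c N) ⟩
      b                                          ∎

    indicator : (Ts : Vec (Subset m) rounds) (E? : Dec (E Ts)) →
      (∃₂ λ T t → loop subroutines d X (threshold n m η (proj₁ pinv)) Ts ≡ just (T , t) × t ℕ.≤ rounds ℕ.* u) ⊎ allOf rejection Ts ≈ 1# →
      1# - 1# * allOf rejection Ts ≤ (if does E? then 1# else 0#)
    indicator Ts E? (inj₁ (T , t , result , t≤)) = begin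
      1# - 1# * allOf rejection Ts   ≤⟨ difference⇒≤ (solve 1 (λ r → con (+ 1) :- (con (+ 1) :- con (+ 1) :* r) := r) refl (allOf rejection Ts)) (allOf-rejection-nonNeg Ts) ⟩
      1#                             ≡⟨ if-yes E? (T , _ , ≡.cong (Maybe.map (map₂ (proj₂ pinv ℕ.+ 5 ℕ.+_))) result , within-budget t≤) ⟨
      (if does E? then 1# else 0#)   ∎
    indicator Ts E? (inj₂ ≈1) = begin
      1# - 1# * allOf rejection Ts   ≈⟨ +-congˡ (-‿cong (trans (*-identityˡ _) ≈1)) ⟩
      1# - 1#                        ≈⟨ -‿inverseʳ 1# ⟩
      0#                             ≤⟨ 0≤indicator E? ⟩
      (if does E? then 1# else 0#)   ∎
      where
      0≤indicator : {P : Set} (P? : Dec P) → 0# ≤ (if does P? then 1# else 0#)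
      0≤indicator (yes _) = 0≤1
      0≤indicator (no _)  = ≤-refl

  algorithm-sound : {X : Matrix n m} → 1 ℕ.≤ n → HasRank X n → ∀ d {η} → 0# < η →
    (draws : Vec (Subset m) k) (T : Subset m) (t : ℕ) → All (λ U → 0# < volSamp X U) draws →
    algorithm subroutines d X η draws ≡ just (T , t) →
      ∣ T ∣ ≡ n
    × Invertible (columns X T)
    × ‖ columns X T ⁺ ‖F ^ 2 ≤ (1# + η) * fromℕ (m ℕ.∸ n ℕ.+ 1) * ‖ X † ‖F ^ 2
    × ‖ columns X T ⁺ ‖₂ ^ 2 ≤ (1# + η) * fromℕ (m ℕ.∸ n ℕ.+ 1) * fromℕ n * ‖ X † ‖₂ ^ 2
  algorithm-sound {n} {m} {X = X} 1≤n rank d {η} 0<η draws T t positive result =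
    let 0<p , accepted = loop-sound draws positive (proj₂ (map₂-just (loop subroutines d X α draws) result))
    in accepted-bounds 1≤n rank d 0<η T 0<p accepted
    where
    α = threshold n m η (proj₁ (run (normProgram n m) (entries X)))
    open Loop X d α

theorem3p11 : (em : ExcludedMiddle 0ℓ) (reals : CompleteOrderedField) →
    let open Theory em reals in
    (drawCost : ℕ → ℕ → ℕ) (c : ℕ) →
    (∀ n m → 1 ℕ.≤ n → n ℕ.≤ m → drawCost n m ℕ.≤ c ℕ.* (n ℕ.^ 3 ℕ.* m)) →
    Σ[ S ∈ Subroutines ] Σ[ C ∈ ℕ ]
    (∀ (n m : ℕ) → 1 ℕ.≤ n → n ℕ.≤ m →
    (X : Matrix n m) → HasRank X n →
    (η : ℝ) → 0# < η →
    (∀ (k : ℕ) (draws : Vec (Subset m) k) (T : Subset m) (t : ℕ) →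
    All (λ U → 0# < volSamp X U) draws →
    algorithm S (drawCost n m) X η draws ≡ just (T , t) →
    ∣ T ∣ ≡ n
    × Invertible (columns X T)
    × ‖ columns X T ⁺ ‖F ^ 2 ≤ (1# + η) * fromℕ (m ℕ.∸ n ℕ.+ 1) * ‖ X † ‖F ^ 2
    × ‖ columns X T ⁺ ‖₂ ^ 2 ≤ (1# + η) * fromℕ (m ℕ.∸ n ℕ.+ 1) * fromℕ n * ‖ X † ‖₂ ^ 2)
    × (∀ (log : ℝ → ℝ) → IsLogarithm log →
    (δ : ℝ) → 0# < δ → δ < 1# →
    1# - δ ≤ prob∞ (volSamp X)
    (TerminatesWithin S (drawCost n m) X η
    (fromℕ (C ℕ.* (m ℕ.* n ℕ.^ 3)) * (1# ⊔ (log (1# / δ) / log (1# + η)))))))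
theorem3p11 em reals drawCost c drawCost≤ =
  -- The constant depends on `c` alone and is fixed before the dimensions, the matrix, `η` and `δ`.
  subroutines em reals , 14 ℕ.+ ((c ℕ.+ 10) ℕ.+ (c ℕ.+ 10)) , λ n m 1≤n n≤m X rank η 0<η →
    (λ k draws T t → algorithm-sound em reals {X = X} 1≤n rank (drawCost n m) {η} 0<η draws T t) ,
    (λ log isLogarithm δ 0<δ δ<1 →
      termination-probability em reals {X = X} 1≤n n≤m rank {drawCost n m} {c} (drawCost≤ n m 1≤n n≤m) {η} 0<η
        {log} isLogarithm {δ} 0<δ δ<1)
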